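{- Let $G$ be any Abelian group; for $\varepsilon>0$ let $L(\varepsilon)$ denote the maximum, over all $n$ and all $f:\{0,1\}^n\to G$, of $|\mathsf{List}^f_\varepsilon|$ (which is at most $\mathrm{poly}(1/\varepsilon)$). Fix $n\in\mathbb{N}$ and $\varepsilon>0$. There exists a randomized algorithm $\mathcal{A}_1$ that, given oracle access to $f:\{0,1\}^n\to G$, makes at most $O_\varepsilon(1)$ queries to $f$ and outputs deterministic oracle algorithms $\psi_1,\dots,\psi_{L'}$, with $L'=O(L(\varepsilon/2)\log L(\varepsilon/2))$, such that with probability at least $3/4$ the following holds: for every $P\in\mathsf{List}^f_\varepsilon$ there exists $j\in[L']$ with $\delta(\psi_j^f,P)\le1/100$, where $\psi_j^f:\{0,1\}^n\to G$ is the function computed by $\psi_j$ with oracle access to $f$; moreover, on every input $x\in\{0,1\}^n$, each $\psi_j$ makes at most $O_\varepsilon(1)$ queries to $f$.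
   Context: $\mathcal{P}_1(\{0,1\}^n,G)$ is the set of functions $P(x)=a_0+\sum_{i=1}^n a_ix_i$, $a_i\in G$, $x\in\{0,1\}^n$. $\delta(f,P)=\Pr_{x\sim\{0,1\}^n}[f(x)\ne P(x)]$ and $\mathsf{List}^f_\varepsilon=\{P\in\mathcal{P}_1(\{0,1\}^n,G):\delta(f,P)\le 1/2-\varepsilon\}$. Algorithms may store group elements, perform group operations and test equality of group elements. $O_\varepsilon(1)$ denotes a quantity depending only on $\varepsilon$.
   Formalization: The parameter ε ranges over positive rational numbers instead of positive real numbers. -}

module Defs where

open import Level using (Level)
open import Algebra.Bundles using (AbelianGroup)
open import Data.Bool using (Bool; true; false; if_then_else_)
open import Data.Nat as ℕ using (ℕ; zero; suc; _^_)
open import Data.Nat.Properties using (m^n≢0)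
open import Data.Integer using (+_)
open import Data.Rational using (ℚ; _/_; _≤_; _-_; ½)
open import Data.Fin using (Fin)
open import Data.Vec using (Vec; []; _∷_; lookup)
open import Data.List using (List; []; _∷_; _++_; map; filter; length)
open import Data.List.Relation.Unary.Any using (Any)
open import Data.List.Relation.Unary.All using (All)
open import Data.List.Relation.Unary.AllPairs using (AllPairs)
open import Data.Product using (Σ; ∃; _×_; _,_)
open import Relation.Binary using (Decidable)
open import Relation.Nullary using (¬_; yes; no; ¬?)


Cube : ℕ → Set
Cube n = Vec Bool n

allPoints : (n : ℕ) → List (Cube n)
allPoints zero    = [] ∷ []
allPoints (suc n) = map (true ∷_) (allPoints n) ++ map (false ∷_) (allPoints n)

-- Syntactic model of oracle algorithms over an (unknown) abelian group G.
-- A program keeps a register file of m group elements.  It may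
--   * query the oracle f at a point x ∈ {0,1}^n (storing f x),
--   * perform group operations on stored elements (∙, ⁻¹, unit),
--   * branch on equality of two stored elements,
--   * halt with an output of type O m (which may refer to registers).
-- All other (bit-level) computation is unrestricted and is represented by
-- the shape of the tree (queried points may depend arbitrarily on the path).

data Prog (O : ℕ → Set) (n : ℕ) : ℕ → Set where
  out   : ∀ {m} → O m → Prog O n m
  query : ∀ {m} → Cube n → Prog O n (suc m) → Prog O n m
  mul   : ∀ {m} → Fin m → Fin m → Prog O n (suc m) → Prog O n m
  inv   : ∀ {m} → Fin m → Prog O n (suc m) → Prog O n m
  unit  : ∀ {m} → Prog O n (suc m) → Prog O n m
  test  : ∀ {m} → Fin m → Fin m → Prog O n m → Prog O n m → Prog O n m

-- A deterministic oracle algorithm ψ : on input x ∈ {0,1}^n it runs a program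
-- starting with m stored group elements (hard-wired constants) and outputs
-- the content of one register.
Psi : ℕ → ℕ → Set
Psi n m = Cube n → Prog Fin n m

-- Output of the algorithm A₁: a list of deterministic oracle algorithms ψⱼ,
-- whose hard-wired constants are A₁'s final registers.
PsiList : ℕ → ℕ → Set
PsiList n m = List (Psi n m)

-- A randomized oracle algorithm using r uniformly random coins,
-- starting with no stored group elements.
RandAlg : ℕ → ℕ → Set
RandAlg n r = Vec Bool r → Prog (PsiList n) n 0

module WithGroup {c ℓ : Level} (G : AbelianGroup c ℓ)
                 (_≟_ : Decidable (AbelianGroup._≈_ G)) where

  open AbelianGroup G using (Carrier; _≈_; _∙_; ε; _⁻¹)

  exec : ∀ {O n m} → (Cube n → Carrier) → Prog O n m → Vec Carrier m
       → Σ ℕ (λ k → O k × Vec Carrier k)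
  exec f (out o)        rs = _ , o , rs
  exec f (query x p)    rs = exec f p (f x ∷ rs)
  exec f (mul i j p)    rs = exec f p ((lookup rs i ∙ lookup rs j) ∷ rs)
  exec f (inv i p)      rs = exec f p ((lookup rs i ⁻¹) ∷ rs)
  exec f (unit p)       rs = exec f p (ε ∷ rs)
  exec f (test i j p q) rs with lookup rs i ≟ lookup rs j
  ... | yes _ = exec f p rs
  ... | no  _ = exec f q rs

  queries : ∀ {O n m} → (Cube n → Carrier) → Prog O n m → Vec Carrier m → ℕ
  queries f (out o)        rs = 0
  queries f (query x p)    rs = suc (queries f p (f x ∷ rs))
  queries f (mul i j p)    rs = queries f p ((lookup rs i ∙ lookup rs j) ∷ rs)
  queries f (inv i p)      rs = queries f p ((lookup rs i ⁻¹) ∷ rs)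
  queries f (unit p)       rs = queries f p (ε ∷ rs)
  queries f (test i j p q) rs with lookup rs i ≟ lookup rs j
  ... | yes _ = queries f p rs
  ... | no  _ = queries f q rs

  runPsi : ∀ {n m} → (Cube n → Carrier) → Psi n m → Vec Carrier m → Cube n → Carrier
  runPsi f ψ rs x with exec f (ψ x) rs
  ... | _ , o , rs' = lookup rs' o

  record Affine (n : ℕ) : Set c where
    constructor affine
    field
      a₀ : Carrier
      a  : Vec Carrier n

  linear : ∀ {n} → Vec Carrier n → Cube n → Carrier
  linear []       []       = ε
  linear (aᵢ ∷ a) (b ∷ x)  = (if b then aᵢ else ε) ∙ linear a x

  evalA : ∀ {n} → Affine n → Cube n → Carrier
  evalA (affine a₀ a) x = a₀ ∙ linear a x

  δ : ∀ {n} → (Cube n → Carrier) → (Cube n → Carrier) → ℚ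
  δ {n} f g = _/_ (+ length (filter (λ x → ¬? (f x ≟ g x)) (allPoints n)))
                  (2 ^ n) {{m^n≢0 2 n}}

  InList : ∀ {n} → (Cube n → Carrier) → ℚ → Affine n → Set
  InList f ε' P = δ f (evalA P) ≤ ½ - ε'

  Distinct : ∀ {n} → Affine n → Affine n → Set ℓ
  Distinct P Q = ¬ (∀ x → evalA P x ≈ evalA Q x)

  IsMaxListSize : ℚ → ℕ → Set (c Level.⊔ ℓ)
  IsMaxListSize ε' L =
      (∀ n (f : Cube n → Carrier) (Ps : List (Affine n))
         → AllPairs Distinct Ps → All (InList f ε') Ps → length Ps ℕ.≤ L)
    × (∃ λ n → Σ (Cube n → Carrier) λ f → Σ (List (Affine n)) λ Ps
         → AllPairs Distinct Ps × All (InList f ε') Ps × length Ps ≡ L)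
    where open import Relation.Binary.PropositionalEquality using (_≡_)

  outputs : ∀ {n r} → (Cube n → Carrier) → RandAlg n r → Vec Bool r
          → Σ ℕ (λ k → PsiList n k × Vec Carrier k)
  outputs f A ω = exec f (A ω) []

  Good : ∀ {n r} → (Cube n → Carrier) → ℚ → RandAlg n r → Vec Bool r → Set c
  Good f ε' A ω with outputs f A ω
  ... | k , ψs , rs =
    ∀ (P : Affine _) → InList f ε' P
      → Any (λ ψ → δ (runPsi f ψ rs) (evalA P) ≤ (+ 1 / 100)) ψs

  numOut : ∀ {n r} → (Cube n → Carrier) → RandAlg n r → Vec Bool r → ℕ
  numOut f A ω with outputs f A ω
  ... | k , ψs , rs = length ψs

  PsiQueryBound : ∀ {n r} → (Cube n → Carrier) → RandAlg n r → Vec Bool r → ℕ → Set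
  PsiQueryBound f A ω q with outputs f A ω
  ... | k , ψs , rs = All (λ ψ → ∀ x → queries f (ψ x) rs ℕ.≤ q) ψs

{-# OPTIONS --safe #-}
-- Call the affine functions within distance 1/2 − η of the oracle f (η = ε/2) listed.
--
-- Uniform list bound.  In a given direction the coefficients of listed functions take at most 1/(2η) values,
-- since each value is witnessed by a 2η-fraction of the edges.  So a long list contains P₀, P₁, … such that, for
-- suitable directions b₀, b₁, …, the coefficients of all P_t with t > s at b_s coincide and differ from that of P_s.
-- For s < u the event "P_s = P_u" cannot hold at both ends of an edge in direction b_s, and flipping b_s does not
-- affect the events "P_t = P_u" with t, u > s.  For fixed u the events "P_s = P_u" thus form a process with
-- conditional probabilities at most 1/2 and uncorrelated increments: with high probability no value is shared by
-- many more than half of the P_s, so their average agreement with f is at most 1/2 + o(1).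
--
-- Correction.  Choose a point a, points t₁, …, t_q and a position r at random.  The points a and a ⊕ t_i generate a
-- subcube of dimension 2^q which is a good sample of {0,1}ⁿ.  Replacing a ⊕ t_r by the input x gives a second
-- such subcube, which meets the first one in the subcube C_r generated by the remaining points.  The j-th oracle
-- algorithm takes the j-th listed function on the first subcube, looks for a listed function on the second one
-- with the same restriction to C_r, and evaluates it at x.  It errs only if some listed function on the second
-- subcube agrees with P on C_r but not at x.  Such functions are different for different r, because the r-th
-- generator lies in C_r′ for every r′ ≠ r; so by the list bound a random r is bad with probability O(1/q).
module Submission where

open import Defs
open import Algebra.Bundles using (AbelianGroup)
open import Data.Nat using (ℕ)
open import Data.Rational using (ℚ)
open import Relation.Binary using (Decidable)

-- `Q` is chosen before the group, so the maximal list size `L` of the given group must not enter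
-- the query bound: this is why an explicit bound in `ε` alone, valid for all groups, is needed. `L`
-- itself only limits the number of algorithms that are output. Distances are at most 1/2 - ε
-- globally and are tested locally against 1/2 - ε/2; the gap `η` absorbs the sampling error. The
-- first subcube does not involve x, hence the index j names one function for all inputs. If x is
-- uniform, replacing the r-th point gives a tuple with the original law for every r, so r is still
-- a fresh random position for the second subcube. `G` may be infinite and only offers equality
-- tests, hence local lists are found by enumerating the places where coefficients can be read off
-- from oracle values.

module Expectation where
  open import Data.Bool using (Bool; true; false; not; _xor_; if_then_else_)
  open import Data.Fin using (Fin; zero; suc)
  open import Data.Nat as ℕ using (ℕ; zero; suc; _^_)
  import Data.Nat.Properties as ℕₚ
  import Data.Integer as ℤ
  import Data.Integer.Properties as ℤₚ
  open import Data.Rational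
  open import Data.Rational.Properties
  open import Data.Rational.Solver using (module +-*-Solver)
  import Data.Rational.Unnormalised as ℚᵘ
  import Data.Rational.Unnormalised.Properties as ℚᵘₚ
  open import Data.Vec using (Vec; []; _∷_; zipWith; _++_; _[_]%=_)
  open import Data.List as List using (List)
  import Data.List.Properties as List
  open import Data.Empty using (⊥-elim)
  open import Data.Sum using (inj₁; inj₂)
  open import Function using (_∘_)
  open import Relation.Nullary using (yes; no; does)
  open import Relation.Unary using () renaming (Decidable to Decidable₁)
  open import Relation.Binary.PropositionalEquality

  open +-*-Solver using (solve; _:+_; _:*_; _:-_; :-_; _:=_; con)

  -- Ordered-field lemmas and the embedding of ℕ into ℚ.

  infix 8 _²
  _² : ℚ → ℚ
  p ² = p * p

  fromℕ : ℕ → ℚ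
  fromℕ zero    = 0ℚ
  fromℕ (suc n) = 1ℚ + fromℕ n

  ind : Bool → ℚ
  ind b = if b then 1ℚ else 0ℚ

  0≤1 : 0ℚ ≤ 1ℚ
  0≤1 = nonNegative⁻¹ 1ℚ

  0≤½ : 0ℚ ≤ ½
  0≤½ = nonNegative⁻¹ ½

  -- Polynomial inequalities are proved in this form throughout: the gap is exhibited as a visibly
  -- nonnegative term, and the remaining identity goes to the ring solver.
  ≤-from-gap : ∀ {p q} d → 0ℚ ≤ d → q ≡ p + d → p ≤ q
  ≤-from-gap {p} d 0≤d refl = subst (_≤ p + d) (+-identityʳ p) (+-monoʳ-≤ p 0≤d)

  gap : ∀ {p q} → p ≤ q → 0ℚ ≤ q - p
  gap {p} {q} p≤q = subst (_≤ q - p) (+-inverseʳ p) (+-monoˡ-≤ (- p) p≤q)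

  0≤+ : ∀ {p q} → 0ℚ ≤ p → 0ℚ ≤ q → 0ℚ ≤ p + q
  0≤+ 0≤p 0≤q = +-mono-≤ 0≤p 0≤q

  0≤* : ∀ {p q} → 0ℚ ≤ p → 0ℚ ≤ q → 0ℚ ≤ p * q
  0≤* {p} {q} 0≤p 0≤q =
    subst (_≤ p * q) (*-zeroʳ p) (*-monoˡ-≤-nonNeg p {{nonNegative 0≤p}} 0≤q)

  *-monoˡ : ∀ {r p q} → 0ℚ ≤ r → p ≤ q → r * p ≤ r * q
  *-monoˡ {r} 0≤r = *-monoˡ-≤-nonNeg r {{nonNegative 0≤r}}

  *-mono : ∀ {p q r s} → 0ℚ ≤ p → 0ℚ ≤ s → p ≤ q → r ≤ s → p * r ≤ q * s
  *-mono {p} {q} {r} {s} 0≤p 0≤s p≤q r≤s =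
    ≤-trans (*-monoˡ 0≤p r≤s) (*-monoʳ-≤-nonNeg s {{nonNegative 0≤s}} p≤q)

  0≤² : ∀ p → 0ℚ ≤ p ²
  0≤² p with ≤-total 0ℚ p
  ... | inj₁ 0≤p = 0≤* 0≤p 0≤p
  ... | inj₂ p≤0 = subst (0ℚ ≤_) (solve 1 (λ x → (:- x) :* (:- x) := x :* x) refl p) (0≤* 0≤-p 0≤-p)
    where
    0≤-p : 0ℚ ≤ - p
    0≤-p = neg-antimono-≤ p≤0

  0≤fromℕ : ∀ n → 0ℚ ≤ fromℕ n
  0≤fromℕ zero    = ≤-refl
  0≤fromℕ (suc n) = 0≤+ 0≤1 (0≤fromℕ n)

  fromℕ-+ : ∀ m n → fromℕ (m ℕ.+ n) ≡ fromℕ m + fromℕ n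
  fromℕ-+ zero    n = sym (+-identityˡ (fromℕ n))
  fromℕ-+ (suc m) n = trans (cong (1ℚ +_) (fromℕ-+ m n)) (sym (+-assoc 1ℚ (fromℕ m) (fromℕ n)))

  fromℕ-* : ∀ m n → fromℕ (m ℕ.* n) ≡ fromℕ m * fromℕ n
  fromℕ-* zero    n = sym (*-zeroˡ (fromℕ n))
  fromℕ-* (suc m) n = begin
    fromℕ (n ℕ.+ m ℕ.* n)         ≡⟨ fromℕ-+ n (m ℕ.* n) ⟩
    fromℕ n + fromℕ (m ℕ.* n)     ≡⟨ cong (fromℕ n +_) (fromℕ-* m n) ⟩
    fromℕ n + fromℕ m * fromℕ n   ≡⟨ solve 2 (λ x y → y :+ x :* y := (con 1ℚ :+ x) :* y) refl (fromℕ m) (fromℕ n) ⟩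
    fromℕ (suc m) * fromℕ n       ∎
    where open ≡-Reasoning

  fromℕ-mono : ∀ {m n} → m ℕ.≤ n → fromℕ m ≤ fromℕ n
  fromℕ-mono {n = n} ℕ.z≤n     = 0≤fromℕ n
  fromℕ-mono (ℕ.s≤s m≤n) = +-monoʳ-≤ 1ℚ (fromℕ-mono m≤n)

  fromℕ-cancel : ∀ {m n} → fromℕ m ≤ fromℕ n → m ℕ.≤ n
  fromℕ-cancel {m} {n} le with m ℕ.≤? n
  ... | yes m≤n = m≤n
  ... | no  m≰n = contradiction′ (≤-trans (fromℕ-mono (ℕₚ.≰⇒> m≰n)) le)
    where
    contradiction′ : 1ℚ + fromℕ n ≤ fromℕ n → m ℕ.≤ n
    contradiction′ h = ⊥-elim (<-irrefl refl (<-≤-trans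
      (subst (_< 1ℚ + fromℕ n) (+-identityˡ (fromℕ n)) (+-monoˡ-< (fromℕ n) (positive⁻¹ 1ℚ))) h))

  ind-nonneg : ∀ b → 0ℚ ≤ ind b
  ind-nonneg true  = 0≤1
  ind-nonneg false = ≤-refl

  ind≤1 : ∀ b → ind b ≤ 1ℚ
  ind≤1 true  = ≤-refl
  ind≤1 false = 0≤1

  -- Expectation over the uniform cube.

  E : ∀ n → (Cube n → ℚ) → ℚ
  E zero    F = F []
  E (suc n) F = ½ * (E n (F ∘ (true ∷_)) + E n (F ∘ (false ∷_)))

  E-cong : ∀ {n} {F H : Cube n → ℚ} → (∀ x → F x ≡ H x) → E n F ≡ E n H
  E-cong {zero}  F≡H = F≡H []
  E-cong {suc n} F≡H = cong (½ *_) (cong₂ _+_ (E-cong (F≡H ∘ (true ∷_))) (E-cong (F≡H ∘ (false ∷_))))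

  E-mono : ∀ {n} {F H : Cube n → ℚ} → (∀ x → F x ≤ H x) → E n F ≤ E n H
  E-mono {zero}  F≤H = F≤H []
  E-mono {suc n} F≤H = *-monoˡ 0≤½ (+-mono-≤ (E-mono (F≤H ∘ (true ∷_))) (E-mono (F≤H ∘ (false ∷_))))

  E-const : ∀ n c → E n (λ _ → c) ≡ c
  E-const zero    c = refl
  E-const (suc n) c = trans (cong (λ e → ½ * (e + e)) (E-const n c))
    (solve 1 (λ x → con ½ :* (x :+ x) := x) refl c)

  E-nonneg : ∀ {n} {F : Cube n → ℚ} → (∀ x → 0ℚ ≤ F x) → 0ℚ ≤ E n F
  E-nonneg {n} {F} 0≤F = subst (_≤ E n F) (E-const n 0ℚ) (E-mono 0≤F)

  E-≤const : ∀ {n} {F : Cube n → ℚ} {c} → (∀ x → F x ≤ c) → E n F ≤ c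
  E-≤const {n} {F} {c} F≤c = subst (E n F ≤_) (E-const n c) (E-mono F≤c)

  E-+ : ∀ {n} (F H : Cube n → ℚ) → E n (λ x → F x + H x) ≡ E n F + E n H
  E-+ {zero}  F H = refl
  E-+ {suc n} F H = trans
    (cong (½ *_) (cong₂ _+_ (E-+ (F ∘ (true ∷_)) (H ∘ (true ∷_))) (E-+ (F ∘ (false ∷_)) (H ∘ (false ∷_)))))
    (solve 4 (λ a b c d → con ½ :* ((a :+ b) :+ (c :+ d)) := con ½ :* (a :+ c) :+ con ½ :* (b :+ d)) refl
      (E n (F ∘ (true ∷_))) (E n (H ∘ (true ∷_))) (E n (F ∘ (false ∷_))) (E n (H ∘ (false ∷_))))

  E-*ˡ : ∀ {n} c (F : Cube n → ℚ) → E n (λ x → c * F x) ≡ c * E n F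
  E-*ˡ {zero}  c F = refl
  E-*ˡ {suc n} c F = trans
    (cong (½ *_) (cong₂ _+_ (E-*ˡ c (F ∘ (true ∷_))) (E-*ˡ c (F ∘ (false ∷_)))))
    (solve 3 (λ c a b → con ½ :* (c :* a :+ c :* b) := c :* (con ½ :* (a :+ b))) refl
      c (E n (F ∘ (true ∷_))) (E n (F ∘ (false ∷_))))

  E-swap : ∀ m n (F : Cube m → Cube n → ℚ) →
           E m (λ x → E n (F x)) ≡ E n (λ y → E m (λ x → F x y))
  E-swap zero    n F = refl
  E-swap (suc m) n F = begin
    ½ * (E m (λ x → E n (F (true ∷ x))) + E m (λ x → E n (F (false ∷ x))))
      ≡⟨ cong (½ *_) (cong₂ _+_ (E-swap m n (F ∘ (true ∷_))) (E-swap m n (F ∘ (false ∷_)))) ⟩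
    ½ * (E n (λ y → E m (λ x → F (true ∷ x) y)) + E n (λ y → E m (λ x → F (false ∷ x) y)))
      ≡⟨ cong (½ *_) (E-+ (λ y → E m (λ x → F (true ∷ x) y)) (λ y → E m (λ x → F (false ∷ x) y))) ⟨
    ½ * E n (λ y → E m (λ x → F (true ∷ x) y) + E m (λ x → F (false ∷ x) y))
      ≡⟨ E-*ˡ ½ (λ y → E m (λ x → F (true ∷ x) y) + E m (λ x → F (false ∷ x) y)) ⟨
    E n (λ y → E (suc m) (λ x → F x y)) ∎
    where open ≡-Reasoning

  E-++ : ∀ m {n} (F : Cube (m ℕ.+ n) → ℚ) → E (m ℕ.+ n) F ≡ E m (λ u → E n (λ v → F (u ++ v)))
  E-++ zero    F = refl
  E-++ (suc m) F = cong (½ *_) (cong₂ _+_ (E-++ m (F ∘ (true ∷_))) (E-++ m (F ∘ (false ∷_))))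

  infixl 6 _⊕_
  _⊕_ : ∀ {n} → Cube n → Cube n → Cube n
  _⊕_ = zipWith _xor_

  E-⊕ : ∀ {n} (w : Cube n) (F : Cube n → ℚ) → E n (λ x → F (x ⊕ w)) ≡ E n F
  E-⊕ {zero}  []          F = refl
  E-⊕ {suc n} (false ∷ w) F = cong (½ *_) (cong₂ _+_ (E-⊕ w (F ∘ (true ∷_))) (E-⊕ w (F ∘ (false ∷_))))
  E-⊕ {suc n} (true  ∷ w) F = trans
    (cong (½ *_) (cong₂ _+_ (E-⊕ w (F ∘ (false ∷_))) (E-⊕ w (F ∘ (true ∷_)))))
    (cong (½ *_) (+-comm (E n (F ∘ (false ∷_))) _))

  flip : ∀ {n} → Fin n → Cube n → Cube n
  flip b x = x [ b ]%= not

  E-flip : ∀ {n} (b : Fin n) (F : Cube n → ℚ) → E n (F ∘ flip b) ≡ E n F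
  E-flip {suc n} zero    F = cong (½ *_) (+-comm (E n (F ∘ (false ∷_))) _)
  E-flip {suc n} (suc b) F = cong (½ *_) (cong₂ _+_ (E-flip b (F ∘ (true ∷_))) (E-flip b (F ∘ (false ∷_))))

  E-shift : ∀ {n} c (F : Cube n → ℚ) → E n (λ x → F x - c) ≡ E n F - c
  E-shift {n} c F = trans (E-+ F (λ _ → - c)) (cong (E n F +_) (E-const n (- c)))

  -- The gap is the variance of `F`.
  E-jensen : ∀ {n} (F : Cube n → ℚ) → E n F ² ≤ E n (λ x → F x ²)
  E-jensen {n} F = ≤-from-gap (E n (λ x → (F x - m) ²)) (E-nonneg (λ x → 0≤² (F x - m))) eq
    where
    m = E n F
    open ≡-Reasoning
    eq : E n (λ x → F x ²) ≡ m ² + E n (λ x → (F x - m) ²)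
    eq = sym (begin
      m ² + E n (λ x → (F x - m) ²)
        ≡⟨ cong (m ² +_) (E-cong λ x → solve 2 (λ f m → (f :- m) :* (f :- m) := f :* f :+ ((:- (m :+ m)) :* f :+ m :* m)) refl (F x) m) ⟩
      m ² + E n (λ x → F x ² + (- (m + m) * F x + m ²))
        ≡⟨ cong (m ² +_) (E-+ (λ x → F x ²) (λ x → - (m + m) * F x + m ²)) ⟩
      m ² + (E n (λ x → F x ²) + E n (λ x → - (m + m) * F x + m ²))
        ≡⟨ cong (λ e → m ² + (E n (λ x → F x ²) + e)) (trans (E-+ (λ x → - (m + m) * F x) (λ _ → m ²)) (cong₂ _+_ (E-*ˡ (- (m + m)) F) (E-const n (m ²)))) ⟩
      m ² + (E n (λ x → F x ²) + (- (m + m) * m + m ²))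
        ≡⟨ solve 2 (λ m s → m :* m :+ (s :+ ((:- (m :+ m)) :* m :+ m :* m)) := s) refl m (E n (λ x → F x ²)) ⟩
      E n (λ x → F x ²) ∎)

  sumL : ∀ {a} {A : Set a} → (A → ℚ) → List A → ℚ
  sumL F List.[]      = 0ℚ
  sumL F (x List.∷ l) = F x + sumL F l

  E-sumL : ∀ {a n} {A : Set a} (F : A → Cube n → ℚ) l → E n (λ x → sumL (λ y → F y x) l) ≡ sumL (λ y → E n (F y)) l
  E-sumL {n = n} F List.[]      = E-const n 0ℚ
  E-sumL {n = n} F (y List.∷ l) = trans (E-+ (F y) (λ x → sumL (λ z → F z x) l)) (cong (E n (F y) +_) (E-sumL F l))

  fromℕ-2^suc : ∀ n → fromℕ (2 ^ suc n) ≡ fromℕ (2 ^ n) + fromℕ (2 ^ n)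
  fromℕ-2^suc n = trans (fromℕ-+ (2 ^ n) _) (cong (fromℕ (2 ^ n) +_) (cong fromℕ (ℕₚ.+-identityʳ (2 ^ n))))

  -- Counts of cube points as expectations.

  count : ∀ {p n} {P : Cube n → Set p} → Decidable₁ P → ℕ
  count {n = n} P? = List.length (List.filter P? (allPoints n))

  length-filter-map : ∀ {a b p} {A : Set a} {B : Set b} {P : B → Set p} (P? : Decidable₁ P) (h : A → B) (l : List A) →
    List.length (List.filter P? (List.map h l)) ≡ List.length (List.filter (P? ∘ h) l)
  length-filter-map P? h List.[] = refl
  length-filter-map P? h (x List.∷ l) with does (P? (h x))
  ... | true  = cong suc (length-filter-map P? h l)
  ... | false = length-filter-map P? h l

  count-suc : ∀ {p n} {P : Cube (suc n) → Set p} (P? : Decidable₁ P) →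
    count P? ≡ count (P? ∘ (true ∷_)) ℕ.+ count (P? ∘ (false ∷_))
  count-suc {n = n} P? = trans (cong List.length (List.filter-++ P? (List.map (true ∷_) (allPoints n)) _))
    (trans (List.length-++ (List.filter P? (List.map (true ∷_) (allPoints n))))
      (cong₂ ℕ._+_ (length-filter-map P? (true ∷_) (allPoints n)) (length-filter-map P? (false ∷_) (allPoints n))))

  count≡E : ∀ {p n} {P : Cube n → Set p} (P? : Decidable₁ P) →
    fromℕ (count P?) ≡ fromℕ (2 ^ n) * E n (ind ∘ does ∘ P?)
  count≡E {n = zero} P? with does (P? [])
  ... | true  = refl
  ... | false = refl
  count≡E {n = suc n} P? = begin
    fromℕ (count P?)
      ≡⟨ trans (cong fromℕ (count-suc P?)) (fromℕ-+ (count (P? ∘ (true ∷_))) _) ⟩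
    fromℕ (count (P? ∘ (true ∷_))) + fromℕ (count (P? ∘ (false ∷_)))
      ≡⟨ cong₂ _+_ (count≡E (P? ∘ (true ∷_))) (count≡E (P? ∘ (false ∷_))) ⟩
    fromℕ (2 ^ n) * E n (ind ∘ does ∘ P? ∘ (true ∷_)) + fromℕ (2 ^ n) * E n (ind ∘ does ∘ P? ∘ (false ∷_))
      ≡⟨ solve 3 (λ c a b → c :* a :+ c :* b := (c :+ c) :* (con ½ :* (a :+ b))) refl
           (fromℕ (2 ^ n)) (E n (ind ∘ does ∘ P? ∘ (true ∷_))) (E n (ind ∘ does ∘ P? ∘ (false ∷_))) ⟩
    (fromℕ (2 ^ n) + fromℕ (2 ^ n)) * E (suc n) (ind ∘ does ∘ P?)
      ≡⟨ cong (_* E (suc n) (ind ∘ does ∘ P?)) (fromℕ-2^suc n) ⟨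
    fromℕ (2 ^ suc n) * E (suc n) (ind ∘ does ∘ P?) ∎
    where open ≡-Reasoning

  fromℕ≡/1 : ∀ n → fromℕ n ≡ ℤ.+ n / 1
  fromℕ≡/1 zero    = refl
  fromℕ≡/1 (suc n) = trans (cong (_+_ 1ℚ) (fromℕ≡/1 n)) (toℚᵘ-injective (ℚᵘₚ.≃-trans (toℚᵘ-homo-+ 1ℚ (ℤ.+ n / 1))
    (ℚᵘₚ.≃-trans (ℚᵘₚ.+-congʳ (toℚᵘ 1ℚ) (toℚᵘ-fromℚᵘ (ℚᵘ.mkℚᵘ (ℤ.+ n) 0)))
      (ℚᵘₚ.≃-trans (ℚᵘ.*≡* (cong (ℤ._* (ℤ.+ 1)) (cong (λ z → ℤ.+ 1 ℤ.+ z) (ℤₚ.*-identityʳ (ℤ.+ n)))))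
        (ℚᵘₚ.≃-sym (toℚᵘ-fromℚᵘ (ℚᵘ.mkℚᵘ (ℤ.+ suc n) 0)))))))

  *-/ : ∀ k d .{{_ : ℕ.NonZero d}} → fromℕ d * (ℤ.+ k / d) ≡ fromℕ k
  *-/ k (suc d) = trans (cong (_* (ℤ.+ k / suc d)) (fromℕ≡/1 (suc d))) (trans
    (toℚᵘ-injective (ℚᵘₚ.≃-trans (toℚᵘ-homo-* (ℤ.+ suc d / 1) (ℤ.+ k / suc d))
      (ℚᵘₚ.≃-trans (ℚᵘₚ.*-cong (toℚᵘ-fromℚᵘ (ℚᵘ.mkℚᵘ (ℤ.+ suc d) 0)) (toℚᵘ-fromℚᵘ (ℚᵘ.mkℚᵘ (ℤ.+ k) d)))
        (ℚᵘₚ.≃-trans (ℚᵘ.*≡* (trans (ℤₚ.*-identityʳ _) (trans (ℤₚ.*-comm (ℤ.+ suc d) (ℤ.+ k)) (cong (λ z → ℤ.+ k ℤ.* ℤ.+ z) (sym (ℕₚ.+-identityʳ (suc d)))))))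
          (ℚᵘₚ.≃-sym (toℚᵘ-fromℚᵘ (ℚᵘ.mkℚᵘ (ℤ.+ k) 0)))))))
    (sym (fromℕ≡/1 k)))

  fromℕ-positive : ∀ n .{{_ : ℕ.NonZero n}} → Positive (fromℕ n)
  fromℕ-positive (suc n) = positive (<-≤-trans (positive⁻¹ 1ℚ) (≤-from-gap (fromℕ n) (0≤fromℕ n) refl))

  *-cancelˡ-pos : ∀ {p q} r .{{_ : Positive r}} → r * p ≡ r * q → p ≡ q
  *-cancelˡ-pos r eq = ≤-antisym (*-cancelˡ-≤-pos r (≤-reflexive eq)) (*-cancelˡ-≤-pos r (≤-reflexive (sym eq)))

  count/2^n≡E : ∀ {p n} {P : Cube n → Set p} (P? : Decidable₁ P) .{{_ : ℕ.NonZero (2 ^ n)}} →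
    ℤ.+ count P? / (2 ^ n) ≡ E n (ind ∘ does ∘ P?)
  count/2^n≡E {n = n} P? = *-cancelˡ-pos (fromℕ (2 ^ n)) {{fromℕ-positive (2 ^ n)}}
    (trans (*-/ (count P?) (2 ^ n)) (count≡E P?))

-- The explicit list bound.

module Constants where
  open import Data.Nat using (ℕ; zero; suc; _*_)

  -- One step of the extraction keeps a class of equal coefficients, one of at most `M`. The value 1
  -- at zero and the added 1 ensure that any longer list has two members, from which a direction can
  -- be obtained.
  triangularBound : ℕ → ℕ → ℕ
  triangularBound M zero    = 1
  triangularBound M (suc k) = suc (M * triangularBound M k)

  listBound : ℕ → ℕ
  listBound e = triangularBound e (m * m * (m * m)) where m = 2 * e

-- Few coefficients per direction; extraction of triangular families.

module ListBound {c ℓ} (G : AbelianGroup c ℓ) (_≟_ : Decidable (AbelianGroup._≈_ G)) where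
  open import Data.Bool using (Bool; true; false; not; _∧_)
  import Data.Bool.Properties as Bool
  open import Data.Empty using (⊥-elim)
  open import Data.Fin using (Fin; zero; suc)
  import Data.Fin.Properties as Fin
  open import Data.Nat as ℕ using (ℕ; zero; suc; s≤s; z≤n)
  import Data.Nat.Properties as ℕₚ
  open import Data.List using (List; []; _∷_; length; filter)
  open import Data.List.Membership.Propositional using (_∈_)
  open import Data.List.Membership.Propositional.Properties using (∈-filter⁻)
  open import Data.List.Relation.Unary.All as All using (All; []; _∷_)
  import Data.List.Relation.Unary.All.Properties as All
  open import Data.List.Relation.Unary.AllPairs as AllPairs using (AllPairs; []; _∷_)
  import Data.List.Relation.Unary.AllPairs.Properties as AllPairs
  open import Data.List.Relation.Unary.Any using (here; there)
  open import Data.Product using (∃; _×_; _,_; proj₁; proj₂)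
  open import Data.Rational hiding (_≟_; _≥_; _>_)
  open import Data.Rational.Properties hiding (_≟_)
  open import Data.Rational.Solver using (module +-*-Solver)
  open import Data.Sum using (_⊎_; inj₁; inj₂; [_,_]′)
  open import Data.Vec using (Vec; []; _∷_; lookup)
  open import Function using (_∘_)
  import Level
  open import Relation.Binary.PropositionalEquality
  open import Relation.Nullary using (Dec; yes; no; does; ¬_; ¬?)
  open import Relation.Nullary.Decidable using (dec-true; dec-false)

  open +-*-Solver using (solve; _:+_; _:*_; _:-_; :-_; _:=_; con)
  open AbelianGroup G using (Carrier; _≈_; _∙_; ε; _⁻¹; ∙-cong; ∙-congˡ; ∙-congʳ; assoc; comm; identityˡ; identityʳ; inverseʳ; ⁻¹-cong)
    renaming (refl to ≈-refl; sym to ≈-sym; trans to ≈-trans)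
  open import Algebra.Properties.Group (AbelianGroup.group G) using (∙-cancelˡ; ∙-cancelʳ; ⁻¹-injective)
  open WithGroup G _≟_
  open Expectation
  open Constants
  import Relation.Binary.Reasoning.Setoid (AbelianGroup.setoid G) as ≈R

  ⟦_⟧ : ∀ {n} → Affine n → Cube n → Carrier
  ⟦_⟧ = evalA

  coef : ∀ {n} → Affine n → Fin n → Carrier
  coef P b = lookup (Affine.a P) b

  eqb : Carrier → Carrier → Bool
  eqb g h = does (g ≟ h)

  eqb-true : ∀ {g h} → g ≈ h → eqb g h ≡ true
  eqb-true {g} {h} = dec-true (g ≟ h)

  eqb-false : ∀ {g h} → ¬ g ≈ h → eqb g h ≡ false
  eqb-false {g} {h} = dec-false (g ≟ h)

  eqb⇒≈ : ∀ {g h} → eqb g h ≡ true → g ≈ h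
  eqb⇒≈ {g} {h} eq with g ≟ h
  ... | yes g≈h = g≈h

  eqb-cong : ∀ {g h g′ h′} → (g ≈ h → g′ ≈ h′) → (g′ ≈ h′ → g ≈ h) → eqb g h ≡ eqb g′ h′
  eqb-cong {g} {h} {g′} {h′} to from with g ≟ h
  ... | yes p = sym (eqb-true (to p))
  ... | no ¬p = sym (eqb-false (¬p ∘ from))

  agree : ∀ {n} → (Cube n → Carrier) → (Cube n → Carrier) → Cube n → ℚ
  agree f g x = ind (eqb (f x) (g x))

  differ : ∀ {n} → (Cube n → Carrier) → (Cube n → Carrier) → Cube n → ℚ
  differ f g x = ind (not (eqb (f x) (g x)))

  δ≡E : ∀ {n} (f g : Cube n → Carrier) → δ f g ≡ E n (differ f g)
  δ≡E {n} f g = count/2^n≡E (λ x → ¬? (f x ≟ g x)) {{ℕₚ.m^n≢0 2 n}}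

  differ≡1-agree : ∀ {n} (f g : Cube n → Carrier) x → differ f g x ≡ - agree f g x - (- 1ℚ)
  differ≡1-agree f g x with eqb (f x) (g x)
  ... | true  = refl
  ... | false = refl

  δ≡1-E : ∀ {n} (f g : Cube n → Carrier) → δ f g ≡ 1ℚ - E n (agree f g)
  δ≡1-E {n} f g = begin
    δ f g                                   ≡⟨ δ≡E f g ⟩
    E n (differ f g)                        ≡⟨ E-cong (λ x → trans (differ≡1-agree f g x) (solve 1 (λ a → (:- a) :- (:- con 1ℚ) := (:- con 1ℚ) :* a :- (:- con 1ℚ)) refl (agree f g x))) ⟩
    E n (λ x → - 1ℚ * agree f g x - (- 1ℚ)) ≡⟨ E-shift (- 1ℚ) (λ x → - 1ℚ * agree f g x) ⟩
    E n (λ x → - 1ℚ * agree f g x) - (- 1ℚ) ≡⟨ cong (_- (- 1ℚ)) (E-*ˡ (- 1ℚ) (agree f g)) ⟩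
    - 1ℚ * E n (agree f g) - (- 1ℚ)         ≡⟨ solve 1 (λ e → (:- con 1ℚ) :* e :- (:- con 1ℚ) := con 1ℚ :- e) refl (E n (agree f g)) ⟩
    1ℚ - E n (agree f g) ∎
    where open ≡-Reasoning

  InList⇒agree : ∀ {n} {f : Cube n → Carrier} η P → InList f η P → ½ + η ≤ E n (agree f ⟦ P ⟧)
  InList⇒agree {n} {f} η P δ≤ = ≤-from-gap (½ - η - δ f ⟦ P ⟧) (gap δ≤)
    (trans (solve 2 (λ e h → e := con ½ :+ h :+ (con ½ :- h :- (con 1ℚ :- e))) refl (E n (agree f ⟦ P ⟧)) η)
      (cong (λ d → ½ + η + (½ - η - d)) (sym (δ≡1-E f ⟦ P ⟧))))

  -- The increment along an edge, given the coefficient and the old value of the flipped bit: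
  -- setting the bit adds the coefficient, clearing it subtracts.
  step : Bool → Carrier → Carrier
  step false g = g
  step true  g = g ⁻¹

  step-cong : ∀ β {g h} → g ≈ h → step β g ≈ step β h
  step-cong false = λ e → e
  step-cong true  = ⁻¹-cong

  step-injective : ∀ β {g h} → step β g ≈ step β h → g ≈ h
  step-injective false = λ e → e
  step-injective true  = ⁻¹-injective

  linear-flip : ∀ {n} (v : Vec Carrier n) b x →
                linear v (flip b x) ≈ linear v x ∙ step (lookup x b) (lookup v b)
  linear-flip (g ∷ v) zero (true ∷ x) = begin
    ε ∙ linear v x              ≈⟨ identityˡ _ ⟩
    linear v x                  ≈⟨ identityʳ _ ⟨
    linear v x ∙ ε              ≈⟨ ∙-congˡ (inverseʳ g) ⟨
    linear v x ∙ (g ∙ g ⁻¹)     ≈⟨ assoc _ _ _ ⟨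
    (linear v x ∙ g) ∙ g ⁻¹     ≈⟨ ∙-congʳ (comm _ _) ⟩
    (g ∙ linear v x) ∙ g ⁻¹     ∎
    where open ≈R
  linear-flip (g ∷ v) zero (false ∷ x) = begin
    g ∙ linear v x          ≈⟨ comm _ _ ⟩
    linear v x ∙ g          ≈⟨ ∙-congʳ (identityˡ _) ⟨
    (ε ∙ linear v x) ∙ g    ∎
    where open ≈R
  linear-flip (g ∷ v) (suc b) (β ∷ x) = ≈-trans (∙-congˡ (linear-flip v b x)) (≈-sym (assoc _ _ _))

  eval-flip : ∀ {n} (P : Affine n) b x → ⟦ P ⟧ (flip b x) ≈ ⟦ P ⟧ x ∙ step (lookup x b) (coef P b)
  eval-flip (affine a₀ v) b x = ≈-trans (∙-congˡ (linear-flip v b x)) (≈-sym (assoc _ _ _))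

  agree-twice⇒coef≈ : ∀ {n} (P Q : Affine n) b x → ⟦ P ⟧ x ≈ ⟦ Q ⟧ x → ⟦ P ⟧ (flip b x) ≈ ⟦ Q ⟧ (flip b x) →
                      coef P b ≈ coef Q b
  agree-twice⇒coef≈ P Q b x e e′ = step-injective (lookup x b) (∙-cancelˡ (⟦ P ⟧ x) _ _ (begin
    ⟦ P ⟧ x ∙ step (lookup x b) (coef P b)  ≈⟨ eval-flip P b x ⟨
    ⟦ P ⟧ (flip b x)                        ≈⟨ e′ ⟩
    ⟦ Q ⟧ (flip b x)                        ≈⟨ eval-flip Q b x ⟩
    ⟦ Q ⟧ x ∙ step (lookup x b) (coef Q b)  ≈⟨ ∙-congʳ e ⟨
    ⟦ P ⟧ x ∙ step (lookup x b) (coef Q b)  ∎))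
    where open ≈R

  -- Equal coefficients give both functions the same increment along the edge, which cancels.
  coef≈⇒eqb-flip : ∀ {n} (P Q : Affine n) b → coef P b ≈ coef Q b → ∀ x →
                   eqb (⟦ P ⟧ (flip b x)) (⟦ Q ⟧ (flip b x)) ≡ eqb (⟦ P ⟧ x) (⟦ Q ⟧ x)
  coef≈⇒eqb-flip P Q b e x = eqb-cong
    (λ h → ∙-cancelʳ (step β (coef P b)) _ _ (≈-trans (≈-sym (eval-flip P b x)) (≈-trans h (≈-trans (eval-flip Q b x) (∙-congˡ (step-cong β (≈-sym e)))))))
    (λ h → ≈-trans (eval-flip P b x) (≈-trans (∙-cong h (step-cong β e)) (≈-sym (eval-flip Q b x))))
    where β = lookup x b

  linear-cong : ∀ {n} (v w : Vec Carrier n) → (∀ b → lookup v b ≈ lookup w b) → ∀ x → linear v x ≈ linear w x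
  linear-cong []      []      e []          = ≈-refl
  linear-cong (g ∷ v) (h ∷ w) e (true ∷ x)  = ∙-cong (e zero) (linear-cong v w (e ∘ suc) x)
  linear-cong (g ∷ v) (h ∷ w) e (false ∷ x) = ∙-congˡ (linear-cong v w (e ∘ suc) x)

  E-pos⇒∃ : ∀ {n} (F : Cube n → ℚ) → 0ℚ < E n F → ∃ λ x → 0ℚ < F x
  E-pos⇒∃ {zero}  F 0<E = [] , 0<E
  E-pos⇒∃ {suc n} F 0<E with 0ℚ <? E n (F ∘ (true ∷_)) | 0ℚ <? E n (F ∘ (false ∷_))
  ... | yes p | _ = let x , q = E-pos⇒∃ _ p in true ∷ x , q
  ... | no _ | yes p = let x , q = E-pos⇒∃ _ p in false ∷ x , q
  ... | no ¬p | no ¬q = ⊥-elim (<-irrefl refl (<-≤-trans 0<E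
          (*-monoˡ 0≤½ (+-mono-≤ (≮⇒≥ ¬p) (≮⇒≥ ¬q)))))

  ind-∧ : ∀ a b → ind a + ind b - 1ℚ ≤ ind (a ∧ b)
  ind-∧ true  true  = ≤-refl
  ind-∧ true  false = ≤-refl
  ind-∧ false true  = ≤-refl
  ind-∧ false false = nonPositive⁻¹ (0ℚ + 0ℚ - 1ℚ)

  -- Inclusion-exclusion, through the pointwise bound `ind-∧`.
  E-ind-∧ : ∀ {n} η (A B : Cube n → Bool) → ½ + η ≤ E n (ind ∘ A) → ½ + η ≤ E n (ind ∘ B) →
            η + η ≤ E n (λ x → ind (A x ∧ B x))
  E-ind-∧ {n} η A B hA hB = ≤-trans
    (≤-from-gap ((E n (ind ∘ A) - (½ + η)) + (E n (ind ∘ B) - (½ + η))) (0≤+ (gap hA) (gap hB))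
      (trans (trans (E-shift 1ℚ (λ x → ind (A x) + ind (B x))) (cong (_- 1ℚ) (E-+ (ind ∘ A) (ind ∘ B))))
        (solve 3 (λ a b h → (a :+ b) :- con 1ℚ := (h :+ h) :+ ((a :- (con ½ :+ h)) :+ (b :- (con ½ :+ h)))) refl (E n (ind ∘ A)) (E n (ind ∘ B)) η)))
    (E-mono (λ x → ind-∧ (A x) (B x)))

  ind-pos : ∀ b → 0ℚ < ind b → b ≡ true
  ind-pos true  _ = refl
  ind-pos false p = ⊥-elim (<-irrefl refl p)

  ∧-true : ∀ a b → a ∧ b ≡ true → a ≡ true × b ≡ true
  ∧-true true true refl = refl , refl

  module _ {n} (f : Cube n → Carrier) {η : ℚ} (0<η : 0ℚ < η) where

    Listed : Affine n → Set
    Listed = InList f η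

    common-point : ∀ P Q → Listed P → Listed Q → ∃ λ x → ⟦ P ⟧ x ≈ ⟦ Q ⟧ x
    common-point P Q p q = x , ≈-trans (≈-sym (eqb⇒≈ (proj₁ both))) (eqb⇒≈ (proj₂ both))
      where
      w = E-pos⇒∃ (λ x → ind (eqb (f x) (⟦ P ⟧ x) ∧ eqb (f x) (⟦ Q ⟧ x)))
            (<-≤-trans (+-mono-< 0<η 0<η)
              (E-ind-∧ η (λ x → eqb (f x) (⟦ P ⟧ x)) (λ x → eqb (f x) (⟦ Q ⟧ x)) (InList⇒agree η P p) (InList⇒agree η Q q)))
      x = proj₁ w
      both = ∧-true (eqb (f x) (⟦ P ⟧ x)) (eqb (f x) (⟦ Q ⟧ x)) (ind-pos _ (proj₂ w))

    -- If all coefficients agreed, only the constant terms could differ. This is excluded by a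
    -- common point, which exists because both functions agree with `f` on more than half of the
    -- cube.
    distinct⇒coef≉ : ∀ P Q → Listed P → Listed Q → Distinct P Q → ∃ λ b → ¬ coef P b ≈ coef Q b
    distinct⇒coef≉ P Q p q P≢Q = Fin.¬∀⟶∃¬ n (λ b → coef P b ≈ coef Q b) (λ b → coef P b ≟ coef Q b) λ same →
      let lin = linear-cong (Affine.a P) (Affine.a Q) same
          x , e = common-point P Q p q
          a₀≈ = ∙-cancelʳ (linear (Affine.a P) x) _ _ (≈-trans e (∙-congˡ (≈-sym (lin x))))
      in P≢Q λ y → ∙-cong a₀≈ (lin y)

    module _ (b : Fin n) where

      edge : Affine n → Cube n → Bool
      edge P x = eqb (f x) (⟦ P ⟧ x) ∧ eqb (f (flip b x)) (⟦ P ⟧ (flip b x))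

      edge-coef : ∀ P Q x → edge P x ≡ true → edge Q x ≡ true → coef P b ≈ coef Q b
      edge-coef P Q x p q =
        let p₁ , p₂ = ∧-true _ _ p
            q₁ , q₂ = ∧-true _ _ q
        in agree-twice⇒coef≈ P Q b x (≈-trans (≈-sym (eqb⇒≈ p₁)) (eqb⇒≈ q₁)) (≈-trans (≈-sym (eqb⇒≈ p₂)) (eqb⇒≈ q₂))

      edge-density : ∀ P → Listed P → η + η ≤ E n (ind ∘ edge P)
      edge-density P p = E-ind-∧ η (λ x → eqb (f x) (⟦ P ⟧ x)) (λ x → eqb (f (flip b x)) (⟦ P ⟧ (flip b x)))
        (InList⇒agree η P p) (subst (½ + η ≤_) (sym (E-flip b (agree f ⟦ P ⟧))) (InList⇒agree η P p))

      sumL-zero : ∀ x Ps → All (λ Q → edge Q x ≡ false) Ps → sumL (λ Q → ind (edge Q x)) Ps ≡ 0ℚ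
      sumL-zero x []       []       = refl
      sumL-zero x (P ∷ Ps) (p ∷ ps) rewrite p = trans (+-identityˡ _) (sumL-zero x Ps ps)

      -- Functions that follow `f` along the same edge have the same coefficient there, so at most
      -- one summand is 1.
      sumL-edge≤1 : ∀ x Ps → AllPairs (λ P Q → ¬ coef P b ≈ coef Q b) Ps → sumL (λ Q → ind (edge Q x)) Ps ≤ 1ℚ
      sumL-edge≤1 x []       []         = 0≤1
      sumL-edge≤1 x (P ∷ Ps) (p ∷ ps) with edge P x in eq
      ... | false = subst (_≤ 1ℚ) (sym (+-identityˡ _)) (sumL-edge≤1 x Ps ps)
      ... | true  = ≤-reflexive (cong (1ℚ +_) (sumL-zero x Ps
                      (All.map (λ {Q} P≉Q → Bool.¬-not λ q → P≉Q (edge-coef P Q x eq q)) p)))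

      sumL-≥ : ∀ Ps → All Listed Ps → fromℕ (length Ps) * (η + η) ≤ sumL (λ P → E n (ind ∘ edge P)) Ps
      sumL-≥ []       []       = ≤-reflexive (*-zeroˡ (η + η))
      sumL-≥ (P ∷ Ps) (p ∷ ps) = subst (_≤ sumL (λ P → E n (ind ∘ edge P)) (P ∷ Ps))
        (solve 2 (λ k h → h :+ k :* h := (con 1ℚ :+ k) :* h) refl (fromℕ (length Ps)) (η + η))
        (+-mono-≤ (edge-density P p) (sumL-≥ Ps ps))

      -- Double counting: every function follows `f` on a 2η-fraction of the edges, and no edge is
      -- used twice.
      few-coefs : ∀ Ps → All Listed Ps → AllPairs (λ P Q → ¬ coef P b ≈ coef Q b) Ps →
                  fromℕ (length Ps) * (η + η) ≤ 1ℚ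
      few-coefs Ps ps dist = ≤-trans (sumL-≥ Ps ps)
        (subst (_≤ 1ℚ) (E-sumL (λ P x → ind (edge P x)) Ps) (E-≤const (λ x → sumL-edge≤1 x Ps dist)))

    length-filter-split : ∀ {A : Set c} {p} {Pr : A → Set p} (P? : ∀ y → Dec (Pr y)) (l : List A) →
      length (filter P? l) ℕ.+ length (filter (¬? ∘ P?) l) ≡ length l
    length-filter-split P? [] = refl
    length-filter-split P? (y ∷ l) with does (P? y)
    ... | true  = cong suc (length-filter-split P? l)
    ... | false = trans (ℕₚ.+-suc _ _) (cong suc (length-filter-split P? l))

    length-filter-filter : ∀ {A : Set c} {p q} {Pr : A → Set p} {Qr : A → Set q}
      (P? : ∀ y → Dec (Pr y)) (Q? : ∀ y → Dec (Qr y)) (l : List A) →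
      length (filter P? (filter Q? l)) ℕ.≤ length (filter P? l)
    length-filter-filter P? Q? [] = z≤n
    length-filter-filter P? Q? (y ∷ l) with does (Q? y)
    ... | false with does (P? y)
    ...   | true  = ℕₚ.m≤n⇒m≤1+n (length-filter-filter P? Q? l)
    ...   | false = length-filter-filter P? Q? l
    length-filter-filter P? Q? (y ∷ l) | true with does (P? y)
    ...   | true  = s≤s (length-filter-filter P? Q? l)
    ...   | false = length-filter-filter P? Q? l

    -- The values of `κ` cannot be enumerated, only compared. The induction on `M` therefore splits
    -- off the class of the head: if it is small, the rest is still large for `M` - 1, and the head
    -- has a value different from all values in the rest.
    pigeonhole : ∀ {A : Set c} (κ : A → Carrier) M X (l : List A) → M ℕ.* X ℕ.< length l →
      (∃ λ w → X ℕ.< length (filter (λ y → κ y ≟ w) l)) ⊎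
      (∃ λ l′ → M ℕ.< length l′ × All (_∈ l) l′ × AllPairs (λ y z → ¬ κ y ≈ κ z) l′)
    pigeonhole κ zero    X (y ∷ l) _ = inj₂ (y ∷ [] , s≤s z≤n , here refl ∷ [] , [] ∷ [])
    pigeonhole κ (suc M) X (y ∷ l) lt with X ℕ.<? length (filter (λ z → κ z ≟ κ y) (y ∷ l))
    ... | yes big  = inj₁ (κ y , big)
    ... | no small with pigeonhole κ M X rest rest-large
      where
      class = filter (λ z → κ z ≟ κ y) (y ∷ l)
      rest = filter (λ z → ¬? (κ z ≟ κ y)) (y ∷ l)
      rest-large : M ℕ.* X ℕ.< length rest
      rest-large = ℕₚ.+-cancelˡ-< X _ _ (ℕₚ.<-≤-trans lt (subst (ℕ._≤ X ℕ.+ length rest)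
        (length-filter-split (λ z → κ z ≟ κ y) (y ∷ l)) (ℕₚ.+-monoˡ-≤ (length rest) (ℕₚ.≮⇒≥ small))))
    ...   | inj₁ (w , big) = inj₁ (w , ℕₚ.<-≤-trans big (length-filter-filter (λ z → κ z ≟ w) (λ z → ¬? (κ z ≟ κ y)) (y ∷ l)))
    ...   | inj₂ (l′ , M< , sub , dist) = inj₂
            ( y ∷ l′ , s≤s M<
            , here refl ∷ All.map (λ h → proj₁ (∈-filter⁻ (λ z → ¬? (κ z ≟ κ y)) h)) sub
            , All.map (λ h e → proj₂ (∈-filter⁻ (λ z → ¬? (κ z ≟ κ y)) {xs = y ∷ l} h) (≈-sym e)) sub ∷ dist)

    -- The sequences are total on ℕ and constrained only below `k`, so that prepending an element
    -- needs no index conversions.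
    record Triangular (k : ℕ) (Ps : List (Affine n)) : Set (c Level.⊔ ℓ) where
      field
        P      : ℕ → Affine n
        b      : ℕ → Fin n
        member : ∀ s → s ℕ.< k → P s ∈ Ps
        diag   : ∀ s t → s ℕ.< t → t ℕ.< k → ¬ coef (P s) (b s) ≈ coef (P t) (b s)
        below  : ∀ s t u → s ℕ.< t → t ℕ.< k → s ℕ.< u → u ℕ.< k → coef (P t) (b s) ≈ coef (P u) (b s)

    module _ (M : ℕ) (1≤Mη : 1ℚ ≤ fromℕ M * η) where

      few : ∀ b Ps → All Listed Ps → AllPairs (λ P Q → ¬ coef P b ≈ coef Q b) Ps → length Ps ℕ.≤ M
      few b Ps ps dist = fromℕ-cancel (*-cancelʳ-≤-pos {fromℕ (length Ps)} {fromℕ M} η {{positive 0<η}} (begin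
        fromℕ (length Ps) * η          ≤⟨ ≤-from-gap (fromℕ (length Ps) * η) (0≤* (0≤fromℕ (length Ps)) (<⇒≤ 0<η)) (*-distribˡ-+ (fromℕ (length Ps)) η η) ⟩
        fromℕ (length Ps) * (η + η)    ≤⟨ few-coefs b Ps ps dist ⟩
        1ℚ                             ≤⟨ 1≤Mη ⟩
        fromℕ M * η                    ∎))
        where open ≤-Reasoning

      extend : ∀ {k Ps b₀ w} P₀ → P₀ ∈ Ps → ¬ coef P₀ b₀ ≈ w →
               Triangular k (filter (λ P → coef P b₀ ≟ w) Ps) → Triangular (suc k) Ps
      extend {k} {Ps} {b₀} {w} P₀ P₀∈Ps P₀≉w T = record { P = P ; b = b ; member = member ; diag = diag ; below = below }
        where
        module T = Triangular T
        inClass : ∀ s → s ℕ.< k → T.P s ∈ Ps × coef (T.P s) b₀ ≈ w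
        inClass s s<k = ∈-filter⁻ (λ P → coef P b₀ ≟ w) (T.member s s<k)
        P : ℕ → Affine n
        P zero    = P₀
        P (suc s) = T.P s
        b : ℕ → Fin n
        b zero    = b₀
        b (suc s) = T.b s
        member : ∀ s → s ℕ.< suc k → P s ∈ Ps
        member zero    _         = P₀∈Ps
        member (suc s) (s≤s s<k) = proj₁ (inClass s s<k)
        diag : ∀ s t → s ℕ.< t → t ℕ.< suc k → ¬ coef (P s) (b s) ≈ coef (P t) (b s)
        diag zero    (suc t) _         (s≤s t<k) e = P₀≉w (≈-trans e (proj₂ (inClass t t<k)))
        diag (suc s) (suc t) (s≤s s<t) (s≤s t<k) = T.diag s t s<t t<k
        below : ∀ s t u → s ℕ.< t → t ℕ.< suc k → s ℕ.< u → u ℕ.< suc k → coef (P t) (b s) ≈ coef (P u) (b s)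
        below zero    (suc t) (suc u) _ (s≤s t<k) _ (s≤s u<k) = ≈-trans (proj₂ (inClass t t<k)) (≈-sym (proj₂ (inClass u u<k)))
        below (suc s) (suc t) (suc u) (s≤s s<t) (s≤s t<k) (s≤s s<u) (s≤s u<k) = T.below s t u s<t t<k s<u u<k

      large⇒triangular : ∀ k Ps → AllPairs Distinct Ps → All Listed Ps → triangularBound M k ℕ.< length Ps → Triangular k Ps
      -- Even the empty family needs values for its total sequences. The distinct pair supplies a
      -- direction, which would not exist for `n` = 0.
      large⇒triangular zero (P ∷ Q ∷ _) ((P≢Q ∷ _) ∷ _) (p ∷ q ∷ _) _ = record
        { P = λ _ → P ; b = λ _ → proj₁ (distinct⇒coef≉ P Q p q P≢Q)
        ; member = λ _ () ; diag = λ _ _ _ () ; below = λ _ _ _ _ () }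
      large⇒triangular zero (P ∷ []) _ _ (s≤s ())
      large⇒triangular (suc k) (P ∷ []) _ _ (s≤s ())
      large⇒triangular (suc k) (P₁ ∷ P₂ ∷ Ps) dist@((P₁≢P₂ ∷ _) ∷ _) listed@(p₁ ∷ p₂ ∷ _) lt =
        [ split , (λ (l , M< , sub , d) → ⊥-elim (ℕₚ.<⇒≱ M< (few b₀ l (All.map (All.lookup listed) sub) d))) ]′
        (pigeonhole (λ P → coef P b₀) M (triangularBound M k) (P₁ ∷ P₂ ∷ Ps) (ℕₚ.<-trans (ℕₚ.n<1+n _) lt))
        where
        different = distinct⇒coef≉ P₁ P₂ p₁ p₂ P₁≢P₂
        b₀ = proj₁ different
        -- `P₁` and `P₂` differ in direction `b₀`, so whichever class is large, one of them lies
        -- outside and can head the family.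
        outsider : ∀ w → Dec (coef P₁ b₀ ≈ w) → ∃ λ P → P ∈ (P₁ ∷ P₂ ∷ Ps) × ¬ coef P b₀ ≈ w
        outsider w (no  P₁≉w) = P₁ , here refl , P₁≉w
        outsider w (yes P₁≈w) = P₂ , there (here refl) , λ P₂≈w → proj₂ different (≈-trans P₁≈w (≈-sym P₂≈w))
        split : (∃ λ w → triangularBound M k ℕ.< length (filter (λ P → coef P b₀ ≟ w) (P₁ ∷ P₂ ∷ Ps))) →
                Triangular (suc k) (P₁ ∷ P₂ ∷ Ps)
        split (w , big) =
          let P₀ , P₀∈ , P₀≉w = outsider w (coef P₁ b₀ ≟ w)
              class? = λ P → coef P b₀ ≟ w
          in extend P₀ P₀∈ P₀≉w (large⇒triangular k (filter class? (P₁ ∷ P₂ ∷ Ps))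
               (AllPairs.filter⁺ class? dist) (All.filter⁺ class? listed) big)

-- Second-moment argument against long triangular families.

module UniformListBound {c ℓ} (G : AbelianGroup c ℓ) (_≟_ : Decidable (AbelianGroup._≈_ G)) where
  open import Data.Bool using (Bool; true; false)
  import Data.Bool.Properties as Bool
  open import Data.Empty using (⊥; ⊥-elim)
  open import Data.Fin using (Fin; zero; suc)
  open import Data.Nat as ℕ using (ℕ; zero; suc)
  import Data.Nat.Properties as ℕₚ
  open import Data.List using (List; length)
  open import Data.List.Relation.Unary.All as All using (All)
  open import Data.List.Relation.Unary.AllPairs using (AllPairs)
  open import Data.Rational hiding (_≟_; _≥_; _>_)
  open import Data.Rational.Properties hiding (_≟_)
  open import Data.Rational.Solver using (module +-*-Solver)
  open import Data.Vec using (Vec; _∷_)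
  open import Relation.Binary.PropositionalEquality hiding (J)
  open import Relation.Nullary using (¬_)

  open +-*-Solver using (solve; _:+_; _:*_; _:-_; :-_; _:=_; con)
  open AbelianGroup G using (Carrier; _≈_) renaming (sym to ≈-sym; trans to ≈-trans)
  open WithGroup G _≟_
  open Expectation
  open Constants
  open ListBound G _≟_

  flip-comm : ∀ {n} (b b′ : Fin n) x → flip b (flip b′ x) ≡ flip b′ (flip b x)
  flip-comm zero    zero     (β ∷ x) = refl
  flip-comm zero    (suc b′) (β ∷ x) = refl
  flip-comm (suc b) zero     (β ∷ x) = refl
  flip-comm (suc b) (suc b′) (β ∷ x) = cong (β ∷_) (flip-comm b b′ x)

  flip-involutive : ∀ {n} (b : Fin n) x → flip b (flip b x) ≡ x
  flip-involutive zero    (β ∷ x) = cong (_∷ x) (Bool.not-involutive β)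
  flip-involutive (suc b) (β ∷ x) = cong (β ∷_) (flip-involutive b x)

  Σ< : ℕ → (ℕ → ℚ) → ℚ
  Σ< zero    g = 0ℚ
  Σ< (suc v) g = Σ< v g + g v

  E-Σ< : ∀ {n} v (g : ℕ → Cube n → ℚ) → E n (λ x → Σ< v (λ s → g s x)) ≡ Σ< v (λ s → E n (g s))
  E-Σ< {n} zero    g = E-const n 0ℚ
  E-Σ< {n} (suc v) g = trans (E-+ (λ x → Σ< v (λ s → g s x)) (g v)) (cong (_+ E n (g v)) (E-Σ< v g))

  Σ<-≥ : ∀ v g r → (∀ s → s ℕ.< v → r ≤ g s) → fromℕ v * r ≤ Σ< v g
  Σ<-≥ zero    g r h = ≤-reflexive (*-zeroˡ r)
  Σ<-≥ (suc v) g r h = subst (_≤ Σ< v g + g v)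
    (solve 2 (λ v r → v :* r :+ r := (con 1ℚ :+ v) :* r) refl (fromℕ v) r)
    (+-mono-≤ (Σ<-≥ v g r (λ s s<v → h s (ℕₚ.m<n⇒m<1+n s<v))) (h v (ℕₚ.n<1+n v)))

  Σ<-≤ : ∀ v g r → (∀ s → s ℕ.< v → g s ≤ r) → Σ< v g ≤ fromℕ v * r
  Σ<-≤ zero    g r h = ≤-reflexive (sym (*-zeroˡ r))
  Σ<-≤ (suc v) g r h = subst (Σ< v g + g v ≤_)
    (solve 2 (λ v r → v :* r :+ r := (con 1ℚ :+ v) :* r) refl (fromℕ v) r)
    (+-mono-≤ (Σ<-≤ v g r (λ s s<v → h s (ℕₚ.m<n⇒m<1+n s<v))) (h v (ℕₚ.n<1+n v)))

  Σ<-nonneg : ∀ v g → (∀ s → 0ℚ ≤ g s) → 0ℚ ≤ Σ< v g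
  Σ<-nonneg zero    g h = ≤-refl
  Σ<-nonneg (suc v) g h = 0≤+ (Σ<-nonneg v g h) (h v)

  antisymmetric⇒E≡0 : ∀ {n} (b : Fin n) (F : Cube n → ℚ) → (∀ x → F (flip b x) ≡ - F x) → E n F ≡ 0ℚ
  antisymmetric⇒E≡0 {n} b F anti = begin
    e                ≡⟨ solve 1 (λ e → e := con ½ :* (e :+ e)) refl e ⟩
    ½ * (e + e)      ≡⟨ cong (λ e′ → ½ * (e + e′)) e≡-e ⟩
    ½ * (e + - 1ℚ * e) ≡⟨ solve 1 (λ e → con ½ :* (e :+ (:- con 1ℚ) :* e) := con 0ℚ) refl e ⟩
    0ℚ               ∎
    where
    open ≡-Reasoning
    e = E n F
    e≡-e : e ≡ - 1ℚ * e
    e≡-e = trans (sym (E-flip b F)) (trans (E-cong λ x → trans (anti x) (solve 1 (λ a → :- a := (:- con 1ℚ) :* a) refl (F x)))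
      (E-*ˡ (- 1ℚ) F))

  module _ {n} (f : Cube n → Carrier) {η : ℚ} (k : ℕ) (P : ℕ → Affine n) (b : ℕ → Fin n)
    (listed : ∀ s → s ℕ.< k → ½ + η ≤ E n (agree f ⟦ P s ⟧))
    (diag   : ∀ s t → s ℕ.< t → t ℕ.< k → ¬ coef (P s) (b s) ≈ coef (P t) (b s))
    (below  : ∀ s t u → s ℕ.< t → t ℕ.< k → s ℕ.< u → u ℕ.< k → coef (P t) (b s) ≈ coef (P u) (b s))
    where

    meet : ℕ → ℕ → Cube n → Bool
    meet s u x = eqb (⟦ P s ⟧ x) (⟦ P u ⟧ x)

    -- Twice the deviation of the event `meet s u` from its average over the edge in direction
    -- `b s`.
    Z : ℕ → ℕ → Cube n → ℚ
    Z s u x = ind (meet s u x) - ind (meet s u (flip (b s) x))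

    Y : ℕ → ℕ → Cube n → ℚ
    Y v u x = Σ< v (λ s → Z s u x)

    S : ℕ → Cube n → ℚ
    S s = agree f ⟦ P s ⟧

    T : ℕ → Cube n → ℚ
    T v x = Σ< v (λ s → S s x)

    meet-once : ∀ {s u} → s ℕ.< u → u ℕ.< k → ∀ x → meet s u x ≡ true → meet s u (flip (b s) x) ≡ true → ⊥
    meet-once {s} {u} s<u u<k x e e′ = diag s u s<u u<k (agree-twice⇒coef≈ (P s) (P u) (b s) x (eqb⇒≈ e) (eqb⇒≈ e′))

    meet-invariant : ∀ {s t u} → s ℕ.< t → t ℕ.< k → s ℕ.< u → u ℕ.< k → ∀ x → meet t u (flip (b s) x) ≡ meet t u x
    meet-invariant {s} {t} {u} s<t t<k s<u u<k = coef≈⇒eqb-flip (P t) (P u) (b s) (below s t u s<t t<k s<u u<k)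

    -- By `meet-once` the event holds at one end of the edge at most, so its average over the edge
    -- is at most 1/2.
    twice-meet≤ : ∀ {s u} → s ℕ.< u → u ℕ.< k → ∀ x → ind (meet s u x) + ind (meet s u x) ≤ 1ℚ + Z s u x
    twice-meet≤ {s} {u} s<u u<k x with meet s u x in e | meet s u (flip (b s) x) in e′
    ... | true  | true  = ⊥-elim (meet-once s<u u<k x e e′)
    ... | true  | false = ≤-refl
    ... | false | true  = ≤-refl
    ... | false | false = 0≤1

    Z²≤1 : ∀ s u x → Z s u x ² ≤ 1ℚ
    Z²≤1 s u x with meet s u x | meet s u (flip (b s) x)
    ... | true  | true  = 0≤1
    ... | true  | false = ≤-refl
    ... | false | true  = ≤-refl
    ... | false | false = 0≤1

    Z-anti : ∀ s u x → Z s u (flip (b s) x) ≡ - Z s u x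
    Z-anti s u x = trans (cong (λ y → ind (meet s u (flip (b s) x)) - ind (meet s u y)) (flip-involutive (b s) x))
      (solve 2 (λ p q → p :- q := :- (q :- p)) refl (ind (meet s u (flip (b s) x))) (ind (meet s u x)))

    Z-invariant : ∀ {s t u} → s ℕ.< t → t ℕ.< k → s ℕ.< u → u ℕ.< k → ∀ x → Z t u (flip (b s) x) ≡ Z t u x
    Z-invariant {s} {t} {u} s<t t<k s<u u<k x = cong₂ (λ p q → ind p - ind q) (meet-invariant s<t t<k s<u u<k x)
      (trans (cong (meet t u) (flip-comm (b t) (b s) x)) (meet-invariant s<t t<k s<u u<k (flip (b t) x)))

    -- Flipping `b s` negates the first factor and preserves the second, so the product is
    -- antisymmetric.
    Z-orthogonal : ∀ {s t u} → s ℕ.< t → t ℕ.< u → u ℕ.< k → E n (λ x → Z s u x * Z t u x) ≡ 0ℚ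
    Z-orthogonal {s} {t} {u} s<t t<u u<k = antisymmetric⇒E≡0 (b s) (λ x → Z s u x * Z t u x) λ x →
      trans (cong₂ _*_ (Z-anti s u x) (Z-invariant s<t (ℕₚ.<-trans t<u u<k) (ℕₚ.<-trans s<t t<u) u<k x))
        (sym (neg-distribˡ-* (Z s u x) (Z t u x)))

    YZ-orthogonal : ∀ {v t u} → v ℕ.≤ t → t ℕ.< u → u ℕ.< k → E n (λ x → Y v u x * Z t u x) ≡ 0ℚ
    YZ-orthogonal {zero}  {t} {u} _ _ _ = trans (E-cong (λ x → *-zeroˡ (Z t u x))) (E-const n 0ℚ)
    YZ-orthogonal {suc v} {t} {u} v<t t<u u<k = begin
      E n (λ x → (Y v u x + Z v u x) * Z t u x)
        ≡⟨ E-cong (λ x → *-distribʳ-+ (Z t u x) (Y v u x) (Z v u x)) ⟩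
      E n (λ x → Y v u x * Z t u x + Z v u x * Z t u x)
        ≡⟨ E-+ (λ x → Y v u x * Z t u x) (λ x → Z v u x * Z t u x) ⟩
      E n (λ x → Y v u x * Z t u x) + E n (λ x → Z v u x * Z t u x)
        ≡⟨ cong₂ _+_ (YZ-orthogonal (ℕₚ.<⇒≤ v<t) t<u u<k) (Z-orthogonal v<t t<u u<k) ⟩
      0ℚ ∎
      where open ≡-Reasoning

    E-Y²≤ : ∀ {v u} → v ℕ.≤ u → u ℕ.< k → E n (λ x → Y v u x ²) ≤ fromℕ v
    E-Y²≤ {zero}  {u} _ _ = ≤-reflexive (E-const n 0ℚ)
    E-Y²≤ {suc v} {u} v<u u<k = begin
      E n (λ x → (Y v u x + Z v u x) ²)
        ≡⟨ E-cong (λ x → solve 2 (λ y z → (y :+ z) :* (y :+ z) := z :* z :+ (y :* y :+ (con 1ℚ :+ con 1ℚ) :* (y :* z))) refl (Y v u x) (Z v u x)) ⟩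
      E n (λ x → Z v u x ² + (Y v u x ² + (1ℚ + 1ℚ) * (Y v u x * Z v u x)))
        ≡⟨ E-+ (λ x → Z v u x ²) (λ x → Y v u x ² + (1ℚ + 1ℚ) * (Y v u x * Z v u x)) ⟩
      E n (λ x → Z v u x ²) + E n (λ x → Y v u x ² + (1ℚ + 1ℚ) * (Y v u x * Z v u x))
        ≡⟨ cong (E n (λ x → Z v u x ²) +_) (E-+ (λ x → Y v u x ²) (λ x → (1ℚ + 1ℚ) * (Y v u x * Z v u x))) ⟩
      E n (λ x → Z v u x ²) + (E n (λ x → Y v u x ²) + E n (λ x → (1ℚ + 1ℚ) * (Y v u x * Z v u x)))
        ≡⟨ cong (λ e → E n (λ x → Z v u x ²) + (E n (λ x → Y v u x ²) + e)) cross ⟩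
      E n (λ x → Z v u x ²) + (E n (λ x → Y v u x ²) + 0ℚ)
        ≡⟨ cong (E n (λ x → Z v u x ²) +_) (+-identityʳ (E n (λ x → Y v u x ²))) ⟩
      E n (λ x → Z v u x ²) + E n (λ x → Y v u x ²)
        ≤⟨ +-mono-≤ (E-≤const (Z²≤1 v u)) (E-Y²≤ (ℕₚ.<⇒≤ v<u) u<k) ⟩
      1ℚ + fromℕ v ∎
      where
      open ≤-Reasoning
      cross : E n (λ x → (1ℚ + 1ℚ) * (Y v u x * Z v u x)) ≡ 0ℚ
      cross = trans (E-*ˡ (1ℚ + 1ℚ) (λ x → Y v u x * Z v u x))
        (trans (cong ((1ℚ + 1ℚ) *_) (YZ-orthogonal ℕₚ.≤-refl v<u u<k)) (*-zeroʳ (1ℚ + 1ℚ)))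

    -- Where `P u` has the value of `f`, agreeing with `f` is the same as meeting `P u`; so the
    -- agreements before `v` are controlled by the process for `u`.
    twice-T≤ : ∀ {v u} → v ℕ.≤ u → u ℕ.< k → ∀ x → f x ≈ ⟦ P u ⟧ x → T v x + T v x ≤ fromℕ v + Y v u x
    twice-T≤ {zero}  {u} _ _ x e = ≤-refl
    twice-T≤ {suc v} {u} v<u u<k x e = begin
      (T v x + S v x) + (T v x + S v x)
        ≡⟨ cong (λ s → (T v x + ind s) + (T v x + ind s)) S≡meet ⟩
      (T v x + i) + (T v x + i)
        ≡⟨ solve 2 (λ t i → (t :+ i) :+ (t :+ i) := (t :+ t) :+ (i :+ i)) refl (T v x) i ⟩
      (T v x + T v x) + (i + i)
        ≤⟨ +-mono-≤ (twice-T≤ (ℕₚ.<⇒≤ v<u) u<k x e) (twice-meet≤ v<u u<k x) ⟩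
      (fromℕ v + Y v u x) + (1ℚ + Z v u x)
        ≡⟨ solve 3 (λ v y z → (v :+ y) :+ (con 1ℚ :+ z) := (con 1ℚ :+ v) :+ (y :+ z)) refl (fromℕ v) (Y v u x) (Z v u x) ⟩
      (1ℚ + fromℕ v) + (Y v u x + Z v u x) ∎
      where
      open ≤-Reasoning
      i = ind (meet v u x)
      S≡meet : eqb (f x) (⟦ P v ⟧ x) ≡ meet v u x
      S≡meet = eqb-cong (λ h → ≈-trans (≈-sym h) e) (λ h → ≈-trans e (≈-sym h))

    module _ (κ : ℚ) (0≤κ : 0ℚ ≤ κ) where

      -- The AM-GM bound for `κ * Y u u x`. The index `u` at which a large `Y` occurs depends on
      -- `x`; nonnegative bounds with controlled mean can simply be summed over all `u`.
      V : ℕ → Cube n → ℚ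
      V u x = ½ * (Y u u x ² + κ ²)

      V-nonneg : ∀ u x → 0ℚ ≤ V u x
      V-nonneg u x = 0≤* 0≤½ (0≤+ (0≤² (Y u u x)) (0≤² κ))

      κY≤V : ∀ u x → κ * Y u u x ≤ V u x
      κY≤V u x = ≤-from-gap (½ * (Y u u x - κ) ²) (0≤* 0≤½ (0≤² (Y u u x - κ)))
        (solve 2 (λ y c → con ½ :* (y :* y :+ c :* c) := c :* y :+ con ½ :* ((y :- c) :* (y :- c))) refl (Y u u x) κ)

      excess : ℕ → ℕ → Cube n → ℚ
      excess v J x = T v x + T v x - fromℕ k - (fromℕ J + fromℕ J)

      -- Each of the last J indices u < v with f x = P u x sees at least
      -- T v x − J earlier agreements, which twice-T≤ bounds by (k + Y u u x) / 2.
      excess≤ : ∀ v → v ℕ.≤ k → ∀ J x → fromℕ J * (κ * excess v J x) ≤ Σ< v (λ u → V u x)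
      excess≤ zero    _ J x = ≤-from-gap (fromℕ J * (κ * (fromℕ k + (fromℕ J + fromℕ J))))
        (0≤* (0≤fromℕ J) (0≤* 0≤κ (0≤+ (0≤fromℕ k) (0≤+ (0≤fromℕ J) (0≤fromℕ J)))))
        (solve 3 (λ j c k → con 0ℚ := j :* (c :* (con 0ℚ :- k :- (j :+ j))) :+ j :* (c :* (k :+ (j :+ j)))) refl (fromℕ J) κ (fromℕ k))
      excess≤ (suc v) v<k J x = go J (eqb (f x) (⟦ P v ⟧ x)) refl
        where
        open ≤-Reasoning
        k≥v : fromℕ v ≤ fromℕ k
        k≥v = fromℕ-mono (ℕₚ.<⇒≤ v<k)
        new≤ : ∀ J → f x ≈ ⟦ P v ⟧ x → κ * excess v J x ≤ V v x
        new≤ J e = ≤-trans (*-monoˡ 0≤κ (begin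
          T v x + T v x - fromℕ k - (fromℕ J + fromℕ J)
            ≤⟨ ≤-from-gap (((fromℕ v + Y v v x) - (T v x + T v x)) + (fromℕ k - fromℕ v) + (fromℕ J + fromℕ J))
                 (0≤+ (0≤+ (gap (twice-T≤ ℕₚ.≤-refl v<k x e)) (gap k≥v)) (0≤+ (0≤fromℕ J) (0≤fromℕ J)))
                 (solve 5 (λ t k j v y → y := (t :+ t :- k :- (j :+ j)) :+ (((v :+ y) :- (t :+ t)) :+ (k :- v) :+ (j :+ j))) refl
                   (T v x) (fromℕ k) (fromℕ J) (fromℕ v) (Y v v x)) ⟩
          Y v v x ∎)) (κY≤V v x)
        go : ∀ J β → eqb (f x) (⟦ P v ⟧ x) ≡ β →
             fromℕ J * (κ * (T v x + ind (eqb (f x) (⟦ P v ⟧ x)) + (T v x + ind (eqb (f x) (⟦ P v ⟧ x))) - fromℕ k - (fromℕ J + fromℕ J))) ≤ Σ< v (λ u → V u x) + V v x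
        go J false eq rewrite eq = begin
          fromℕ J * (κ * (T v x + 0ℚ + (T v x + 0ℚ) - fromℕ k - (fromℕ J + fromℕ J)))
            ≡⟨ cong (λ t → fromℕ J * (κ * (t + t - fromℕ k - (fromℕ J + fromℕ J)))) (+-identityʳ (T v x)) ⟩
          fromℕ J * (κ * excess v J x)
            ≤⟨ excess≤ v (ℕₚ.<⇒≤ v<k) J x ⟩
          Σ< v (λ u → V u x)
            ≤⟨ ≤-from-gap (V v x) (V-nonneg v x) refl ⟩
          Σ< v (λ u → V u x) + V v x ∎
        go zero true eq = ≤-trans (≤-reflexive (*-zeroˡ (κ * (T v x + ind (eqb (f x) (⟦ P v ⟧ x)) + (T v x + ind (eqb (f x) (⟦ P v ⟧ x))) - fromℕ k - (0ℚ + 0ℚ)))))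
          (Σ<-nonneg (suc v) (λ u → V u x) (λ u → V-nonneg u x))
        -- An agreement at `v` raises the number of agreements by one, and so does passing from `J`
        -- to `suc J`; `excess` is therefore unchanged, and the one surplus copy is paid for by
        -- `V v x`.
        go (suc J) true eq rewrite eq = begin
          (1ℚ + fromℕ J) * (κ * (T v x + 1ℚ + (T v x + 1ℚ) - fromℕ k - (1ℚ + fromℕ J + (1ℚ + fromℕ J))))
            ≡⟨ solve 4 (λ j c t k → (con 1ℚ :+ j) :* (c :* (t :+ con 1ℚ :+ (t :+ con 1ℚ) :- k :- (con 1ℚ :+ j :+ (con 1ℚ :+ j))))
                       := j :* (c :* (t :+ t :- k :- (j :+ j))) :+ c :* (t :+ t :- k :- (j :+ j))) refl (fromℕ J) κ (T v x) (fromℕ k) ⟩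
          fromℕ J * (κ * excess v J x) + κ * excess v J x
            ≤⟨ +-mono-≤ (excess≤ v (ℕₚ.<⇒≤ v<k) J x) (new≤ J (eqb⇒≈ eq)) ⟩
          Σ< v (λ u → V u x) + V v x ∎

      E-V≤ : ∀ u → u ℕ.< k → E n (V u) ≤ ½ * (fromℕ k + κ ²)
      E-V≤ u u<k = begin
        E n (V u)                                 ≡⟨ E-*ˡ ½ (λ x → Y u u x ² + κ ²) ⟩
        ½ * E n (λ x → Y u u x ² + κ ²)           ≡⟨ cong (½ *_) (trans (E-+ (λ x → Y u u x ²) (λ _ → κ ²)) (cong (E n (λ x → Y u u x ²) +_) (E-const n (κ ²)))) ⟩
        ½ * (E n (λ x → Y u u x ²) + κ ²)         ≤⟨ *-monoˡ 0≤½ (+-monoˡ-≤ (κ ²) (≤-trans (E-Y²≤ ℕₚ.≤-refl u<k) (fromℕ-mono (ℕₚ.<⇒≤ u<k)))) ⟩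
        ½ * (fromℕ k + κ ²)                       ∎
        where open ≤-Reasoning

      E-T≥ : fromℕ k * (½ + η) ≤ E n (T k)
      E-T≥ = subst (fromℕ k * (½ + η) ≤_) (sym (E-Σ< k S)) (Σ<-≥ k (λ s → E n (S s)) (½ + η) listed)

      -- This is `excess≤` at `v` = `k` in expectation: the left side is affine in the number of
      -- agreements, whose mean is at least k(1/2 + η), and every `V u` has mean at most (k + κ²)/2.
      triangular-inequality : ∀ J → fromℕ J * (κ * (fromℕ k * (η + η) - (fromℕ J + fromℕ J))) ≤ fromℕ k * (½ * (fromℕ k + κ ²))
      triangular-inequality J = begin
        j * (κ * (fromℕ k * (η + η) - (j + j)))
          ≤⟨ *-monoˡ (0≤fromℕ J) (*-monoˡ 0≤κ (≤-from-gap ((E n (T k) - fromℕ k * (½ + η)) + (E n (T k) - fromℕ k * (½ + η)))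
               (0≤+ (gap E-T≥) (gap E-T≥))
               (solve 4 (λ t k h j → t :+ t :- k :- (j :+ j) := (k :* (h :+ h) :- (j :+ j)) :+ ((t :- k :* (con ½ :+ h)) :+ (t :- k :* (con ½ :+ h)))) refl (E n (T k)) (fromℕ k) η j))) ⟩
        j * (κ * (E n (T k) + E n (T k) - fromℕ k - (j + j)))
          ≡⟨ cong (λ e → j * (κ * e)) E-excess ⟨
        j * (κ * E n (excess k J))
          ≡⟨ cong (j *_) (E-*ˡ κ (excess k J)) ⟨
        j * E n (λ x → κ * excess k J x)
          ≡⟨ E-*ˡ j (λ x → κ * excess k J x) ⟨
        E n (λ x → j * (κ * excess k J x))
          ≤⟨ E-mono (excess≤ k ℕₚ.≤-refl J) ⟩
        E n (λ x → Σ< k (λ u → V u x))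
          ≡⟨ E-Σ< k V ⟩
        Σ< k (λ u → E n (V u))
          ≤⟨ Σ<-≤ k (λ u → E n (V u)) (½ * (fromℕ k + κ ²)) E-V≤ ⟩
        fromℕ k * (½ * (fromℕ k + κ ²)) ∎
        where
        open ≤-Reasoning
        j = fromℕ J
        E-excess : E n (excess k J) ≡ E n (T k) + E n (T k) - fromℕ k - (j + j)
        E-excess = trans (E-shift (j + j) (λ x → T k x + T k x - fromℕ k)) (cong (_- (j + j))
          (trans (E-shift (fromℕ k) (λ x → T k x + T k x)) (cong (_- fromℕ k) (E-+ (T k) (T k)))))

  module _ {n} (f : Cube n → Carrier) {η : ℚ} (0<η : 0ℚ < η) (e : ℕ) (1≤eη : 1ℚ ≤ fromℕ e * η) where

    -- The choice k = m⁴, κ = m², J = m³ balances the error terms J and k √k / J of triangular-inequality.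
    private
      m k : ℕ
      m = 2 ℕ.* e
      k = m ℕ.* m ℕ.* (m ℕ.* m)

      J : ℕ
      J = m ℕ.* (m ℕ.* m)

      μ : ℚ
      μ = fromℕ m

      k≡ : fromℕ k ≡ μ * μ * (μ * μ)
      k≡ = trans (fromℕ-* (m ℕ.* m) (m ℕ.* m)) (cong₂ _*_ (fromℕ-* m m) (fromℕ-* m m))

      J≡ : fromℕ J ≡ μ * (μ * μ)
      J≡ = trans (fromℕ-* m (m ℕ.* m)) (cong (μ *_) (fromℕ-* m m))

      2≤μη : 1ℚ + 1ℚ ≤ μ * η
      2≤μη = subst (1ℚ + 1ℚ ≤_)
        (trans (solve 2 (λ e h → e :* h :+ e :* h := (e :+ e) :* h) refl (fromℕ e) η)
          (cong (_* η) (sym (trans (fromℕ-+ e (e ℕ.+ 0)) (cong (λ z → fromℕ e + fromℕ z) (ℕₚ.+-identityʳ e))))))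
        (+-mono-≤ 1≤eη 1≤eη)

      0<μ : 0ℚ < μ
      0<μ = *-cancelʳ-<-nonNeg η {{nonNegative (<⇒≤ 0<η)}} {0ℚ} {μ}
        (subst (_< μ * η) (sym (*-zeroˡ η)) (<-≤-trans (positive⁻¹ (1ℚ + 1ℚ)) 2≤μη))

      μ⁸ : ℚ
      μ⁸ = (μ * μ * (μ * μ)) * (μ * μ * (μ * μ))

      0<μ⁸ : 0ℚ < μ⁸
      0<μ⁸ = positive⁻¹ μ⁸ {{pos*pos⇒pos (μ * μ * (μ * μ)) {{p₄}} (μ * μ * (μ * μ)) {{p₄}}}}
        where
        p₂ : Positive (μ * μ)
        p₂ = pos*pos⇒pos μ {{positive 0<μ}} μ {{positive 0<μ}}
        p₄ : Positive (μ * μ * (μ * μ))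
        p₄ = pos*pos⇒pos (μ * μ) {{p₂}} (μ * μ) {{p₂}}

      no-triangular : ∀ {Ps} → All (InList f η) Ps → ¬ Triangular f 0<η k Ps
      no-triangular listed T = <-irrefl refl (<-≤-trans 0<μ⁸ (begin
        μ⁸
          ≤⟨ ≤-from-gap ((μ * η - (1ℚ + 1ℚ)) * (μ⁸ + μ⁸)) (0≤* (gap 2≤μη) (0≤+ (<⇒≤ 0<μ⁸) (<⇒≤ 0<μ⁸)))
               (solve 2 (λ u h → let p = u :* u :* (u :* u) in
                   u :* (u :* u) :* ((u :* u) :* (p :* (h :+ h) :- (u :* (u :* u) :+ u :* (u :* u)))) :- p :* p
                     := p :* p :+ (u :* h :- (con 1ℚ :+ con 1ℚ)) :* (p :* p :+ p :* p)) refl μ η) ⟩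
        μ * (μ * μ) * ((μ * μ) * (μ * μ * (μ * μ) * (η + η) - (μ * (μ * μ) + μ * (μ * μ)))) - μ⁸
          ≡⟨ cong (_- μ⁸) (cong₂ (λ j k → j * ((μ * μ) * (k * (η + η) - (j + j)))) J≡ k≡) ⟨
        fromℕ J * ((μ * μ) * (fromℕ k * (η + η) - (fromℕ J + fromℕ J))) - μ⁸
          ≤⟨ +-monoˡ-≤ (- μ⁸) (triangular-inequality f {η} k T.P T.b
               (λ s s<k → InList⇒agree η (T.P s) (All.lookup listed (T.member s s<k))) T.diag T.below
               (μ * μ) (0≤² μ) J) ⟩
        fromℕ k * (½ * (fromℕ k + (μ * μ) ²)) - μ⁸
          ≡⟨ cong (λ k → k * (½ * (k + (μ * μ) ²)) - μ⁸) k≡ ⟩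
        μ * μ * (μ * μ) * (½ * (μ * μ * (μ * μ) + (μ * μ) ²)) - μ⁸
          ≡⟨ solve 1 (λ u → let p = u :* u :* (u :* u) in
               p :* (con ½ :* (p :+ p)) :- p :* p := con 0ℚ) refl μ ⟩
        0ℚ ∎))
        where
        open ≤-Reasoning
        module T = Triangular T

    -- The bound involves `e` alone, not the group, the dimension or `f`, so it may enter the query
    -- bound.
    list-bound : ∀ Ps → AllPairs Distinct Ps → All (InList f η) Ps → length Ps ℕ.≤ listBound e
    list-bound Ps dist listed = ℕₚ.≮⇒≥ λ large →
      no-triangular listed (large⇒triangular f 0<η e 1≤eη k Ps dist listed large)

-- Decision trees over group terms and their compilation.

module Programs where
  open import Data.Bool using (Bool; true; false; not; if_then_else_)
  open import Data.Fin using (Fin; zero; suc)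
  open import Data.Integer using (+_)
  open import Data.List as List using (List; []; _∷_; length; null)
  open import Data.Maybe using (Maybe; just; nothing)
  open import Data.Nat using (ℕ; zero; suc; _^_)
  open import Data.Nat.Properties using (m^n≢0)
  open import Data.Product using (_×_; _,_)
  open import Data.Rational using (ℚ; _/_)
  open import Data.Rational.Properties using (_≤?_)
  open import Data.Vec using (Vec; []; _∷_; _[_]≔_; lookup; tabulate)
  open import Function using (_∘_; id)
  open import Relation.Nullary using (does)

  infixl 7 _·_
  data Tm (X : Set) : Set where
    var : X → Tm X
    one : Tm X
    _·_ : Tm X → Tm X → Tm X
    inv : Tm X → Tm X

  -- Decision trees branching on equality of group terms over X.
  data DT (X O : Set) : Set where
    ret : O → DT X O
    tst : Tm X → Tm X → DT X O → DT X O → DT X O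

  infixl 1 _>>=_
  _>>=_ : ∀ {X O O′} → DT X O → (O → DT X O′) → DT X O′
  ret o       >>= k = k o
  tst s t a b >>= k = tst s t (a >>= k) (b >>= k)

  renT : ∀ {X Y} → (X → Y) → Tm X → Tm Y
  renT ρ (var x) = var (ρ x)
  renT ρ one     = one
  renT ρ (s · t) = renT ρ s · renT ρ t
  renT ρ (inv t) = inv (renT ρ t)

  renD : ∀ {X Y O} → (X → Y) → DT X O → DT Y O
  renD ρ (ret o)       = ret o
  renD ρ (tst s t a b) = tst (renT ρ s) (renT ρ t) (renD ρ a) (renD ρ b)

  differD : ∀ {X} → Tm X → Tm X → DT X Bool
  differD s t = tst s t (ret false) (ret true)

  filterD : ∀ {X A} → (A → DT X Bool) → List A → DT X (List A)
  filterD p []      = ret []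
  filterD p (x ∷ l) = p x >>= λ b → filterD p l >>= λ l′ → ret (if b then x ∷ l′ else l′)

  -- Many candidates define the same function, while the maximal list size only limits lists of
  -- pairwise distinct ones.
  dedupD : ∀ {X A} → (A → A → DT X Bool) → List A → DT X (List A)
  dedupD r []      = ret []
  dedupD r (x ∷ l) = dedupD r l >>= λ l′ → filterD (r x) l′ >>= λ l″ → ret (x ∷ l″)

  -- Continuation-passing, because each operation pushes a register and shifts the older ones: the
  -- continuation receives the renaming of the old registers along with the register of the result.
  compileT : ∀ {X O n m} → Tm X → (X → Fin m) →
             (∀ {m′} → (Fin m → Fin m′) → Fin m′ → Prog O n m′) → Prog O n m
  compileT (var x) env k = k id (env x)
  compileT one     env k = unit (k suc zero)
  compileT (s · t) env k = compileT s env λ ρ i → compileT t (ρ ∘ env) λ ρ′ j →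
                             mul (ρ′ i) j (k (suc ∘ ρ′ ∘ ρ) zero)
  compileT (inv t) env k = compileT t env λ ρ i → inv i (k (suc ∘ ρ) zero)

  compileD : ∀ {X n m} → DT X (Tm X) → (X → Fin m) → Prog Fin n m
  compileD (ret t)       env = compileT t env λ ρ i → out i
  compileD (tst s t a b) env = compileT s env λ ρ i → compileT t (ρ ∘ env) λ ρ′ j →
    test (ρ′ i) j (compileD a (ρ′ ∘ ρ ∘ env)) (compileD b (ρ′ ∘ ρ ∘ env))

  -- The whole subcube is read before any test is made, so the number of queries does not depend on
  -- the branch taken.
  queryAll : ∀ {O n m} K → (Cube K → Cube n) →
             (∀ {m′} → (Fin m → Fin m′) → (Cube K → Fin m′) → Prog O n m′) → Prog O n m
  queryAll zero    pt k = query (pt []) (k suc λ _ → zero)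
  queryAll (suc K) pt k = queryAll K (pt ∘ (true ∷_)) λ ρ e → queryAll K (pt ∘ (false ∷_)) λ ρ′ e′ →
    k (ρ′ ∘ ρ) λ { (true ∷ y) → ρ′ (e y) ; (false ∷ y) → e′ y }

  program : ∀ {n} K → (Cube K → Cube n) → DT (Cube K) (Tm (Cube K)) → Prog Fin n 0
  program K pt d = queryAll K pt λ ρ e → compileD d e

  -- A function in the list agrees with the oracle on both ends of some edge in every
  -- direction, hence it is determined by one vertex and one edge per direction.
  Cand : ℕ → Set
  Cand K = Cube K × Vec (Cube K) K

  vecs : ∀ {A : Set} → List A → ∀ k → List (Vec A k)
  vecs l zero    = [] ∷ []
  vecs l (suc k) = List.cartesianProductWith _∷_ l (vecs l k)

  allCands : ∀ K → List (Cand K)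
  allCands K = List.cartesianProduct (allPoints K) (vecs (allPoints K) K)

  -- The oracle difference across the edge in direction b through the recorded point. Overwriting
  -- the bit orders the two ends, so either end may have been recorded.
  coefsT : ∀ {K} → Vec (Cube K) K → Vec (Tm (Cube K)) K
  coefsT ys = tabulate λ b → var (lookup ys b [ b ]≔ true) · inv (var (lookup ys b [ b ]≔ false))

  linearT : ∀ {X k} → Vec (Tm X) k → Cube k → Tm X
  linearT []      []      = one
  linearT (t ∷ v) (b ∷ x) = (if b then t else one) · linearT v x

  constT : ∀ {K} → Cand K → Tm (Cube K)
  constT (y₀ , ys) = var y₀ · inv (linearT (coefsT ys) y₀)

  valueT : ∀ {K} → Cand K → Cube K → Tm (Cube K)
  valueT c@(y₀ , ys) y = constT c · linearT (coefsT ys) y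

  agreesWithinD : ∀ {K} → ℚ → Cand K → DT (Cube K) Bool
  agreesWithinD {K} τ c = filterD (λ y → differD (var y) (valueT c y)) (allPoints K) >>= λ l →
    ret (does (_/_ (+ length l) (2 ^ K) {{m^n≢0 2 K}} ≤? τ))

  distinctD : ∀ {K} → Cand K → Cand K → DT (Cube K) Bool
  distinctD {K} c c′ = filterD (λ y → differD (valueT c y) (valueT c′ y)) (allPoints K) >>= λ l → ret (not (null l))

  listD : ∀ {K} → ℚ → DT (Cube K) (List (Cand K))
  listD {K} τ = filterD (agreesWithinD τ) (allCands K) >>= dedupD distinctD

  nth : ∀ {A : Set} → ℕ → List A → Maybe A
  nth j       []      = nothing
  nth zero    (x ∷ l) = just x
  nth (suc j) (x ∷ l) = nth j l

  -- The two halves of Cube (suc K) address two copies of Cube K.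
  consistentD : ∀ {K} → (Cube K → Cube K) → Cand K → Cand K → DT (Cube (suc K)) Bool
  consistentD {K} ι c c′ =
    filterD (λ y → differD (renT (true ∷_) (valueT c (ι y))) (renT (false ∷_) (valueT c′ (ι y)))) (allPoints K) >>= λ l →
    ret (null l)

  firstValueT : ∀ {K} → Cube K → List (Cand K) → Tm (Cube (suc K))
  -- An arbitrary value: without a consistent candidate the output at this input carries no promise.
  firstValueT d []      = one
  firstValueT d (c ∷ _) = renT (false ∷_) (valueT c d)

  extendD : ∀ {K} → ℚ → (Cube K → Cube K) → Cube K → Maybe (Cand K) → DT (Cube (suc K)) (Tm (Cube (suc K)))
  -- The number of oracle algorithms is fixed in advance, so `j` may lie beyond the end of the local
  -- list.
  extendD τ ι d nothing  = ret one
  extendD τ ι d (just c) = renD (false ∷_) (listD τ) >>= λ l → filterD (consistentD ι c) l >>= λ l′ → ret (firstValueT d l′)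

  -- τ is the admitted distance, ι maps onto the common subcube, d is the vertex of the input.
  correctorD : ∀ {K} → ℚ → (Cube K → Cube K) → Cube K → ℕ → DT (Cube (suc K)) (Tm (Cube (suc K)))
  correctorD τ ι d j = renD (true ∷_) (listD τ) >>= λ l → extendD τ ι d (nth j l)

-- Compiled programs compute their trees at a known query cost.

module ProgramSemantics {c ℓ} (G : AbelianGroup c ℓ) (_≟_ : Decidable (AbelianGroup._≈_ G)) where
  open import Data.Bool using (Bool; true; false; not; if_then_else_)
  open import Data.Fin using (Fin; zero; suc)
  open import Data.List using (List; []; _∷_; filterᵇ)
  open import Data.Maybe using (Maybe)
  open import Data.Nat as ℕ using (ℕ; zero; suc; _^_)
  import Data.Nat.Properties as ℕₚ
  open import Data.Product using (_,_; proj₁; proj₂)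
  open import Data.Vec using (Vec; []; _∷_; lookup)
  open import Function using (_∘_)
  open import Relation.Binary.PropositionalEquality
  open import Relation.Nullary using (yes; no; does)

  open AbelianGroup G using (Carrier; _∙_; ε; _⁻¹)
  open WithGroup G _≟_
  open Programs

  evalT : ∀ {X} → (X → Carrier) → Tm X → Carrier
  evalT g (var x) = g x
  evalT g one     = ε
  evalT g (s · t) = evalT g s ∙ evalT g t
  evalT g (inv t) = evalT g t ⁻¹

  evalD : ∀ {X O} → (X → Carrier) → DT X O → O
  evalD g (ret o)       = o
  evalD g (tst s t a b) = if does (evalT g s ≟ evalT g t) then evalD g a else evalD g b

  evalD->>= : ∀ {X O O′} (g : X → Carrier) (d : DT X O) (k : O → DT X O′) →
              evalD g (d >>= k) ≡ evalD g (k (evalD g d))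
  evalD->>= g (ret o)       k = refl
  evalD->>= g (tst s t a b) k with does (evalT g s ≟ evalT g t)
  ... | true  = evalD->>= g a k
  ... | false = evalD->>= g b k

  evalT-ren : ∀ {X Y} (ρ : X → Y) (g : Y → Carrier) t → evalT g (renT ρ t) ≡ evalT (g ∘ ρ) t
  evalT-ren ρ g (var x) = refl
  evalT-ren ρ g one     = refl
  evalT-ren ρ g (s · t) = cong₂ _∙_ (evalT-ren ρ g s) (evalT-ren ρ g t)
  evalT-ren ρ g (inv t) = cong _⁻¹ (evalT-ren ρ g t)

  evalD-ren : ∀ {X Y O} (ρ : X → Y) (g : Y → Carrier) (d : DT X O) → evalD g (renD ρ d) ≡ evalD (g ∘ ρ) d
  evalD-ren ρ g (ret o) = refl
  evalD-ren ρ g (tst s t a b)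
    rewrite evalT-ren ρ g s | evalT-ren ρ g t | evalD-ren ρ g a | evalD-ren ρ g b = refl

  evalD-differ : ∀ {X} (g : X → Carrier) s t → evalD g (differD s t) ≡ not (does (evalT g s ≟ evalT g t))
  evalD-differ g s t with does (evalT g s ≟ evalT g t)
  ... | true  = refl
  ... | false = refl

  evalD-filter : ∀ {X A} (g : X → Carrier) (p : A → DT X Bool) (q : A → Bool) → (∀ x → evalD g (p x) ≡ q x) →
                 ∀ l → evalD g (filterD p l) ≡ filterᵇ q l
  evalD-filter g p q pq []      = refl
  evalD-filter g p q pq (x ∷ l)
    rewrite evalD->>= g (p x) (λ b → filterD p l >>= λ l′ → ret (if b then x ∷ l′ else l′))
          | evalD->>= g (filterD p l) (λ l′ → ret (if evalD g (p x) then x ∷ l′ else l′))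
          | evalD-filter g p q pq l | pq x with q x
  ... | true  = refl
  ... | false = refl

  result : ∀ {n m} → (Cube n → Carrier) → Prog Fin n m → Vec Carrier m → Carrier
  result f p rs = lookup (proj₂ (proj₂ (exec f p rs))) (proj₁ (proj₂ (exec f p rs)))

  runPsi≡result : ∀ {n m} (f : Cube n → Carrier) (ψ : Psi n m) rs x → runPsi f ψ rs x ≡ result f (ψ x) rs
  runPsi≡result f ψ rs x with exec f (ψ x) rs
  ... | _ , _ , _ = refl

  -- The cost is an equality rather than a bound: all queries precede the tests, so both branches of
  -- a test have the same cost.
  record Runs {n m} (f : Cube n → Carrier) (p : Prog Fin n m) (rs : Vec Carrier m) (v : Carrier) (q : ℕ) : Set c where
    constructor runs
    field
      output : result f p rs ≡ v
      cost   : queries f p rs ≡ q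

  compileT-runs : ∀ {X n m} {f : Cube n → Carrier} {g : X → Carrier} t {env : X → Fin m} {rs v q}
    {k : ∀ {m′} → (Fin m → Fin m′) → Fin m′ → Prog Fin n m′} →
    (∀ x → lookup rs (env x) ≡ g x) →
    (∀ {m′} (ρ : Fin m → Fin m′) i rs′ → (∀ l → lookup rs′ (ρ l) ≡ lookup rs l) → lookup rs′ i ≡ evalT g t → Runs f (k ρ i) rs′ v q) →
    Runs f (compileT t env k) rs v q
  compileT-runs (var x) henv hk = hk _ _ _ (λ l → refl) (henv x)
  compileT-runs one     henv hk with hk _ _ (ε ∷ _) (λ l → refl) refl
  ... | runs r q = runs r q
  compileT-runs {g = g} (s · t) henv hk = compileT-runs s henv λ ρ i rs₁ old₁ new₁ →
    compileT-runs t (λ x → trans (old₁ _) (henv x)) λ ρ′ j rs₂ old₂ new₂ →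
      let runs r q = hk _ _ (lookup rs₂ (ρ′ i) ∙ lookup rs₂ j ∷ rs₂) (λ l → trans (old₂ _) (old₁ l)) (cong₂ _∙_ (trans (old₂ i) new₁) new₂)
      in runs r q
  compileT-runs (inv t) henv hk = compileT-runs t henv λ ρ i rs₁ old₁ new₁ →
    let runs r q = hk _ _ (lookup rs₁ i ⁻¹ ∷ rs₁) old₁ (cong _⁻¹ new₁) in runs r q

  test-runs : ∀ {n m} {f : Cube n → Carrier} {i j : Fin m} {p p′ : Prog Fin n m} {rs v v′ q g h} →
    lookup rs i ≡ g → lookup rs j ≡ h → Runs f p rs v q → Runs f p′ rs v′ q →
    Runs f (test i j p p′) rs (if does (g ≟ h) then v else v′) q
  test-runs {f = f} {i} {j} {p} {p′} {rs} {v} {v′} {q} refl refl (runs r c) (runs r′ c′) = runs output cost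
    where
    output : result f (test i j p p′) rs ≡ (if does (lookup rs i ≟ lookup rs j) then v else v′)
    output with lookup rs i ≟ lookup rs j
    ... | yes _ = r
    ... | no  _ = r′
    cost : queries f (test i j p p′) rs ≡ q
    cost with lookup rs i ≟ lookup rs j
    ... | yes _ = c
    ... | no  _ = c′

  evalT-if : ∀ {X} (g : X → Carrier) β (s t : Tm X) → evalT g (if β then s else t) ≡ (if β then evalT g s else evalT g t)
  evalT-if g true  s t = refl
  evalT-if g false s t = refl

  compileD-runs : ∀ {X n m} {f : Cube n → Carrier} {g : X → Carrier} (d : DT X (Tm X)) {env : X → Fin m} {rs} →
    (∀ x → lookup rs (env x) ≡ g x) → Runs f (compileD d env) rs (evalT g (evalD g d)) 0
  compileD-runs (ret t) henv = compileT-runs t henv λ ρ i rs′ old new → runs new refl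
  compileD-runs {f = f} {g} (tst s t a b) henv = compileT-runs s henv λ ρ i rs₁ old₁ new₁ →
    compileT-runs t (λ x → trans (old₁ _) (henv x)) λ ρ′ j rs₂ old₂ new₂ →
      let henv′ = λ x → trans (old₂ _) (trans (old₁ _) (henv x)) in
      subst (λ v → Runs f _ rs₂ v 0) (sym (evalT-if g (does (evalT g s ≟ evalT g t)) (evalD g a) (evalD g b)))
        (test-runs (trans (old₂ i) new₁) new₂ (compileD-runs a henv′) (compileD-runs b henv′))

  queryAll-runs : ∀ {n m} {f : Cube n → Carrier} K (pt : Cube K → Cube n) {rs v q}
    {k : ∀ {m′} → (Fin m → Fin m′) → (Cube K → Fin m′) → Prog Fin n m′} →
    (∀ {m′} (ρ : Fin m → Fin m′) e rs′ → (∀ l → lookup rs′ (ρ l) ≡ lookup rs l) → (∀ y → lookup rs′ (e y) ≡ f (pt y)) → Runs f (k ρ e) rs′ v q) →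
    Runs f (queryAll K pt k) rs v (2 ^ K ℕ.+ q)
  queryAll-runs zero pt hk =
    let runs r c = hk _ _ (_ ∷ _) (λ l → refl) (λ { [] → refl }) in runs r (cong suc c)
  queryAll-runs {f = f} (suc K) pt {rs} {v} {q} {k} hk =
    subst (Runs f (queryAll (suc K) pt k) rs v)
      (trans (sym (ℕₚ.+-assoc (2 ^ K) (2 ^ K) q)) (cong (λ z → 2 ^ K ℕ.+ z ℕ.+ q) (sym (ℕₚ.+-identityʳ (2 ^ K)))))
      (queryAll-runs K (pt ∘ (true ∷_)) λ ρ e rs₁ old₁ new₁ →
        queryAll-runs K (pt ∘ (false ∷_)) λ ρ′ e′ rs₂ old₂ new₂ →
          hk _ _ _ (λ l → trans (old₂ _) (old₁ l))
            λ { (true ∷ y) → trans (old₂ _) (new₁ y) ; (false ∷ y) → new₂ y })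

  program-runs : ∀ {n} (f : Cube n → Carrier) K (pt : Cube K → Cube n) d →
    Runs f (program K pt d) [] (evalT (f ∘ pt) (evalD (f ∘ pt) d)) (2 ^ K)
  program-runs f K pt d = subst (Runs f (program K pt d) [] _) (ℕₚ.+-identityʳ (2 ^ K))
    (queryAll-runs K pt λ ρ e rs′ old new → compileD-runs d new)

-- The computed list contains exactly the listed functions.

module LocalLists {c ℓ} (G : AbelianGroup c ℓ) (_≟_ : Decidable (AbelianGroup._≈_ G)) where
  open import Data.Bool using (Bool; true; false; not; T; T?)
  import Data.Bool.Properties as Bool
  open import Data.Empty using (⊥-elim)
  open import Data.Fin using (Fin; zero; suc)
  open import Data.List as List using (List; []; _∷_; length; null; filterᵇ; filter)
  open import Data.List.Membership.Propositional using (_∈_)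
  open import Data.List.Membership.Propositional.Properties
    using (∈-filter⁻; ∈-filter⁺; ∈-map⁺; ∈-++⁺ˡ; ∈-++⁺ʳ; ∈-cartesianProduct⁺; ∈-cartesianProductWith⁺)
  open import Data.List.Relation.Unary.All as All using (All; []; _∷_)
  import Data.List.Relation.Unary.All.Properties as All
  open import Data.List.Relation.Unary.AllPairs as AllPairs using (AllPairs; []; _∷_)
  import Data.List.Relation.Unary.AllPairs.Properties as AllPairs
  open import Data.List.Relation.Unary.Any using (here; there)
  import Data.Integer as ℤ
  open import Data.Maybe using (just)
  open import Data.Nat as ℕ using (ℕ; zero; suc; s≤s; z≤n)
  import Data.Nat.Properties as ℕₚ
  open import Data.Product using (∃; _×_; _,_; proj₁; proj₂)
  open import Data.Rational hiding (_≟_; _≥_; _>_)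
  open import Data.Rational.Properties hiding (_≟_)
  open import Data.Vec as Vec using (Vec; []; _∷_; lookup; tabulate; _[_]≔_)
  import Data.Vec.Properties as Vec
  open import Function using (_∘_)
  open import Relation.Binary.PropositionalEquality
  open import Relation.Nullary using (Dec; yes; no; does; ¬_; ¬?)

  open AbelianGroup G using (Carrier; _≈_; _∙_; ε; _⁻¹; ∙-cong; ∙-congˡ; ∙-congʳ; assoc; comm; identityʳ; inverseʳ; ⁻¹-cong)
    renaming (refl to ≈-refl; sym to ≈-sym; trans to ≈-trans; reflexive to ≈-reflexive)
  open WithGroup G _≟_
  open Expectation
  open ListBound G _≟_
  open Programs
  open ProgramSemantics G _≟_
  import Relation.Binary.Reasoning.Setoid (AbelianGroup.setoid G) as ≈R

  ∈-allPoints : ∀ {n} (x : Cube n) → x ∈ allPoints n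
  ∈-allPoints []          = here refl
  ∈-allPoints (true ∷ x)  = ∈-++⁺ˡ (∈-map⁺ (true ∷_) (∈-allPoints x))
  ∈-allPoints {suc n} (false ∷ x) = ∈-++⁺ʳ (List.map (true ∷_) (allPoints n)) (∈-map⁺ (false ∷_) (∈-allPoints x))

  ∈-vecs : ∀ {n k} (v : Vec (Cube n) k) → v ∈ vecs (allPoints n) k
  ∈-vecs []      = here refl
  ∈-vecs (x ∷ v) = ∈-cartesianProductWith⁺ _∷_ (∈-allPoints x) (∈-vecs v)

  ∈-allCands : ∀ {K} (γ : Cand K) → γ ∈ allCands K
  ∈-allCands (y , ys) = ∈-cartesianProduct⁺ (∈-allPoints y) (∈-vecs ys)

  T⇒≡ : ∀ {b} → T b → b ≡ true
  T⇒≡ {true} _ = refl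

  ≡⇒T : ∀ {b} → b ≡ true → T b
  ≡⇒T refl = _

  filterᵇ≡filter : ∀ {A : Set} {p} {P : A → Set p} (P? : ∀ x → Dec (P x)) l → filterᵇ (does ∘ P?) l ≡ filter P? l
  filterᵇ≡filter P? []      = refl
  filterᵇ≡filter P? (x ∷ l) with does (P? x)
  ... | true  = cong (x ∷_) (filterᵇ≡filter P? l)
  ... | false = filterᵇ≡filter P? l

  same : ∀ {n} → (Cube n → Carrier) → (Cube n → Carrier) → Bool
  same {n} g h = null (filterᵇ (λ y → not (eqb (g y) (h y))) (allPoints n))

  same⇒≈ : ∀ {n} (g h : Cube n → Carrier) → same g h ≡ true → ∀ y → g y ≈ h y
  same⇒≈ {n} g h eq y with g y ≟ h y in e
  ... | yes g≈h = g≈h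
  ... | no  _   = ⊥-elim (nonempty eq (∈-filter⁺ (λ z → T? (not (eqb (g z) (h z)))) (∈-allPoints y) (≡⇒T (cong (not ∘ does) e))))
    where
    nonempty : ∀ {l : List (Cube n)} → null l ≡ true → ¬ y ∈ l
    nonempty {[]} _ ()

  ≈⇒same : ∀ {n} (g h : Cube n → Carrier) → (∀ y → g y ≈ h y) → same g h ≡ true
  ≈⇒same {n} g h e = go (allPoints n)
    where
    go : ∀ l → null (filterᵇ (λ y → not (eqb (g y) (h y))) l) ≡ true
    go []      = refl
    go (y ∷ l) rewrite eqb-true (e y) = go l

  dedup : ∀ {A : Set} → (A → A → Bool) → List A → List A
  dedup q []      = []
  dedup q (x ∷ l) = x ∷ filterᵇ (q x) (dedup q l)

  evalD-dedup : ∀ {X A} (g : X → Carrier) (r : A → A → DT X Bool) (q : A → A → Bool) → (∀ x y → evalD g (r x y) ≡ q x y) →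
                ∀ l → evalD g (dedupD r l) ≡ dedup q l
  evalD-dedup g r q rq []      = refl
  evalD-dedup g r q rq (x ∷ l)
    rewrite evalD->>= g (dedupD r l) (λ l′ → filterD (r x) l′ >>= λ l″ → ret (x ∷ l″))
          | evalD->>= g (filterD (r x) (evalD g (dedupD r l))) (λ l″ → ret (x ∷ l″))
          | evalD-filter g (r x) (q x) (rq x) (evalD g (dedupD r l))
          | evalD-dedup g r q rq l = refl

  dedup-⊆ : ∀ {A : Set} (q : A → A → Bool) l {x} → x ∈ dedup q l → x ∈ l
  dedup-⊆ q (y ∷ l) (here eq) = here eq
  dedup-⊆ q (y ∷ l) (there i) = there (dedup-⊆ q l (proj₁ (∈-filter⁻ (T? ∘ q y) i)))

  dedup-pairs : ∀ {A : Set} (q : A → A → Bool) l → AllPairs (λ x y → q x y ≡ true) (dedup q l)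
  dedup-pairs q []      = []
  dedup-pairs q (x ∷ l) = All.map T⇒≡ (All.all-filter (T? ∘ q x) (dedup q l)) ∷ AllPairs.filter⁺ (T? ∘ q x) (dedup-pairs q l)

  -- A representative found in the tail may be removed by an earlier element equivalent to it, which
  -- then takes over by transitivity.
  dedup-covers : ∀ {A : Set} {r} {_~_ : A → A → Set r} (q : A → A → Bool) →
    (∀ x → x ~ x) → (∀ {x y z} → x ~ y → y ~ z → x ~ z) → (∀ x y → q x y ≡ false → x ~ y) →
    ∀ l {x} → x ∈ l → ∃ λ y → y ∈ dedup q l × y ~ x
  dedup-covers q rfl trn q⇒~ (z ∷ l) (here refl) = z , here refl , rfl z
  dedup-covers q rfl trn q⇒~ (z ∷ l) {x} (there i) with dedup-covers q rfl trn q⇒~ l i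
  ... | y , j , y~x with q z y in e
  ...   | true  = y , there (∈-filter⁺ (T? ∘ q z) j (≡⇒T e)) , y~x
  ...   | false = z , here refl , trn (q⇒~ z y e) y~x

  toAffine : ∀ {K} → (Cube K → Carrier) → Cand K → Affine K
  toAffine F γ = affine (evalT F (constT γ)) (Vec.map (evalT F) (coefsT (proj₂ γ)))

  value : ∀ {K} → (Cube K → Carrier) → Cand K → Cube K → Carrier
  value F γ = ⟦ toAffine F γ ⟧

  linear-evalT : ∀ {X k} (g : X → Carrier) (v : Vec (Tm X) k) y → linear (Vec.map (evalT g) v) y ≡ evalT g (linearT v y)
  linear-evalT g []      []          = refl
  linear-evalT g (t ∷ v) (true ∷ y)  = cong (evalT g t ∙_) (linear-evalT g v y)
  linear-evalT g (t ∷ v) (false ∷ y) = cong (ε ∙_) (linear-evalT g v y)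

  value≡evalT : ∀ {K} (F : Cube K → Carrier) γ y → value F γ y ≡ evalT F (valueT γ y)
  value≡evalT F γ y = cong (evalT F (constT γ) ∙_) (linear-evalT F (coefsT (proj₂ γ)) y)

  theList : ∀ {K} → ℚ → (Cube K → Carrier) → List (Cand K)
  theList τ F = evalD F (listD τ)

  evalD-agreesWithin : ∀ {K} τ (F : Cube K → Carrier) γ → evalD F (agreesWithinD τ γ) ≡ does (δ F (value F γ) ≤? τ)
  evalD-agreesWithin {K} τ F γ = trans
    (evalD->>= F (filterD (λ y → differD (var y) (valueT γ y)) (allPoints K)) (λ l → ret (within l)))
    (cong within (trans
      (evalD-filter F (λ y → differD (var y) (valueT γ y)) (λ y → not (eqb (F y) (value F γ y)))
        (λ y → trans (evalD-differ F (var y) (valueT γ y)) (cong (λ v → not (eqb (F y) v)) (sym (value≡evalT F γ y))))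
        (allPoints K))
      (filterᵇ≡filter (λ y → ¬? (F y ≟ value F γ y)) (allPoints K))))
    where
    within : List (Cube K) → Bool
    within l = does (_/_ (ℤ.+ length l) (2 ℕ.^ K) {{ℕₚ.m^n≢0 2 K}} ≤? τ)

  evalD-distinct : ∀ {K} (F : Cube K → Carrier) γ γ′ → evalD F (distinctD γ γ′) ≡ not (same (value F γ) (value F γ′))
  evalD-distinct {K} F γ γ′
    rewrite evalD->>= F (filterD (λ y → differD (valueT γ y) (valueT γ′ y)) (allPoints K)) (λ l → ret (not (null l)))
          | evalD-filter F (λ y → differD (valueT γ y) (valueT γ′ y)) (λ y → not (eqb (value F γ y) (value F γ′ y)))
              (λ y → trans (evalD-differ F (valueT γ y) (valueT γ′ y))
                (cong₂ (λ v w → not (eqb v w)) (sym (value≡evalT F γ y)) (sym (value≡evalT F γ′ y))))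
              (allPoints K) = refl

  theList≡ : ∀ {K} τ (F : Cube K → Carrier) →
    theList τ F ≡ dedup (λ γ γ′ → not (same (value F γ) (value F γ′))) (filter (λ γ → δ F (value F γ) ≤? τ) (allCands K))
  theList≡ {K} τ F = trans (evalD->>= F (filterD (agreesWithinD τ) (allCands K)) (dedupD distinctD))
    (trans (cong (λ l → evalD F (dedupD distinctD l))
             (trans (evalD-filter F (agreesWithinD τ) (λ γ → does (δ F (value F γ) ≤? τ)) (evalD-agreesWithin τ F) (allCands K))
               (filterᵇ≡filter (λ γ → δ F (value F γ) ≤? τ) (allCands K))))
      (evalD-dedup F distinctD _ (evalD-distinct F) _))

  theList-sound : ∀ {K} τ (F : Cube K → Carrier) {γ} → γ ∈ theList τ F → δ F (value F γ) ≤ τ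
  theList-sound {K} τ F {γ} γ∈ =
    proj₂ (∈-filter⁻ (λ γ → δ F (value F γ) ≤? τ) {xs = allCands K}
      (dedup-⊆ (λ γ γ′ → not (same (value F γ) (value F γ′))) (filter (λ γ → δ F (value F γ) ≤? τ) (allCands K))
        (subst (γ ∈_) (theList≡ τ F) γ∈)))

  theList-distinct : ∀ {K} τ (F : Cube K → Carrier) → AllPairs Distinct (List.map (toAffine F) (theList τ F))
  theList-distinct {K} τ F = AllPairs.map⁺ (AllPairs.map
    (λ {γ} {γ′} ne e → Bool.not-¬ (cong not (≈⇒same (value F γ) (value F γ′) e)) ne)
    (subst (AllPairs (λ γ γ′ → not (same (value F γ) (value F γ′)) ≡ true)) (sym (theList≡ τ F))
      (dedup-pairs (λ γ γ′ → not (same (value F γ) (value F γ′))) (filter (λ γ → δ F (value F γ) ≤? τ) (allCands K)))))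

  not≡false : ∀ {b} → not b ≡ false → b ≡ true
  not≡false {true} _ = refl

  update-both : ∀ {n p} (Q : Cube n → Set p) b x → Q x → Q (flip b x) → ∀ β → Q (x [ b ]≔ β)
  update-both Q zero (true ∷ x)  q q′ true  = q
  update-both Q zero (true ∷ x)  q q′ false = q′
  update-both Q zero (false ∷ x) q q′ true  = q′
  update-both Q zero (false ∷ x) q q′ false = q
  update-both Q (suc b) (α ∷ x) q q′ β = update-both (Q ∘ (α ∷_)) b x q q′ β

  flip-update : ∀ {n} b (x : Cube n) → flip b (x [ b ]≔ false) ≡ x [ b ]≔ true
  flip-update zero    (α ∷ x) = refl
  flip-update (suc b) (α ∷ x) = cong (α ∷_) (flip-update b x)

  eval-difference : ∀ {n} (P : Affine n) b x → ⟦ P ⟧ (x [ b ]≔ true) ∙ ⟦ P ⟧ (x [ b ]≔ false) ⁻¹ ≈ coef P b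
  eval-difference P b x = begin
    ⟦ P ⟧ (x [ b ]≔ true) ∙ p ⁻¹                 ≈⟨ ∙-congʳ (≈-reflexive (cong ⟦ P ⟧ (flip-update b x))) ⟨
    ⟦ P ⟧ (flip b (x [ b ]≔ false)) ∙ p ⁻¹       ≈⟨ ∙-congʳ (eval-flip P b (x [ b ]≔ false)) ⟩
    (p ∙ step (lookup (x [ b ]≔ false) b) (coef P b)) ∙ p ⁻¹  ≈⟨ ∙-congʳ (≈-reflexive (cong (λ β → p ∙ step β (coef P b)) (Vec.lookup∘update b x false))) ⟩
    (p ∙ coef P b) ∙ p ⁻¹                        ≈⟨ ∙-congʳ (comm _ _) ⟩
    (coef P b ∙ p) ∙ p ⁻¹                        ≈⟨ assoc _ _ _ ⟩
    coef P b ∙ (p ∙ p ⁻¹)                        ≈⟨ ∙-congˡ (inverseʳ p) ⟩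
    coef P b ∙ ε                                 ≈⟨ identityʳ _ ⟩
    coef P b                                     ∎
    where
    open ≈R
    p = ⟦ P ⟧ (x [ b ]≔ false)

  module _ {K} (F : Cube K → Carrier) {η : ℚ} (0<η : 0ℚ < η) (P : Affine K) (listed : InList F η P) where

    -- `P` follows `F` on a positive fraction of the edges in direction `b`; `update-both` restates
    -- this without reference to which end was found.
    edge-point : ∀ b → ∃ λ y → ∀ β → F (y [ b ]≔ β) ≈ ⟦ P ⟧ (y [ b ]≔ β)
    edge-point b = y , update-both (λ z → F z ≈ ⟦ P ⟧ z) b y (eqb⇒≈ (proj₁ both)) (eqb⇒≈ (proj₂ both))
      where
      w = E-pos⇒∃ (ind ∘ edge F 0<η b P) (<-≤-trans (+-mono-< 0<η 0<η) (edge-density F 0<η b P listed))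
      y = proj₁ w
      both = ∧-true _ _ (ind-pos _ (proj₂ w))

    agree-point : ∃ λ y → F y ≈ ⟦ P ⟧ y
    agree-point = y , eqb⇒≈ (ind-pos _ (proj₂ w))
      where
      w = E-pos⇒∃ (agree F ⟦ P ⟧) (<-≤-trans (+-mono-< (positive⁻¹ ½) 0<η) (InList⇒agree η P listed))
      y = proj₁ w

    candidate : Cand K
    candidate = proj₁ agree-point , tabulate (proj₁ ∘ edge-point)

    candidate-coef : ∀ b → coef (toAffine F candidate) b ≈ coef P b
    candidate-coef b = begin
      lookup (Vec.map (evalT F) (coefsT ys)) b        ≈⟨ ≈-reflexive (trans (Vec.lookup-map b (evalT F) (coefsT ys)) (cong (evalT F) (Vec.lookup∘tabulate _ b))) ⟩
      F (lookup ys b [ b ]≔ true) ∙ F (lookup ys b [ b ]≔ false) ⁻¹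
        ≈⟨ ≈-reflexive (cong (λ y → F (y [ b ]≔ true) ∙ F (y [ b ]≔ false) ⁻¹) (Vec.lookup∘tabulate _ b)) ⟩
      F (y [ b ]≔ true) ∙ F (y [ b ]≔ false) ⁻¹       ≈⟨ ∙-cong (proj₂ (edge-point b) true) (⁻¹-cong (proj₂ (edge-point b) false)) ⟩
      ⟦ P ⟧ (y [ b ]≔ true) ∙ ⟦ P ⟧ (y [ b ]≔ false) ⁻¹  ≈⟨ eval-difference P b y ⟩
      coef P b ∎
      where
      open ≈R
      ys = proj₂ candidate
      y = proj₁ (edge-point b)

    candidate-correct : ∀ y → value F candidate y ≈ ⟦ P ⟧ y
    candidate-correct y = ∙-cong a₀≈ (lin y)
      where
      open ≈R
      y₀ = proj₁ agree-point
      lin = linear-cong (Affine.a (toAffine F candidate)) (Affine.a P) candidate-coef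
      l = linear (Affine.a P) y₀
      a₀≈ : evalT F (constT candidate) ≈ Affine.a₀ P
      a₀≈ = begin
        F y₀ ∙ evalT F (linearT (coefsT (proj₂ candidate)) y₀) ⁻¹
          ≈⟨ ∙-cong (proj₂ agree-point) (⁻¹-cong (≈-trans (≈-reflexive (sym (linear-evalT F (coefsT (proj₂ candidate)) y₀))) (lin y₀))) ⟩
        (Affine.a₀ P ∙ l) ∙ l ⁻¹   ≈⟨ assoc _ _ _ ⟩
        Affine.a₀ P ∙ (l ∙ l ⁻¹)   ≈⟨ ∙-congˡ (inverseʳ l) ⟩
        Affine.a₀ P ∙ ε            ≈⟨ identityʳ _ ⟩
        Affine.a₀ P                ∎

  δ-congʳ : ∀ {n} (f : Cube n → Carrier) {g h : Cube n → Carrier} → (∀ x → g x ≈ h x) → δ f g ≡ δ f h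
  δ-congʳ f {g} {h} e = trans (δ≡E f g) (trans
    (E-cong λ x → cong (ind ∘ not) (eqb-cong (λ p → ≈-trans p (e x)) (λ p → ≈-trans p (≈-sym (e x)))))
    (sym (δ≡E f h)))

  -- The candidate built from places of agreement with `P` computes `P`, hence passes the distance
  -- filter; deduplication keeps an equal function, though perhaps from other places.
  theList-complete : ∀ {K} (F : Cube K → Carrier) {η} → 0ℚ < η → ∀ P → InList F η P →
    ∃ λ γ → γ ∈ theList (½ - η) F × (∀ y → value F γ y ≈ ⟦ P ⟧ y)
  theList-complete {K} F {η} 0<η P listed = γ , subst (γ ∈_) (sym (theList≡ (½ - η) F)) γ∈ ,
      λ y → ≈-trans (γ≈ y) (candidate-correct F 0<η P listed y)
    where
    covered = dedup-covers {_~_ = λ γ γ′ → ∀ y → value F γ y ≈ value F γ′ y} (λ γ γ′ → not (same (value F γ) (value F γ′)))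
      (λ _ _ → ≈-refl) (λ p q y → ≈-trans (p y) (q y)) (λ γ γ′ e → same⇒≈ (value F γ) (value F γ′) (not≡false e))
      (filter (λ γ → δ F (value F γ) ≤? ½ - η) (allCands K))
      (∈-filter⁺ (λ γ → δ F (value F γ) ≤? ½ - η) (∈-allCands (candidate F 0<η P listed))
        (≤-trans (≤-reflexive (δ-congʳ F (candidate-correct F 0<η P listed))) listed))
    γ = proj₁ covered
    γ∈ = proj₁ (proj₂ covered)
    γ≈ = proj₂ (proj₂ covered)

  ∈⇒nth : ∀ {A : Set} {x : A} l → x ∈ l → ∃ λ j → j ℕ.< length l × nth j l ≡ just x
  ∈⇒nth (y ∷ l) (here refl) = 0 , s≤s z≤n , refl
  ∈⇒nth (y ∷ l) (there i)   = let j , j< , eq = ∈⇒nth l i in suc j , s≤s j< , eq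

  module _ {K} (τ : ℚ) (ι : Cube K → Cube K) (d : Cube K) (g : Cube (suc K) → Carrier) where

    private
      F₀ F₁ : Cube K → Carrier
      F₀ = g ∘ (true ∷_)
      F₁ = g ∘ (false ∷_)

    evalD-consistent : ∀ γ γ′ → evalD g (consistentD ι γ γ′) ≡ same (value F₀ γ ∘ ι) (value F₁ γ′ ∘ ι)
    evalD-consistent γ γ′
      rewrite evalD->>= g (filterD (λ y → differD (renT (true ∷_) (valueT γ (ι y))) (renT (false ∷_) (valueT γ′ (ι y)))) (allPoints K)) (λ l → ret (null l))
            | evalD-filter g (λ y → differD (renT (true ∷_) (valueT γ (ι y))) (renT (false ∷_) (valueT γ′ (ι y))))
                (λ y → not (eqb (value F₀ γ (ι y)) (value F₁ γ′ (ι y))))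
                (λ y → trans (evalD-differ g (renT (true ∷_) (valueT γ (ι y))) (renT (false ∷_) (valueT γ′ (ι y))))
                  (cong₂ (λ v w → not (eqb v w))
                    (trans (evalT-ren (true ∷_) g (valueT γ (ι y))) (sym (value≡evalT F₀ γ (ι y))))
                    (trans (evalT-ren (false ∷_) g (valueT γ′ (ι y))) (sym (value≡evalT F₁ γ′ (ι y))))))
                (allPoints K) = refl

    extensions : Cand K → List (Cand K)
    extensions γ = filterᵇ (λ γ′ → same (value F₀ γ ∘ ι) (value F₁ γ′ ∘ ι)) (theList τ F₁)

    evalD-corrector : ∀ {j γ} → nth j (theList τ F₀) ≡ just γ →
      evalD g (correctorD τ ι d j) ≡ firstValueT d (extensions γ)
    evalD-corrector {j} {γ} eq = begin
      evalD g (correctorD τ ι d j)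
        ≡⟨ evalD->>= g (renD (true ∷_) (listD τ)) (λ l → extendD τ ι d (nth j l)) ⟩
      evalD g (extendD τ ι d (nth j (evalD g (renD (true ∷_) (listD τ)))))
        ≡⟨ cong (λ l → evalD g (extendD τ ι d (nth j l))) (evalD-ren (true ∷_) g (listD τ)) ⟩
      evalD g (extendD τ ι d (nth j (theList τ F₀)))
        ≡⟨ cong (λ m → evalD g (extendD τ ι d m)) eq ⟩
      evalD g (renD (false ∷_) (listD τ) >>= λ l → filterD (consistentD ι γ) l >>= λ l′ → ret (firstValueT d l′))
        ≡⟨ evalD->>= g (renD (false ∷_) (listD τ)) (λ l → filterD (consistentD ι γ) l >>= λ l′ → ret (firstValueT d l′)) ⟩
      evalD g (filterD (consistentD ι γ) (evalD g (renD (false ∷_) (listD τ))) >>= λ l′ → ret (firstValueT d l′))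
        ≡⟨ cong (λ l → evalD g (filterD (consistentD ι γ) l >>= λ l′ → ret (firstValueT d l′))) (evalD-ren (false ∷_) g (listD τ)) ⟩
      evalD g (filterD (consistentD ι γ) (theList τ F₁) >>= λ l′ → ret (firstValueT d l′))
        ≡⟨ evalD->>= g (filterD (consistentD ι γ) (theList τ F₁)) (λ l′ → ret (firstValueT d l′)) ⟩
      firstValueT d (evalD g (filterD (consistentD ι γ) (theList τ F₁)))
        ≡⟨ cong (firstValueT d) (evalD-filter g (consistentD ι γ) _ (evalD-consistent γ) (theList τ F₁)) ⟩
      firstValueT d (extensions γ) ∎
      where open ≡-Reasoning

    -- `γ₁` survives the consistency filter, so there is a first survivor; every survivor equals
    -- `p₁` on the image of `ι`, and `determined` carries this over to `d`. So it does not matter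
    -- which survivor comes first.
    corrector-correct : ∀ {j γ γ₁} (p₀ p₁ : Cube K → Carrier) →
      nth j (theList τ F₀) ≡ just γ → (∀ y → value F₀ γ y ≈ p₀ y) →
      γ₁ ∈ theList τ F₁ → (∀ y → value F₁ γ₁ y ≈ p₁ y) →
      (∀ y → p₀ (ι y) ≈ p₁ (ι y)) →
      (∀ γ′ → γ′ ∈ theList τ F₁ → (∀ y → value F₁ γ′ (ι y) ≈ p₁ (ι y)) → value F₁ γ′ d ≈ p₁ d) →
      evalT g (evalD g (correctorD τ ι d j)) ≈ p₁ d
    corrector-correct {j} {γ} {γ₁} p₀ p₁ nth≡ γ≈ γ₁∈ γ₁≈ glue determined =
      ≈-trans (≈-reflexive (cong (evalT g) (evalD-corrector nth≡)))
        (first (extensions γ) (λ γ′ i → i)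
          (∈-filter⁺ ext? γ₁∈ (≡⇒T (≈⇒same (value F₀ γ ∘ ι) (value F₁ γ₁ ∘ ι)
            λ y → ≈-trans (γ≈ (ι y)) (≈-trans (glue y) (≈-sym (γ₁≈ (ι y))))))))
      where
      ext? = λ γ′ → T? (same (value F₀ γ ∘ ι) (value F₁ γ′ ∘ ι))
      first : ∀ l → (∀ γ′ → γ′ ∈ l → γ′ ∈ extensions γ) → γ₁ ∈ l → evalT g (firstValueT d l) ≈ p₁ d
      first (γ′ ∷ l) sub _ =
        let γ′∈ , t = ∈-filter⁻ ext? (sub γ′ (here refl))
            e = same⇒≈ (value F₀ γ ∘ ι) (value F₁ γ′ ∘ ι) (T⇒≡ t)
        in ≈-trans (≈-reflexive (trans (evalT-ren (false ∷_) g (valueT γ′ d)) (sym (value≡evalT F₁ γ′ d))))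
             (determined γ′ γ′∈ λ y → ≈-trans (≈-sym (e y)) (≈-trans (γ≈ (ι y)) (glue y)))

-- Subcubes generated by random points, and sampling by them.

module Geometry where
  open import Data.Bool using (Bool; true; false; _xor_)
  import Data.Bool.Properties as Bool
  open import Data.Empty using (⊥-elim)
  open import Data.Fin using (Fin; zero; suc; _↑ˡ_; _↑ʳ_)
  import Data.Fin.Properties as Fin
  open import Data.Nat as ℕ using (ℕ; zero; suc)
  import Data.Nat.Properties as ℕₚ
  open import Data.Rational hiding (_≟_)
  open import Data.Rational.Properties
  open import Data.Rational.Solver using (module +-*-Solver)
  open import Data.Vec as Vec using (Vec; []; _∷_; _++_; lookup; tabulate; take; drop; _[_]≔_)
  import Data.Vec.Properties as Vec
  open import Function using (_∘_)
  open import Relation.Binary.PropositionalEquality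

  open +-*-Solver using (solve; _:+_; _:*_; _:=_; con)
  open Expectation

  Vec-ext : ∀ {A : Set} {n} {u v : Vec A n} → (∀ i → lookup u i ≡ lookup v i) → u ≡ v
  Vec-ext {u = u} {v} e = trans (sym (Vec.tabulate∘lookup u)) (trans (Vec.tabulate-cong e) (Vec.tabulate∘lookup v))

  take-++ : ∀ {A : Set} {m n} (u : Vec A m) (v : Vec A n) → take m (u ++ v) ≡ u
  take-++ {m = m} u v = Vec.++-injectiveˡ (take m (u ++ v)) u (Vec.take++drop≡id m (u ++ v))

  drop-++ : ∀ {A : Set} {m n} (u : Vec A m) (v : Vec A n) → drop m (u ++ v) ≡ v
  drop-++ {m = m} u v = Vec.++-injectiveʳ (take m (u ++ v)) u (Vec.take++drop≡id m (u ++ v))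

  -- The power 2^q, by doubling without the trailing `+ 0` of `2 ^ q`, so that
  -- `Cube (blocks (suc q))` is literally a concatenation of two halves.
  blocks : ℕ → ℕ
  blocks zero    = 1
  blocks (suc q) = blocks q ℕ.+ blocks q

  blocks≡2^ : ∀ q → blocks q ≡ 2 ℕ.^ q
  blocks≡2^ zero    = refl
  blocks≡2^ (suc q) = trans (cong₂ ℕ._+_ (blocks≡2^ q) (blocks≡2^ q)) (cong (2 ℕ.^ q ℕ.+_) (sym (ℕₚ.+-identityʳ (2 ℕ.^ q))))

  -- Coordinates of `Cube (blocks q)` are numbered by bit vectors of length `q`; its points are thus
  -- truth tables of Boolean functions of `q` bits.
  block : ∀ {q} → Vec Bool q → Fin (blocks q)
  block []              = zero
  block {suc q} (true ∷ v)  = blocks q ↑ʳ block v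
  block {suc q} (false ∷ v) = block v ↑ˡ blocks q

  ↑ˡ≢↑ʳ : ∀ {m n} (i : Fin m) (j : Fin n) → i ↑ˡ n ≢ m ↑ʳ j
  ↑ˡ≢↑ʳ zero    j ()
  ↑ˡ≢↑ʳ (suc i) j e = ↑ˡ≢↑ʳ i j (Fin.suc-injective e)

  block-injective : ∀ {q} (u v : Vec Bool q) → block u ≡ block v → u ≡ v
  block-injective []          []          _ = refl
  block-injective {suc q} (true ∷ u)  (true ∷ v)  e = cong (true ∷_) (block-injective u v (Fin.↑ʳ-injective (blocks q) _ _ e))
  block-injective {suc q} (false ∷ u) (false ∷ v) e = cong (false ∷_) (block-injective u v (Fin.↑ˡ-injective (blocks q) _ _ e))
  block-injective (true ∷ u)  (false ∷ v) e = ⊥-elim (↑ˡ≢↑ʳ (block v) (block u) (sym e))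
  block-injective (false ∷ u) (true ∷ v)  e = ⊥-elim (↑ˡ≢↑ʳ (block u) (block v) e)

  const : ∀ q → Bool → Cube (blocks q)
  const zero    β = β ∷ []
  const (suc q) β = const q β ++ const q β

  -- The truth table of the r-th bit: the vertex that `embed a ts` sends to `a ⊕ lookup ts r`.
  dictator : ∀ {q} → Fin q → Cube (blocks q)
  dictator {suc q} zero    = const q false ++ const q true
  dictator {suc q} (suc r) = dictator r ++ dictator r

  -- The projection onto the functions y of the block index that ignore its r-th bit.
  forget : ∀ {q} → Fin q → Cube (blocks q) → Cube (blocks q)
  forget {suc q} zero    y = take (blocks q) y ++ take (blocks q) y
  forget {suc q} (suc r) y = forget r (take (blocks q) y) ++ forget r (drop (blocks q) y)

  lookup-true : ∀ {q} (u w : Cube (blocks q)) (v : Vec Bool q) → lookup (u ++ w) (block (true ∷ v)) ≡ lookup w (block v)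
  lookup-true u w v = Vec.lookup-++ʳ u w (block v)

  lookup-false : ∀ {q} (u w : Cube (blocks q)) (v : Vec Bool q) → lookup (u ++ w) (block (false ∷ v)) ≡ lookup u (block v)
  lookup-false u w v = Vec.lookup-++ˡ u w (block v)

  lookup-twice : ∀ {q} (u : Cube (blocks q)) β (v : Vec Bool q) → lookup (u ++ u) (block (β ∷ v)) ≡ lookup u (block v)
  lookup-twice u true  v = lookup-true u u v
  lookup-twice u false v = lookup-false u u v

  lookup-const : ∀ q β (v : Vec Bool q) → lookup (const q β) (block v) ≡ β
  lookup-const zero    β []      = refl
  lookup-const (suc q) β (α ∷ v) = trans (lookup-twice (const q β) α v) (lookup-const q β v)

  lookup-dictator : ∀ {q} (r : Fin q) v → lookup (dictator r) (block v) ≡ lookup v r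
  lookup-dictator {suc q} zero    (true ∷ v)  = trans (lookup-true (const q false) (const q true) v) (lookup-const q true v)
  lookup-dictator {suc q} zero    (false ∷ v) = trans (lookup-false (const q false) (const q true) v) (lookup-const q false v)
  lookup-dictator {suc q} (suc r) (β ∷ v)     = trans (lookup-twice (dictator r) β v) (lookup-dictator r v)

  lookup-forget : ∀ {q} (r : Fin q) y v β → lookup (forget r y) (block (v [ r ]≔ β)) ≡ lookup (forget r y) (block v)
  lookup-forget {suc q} zero y (α ∷ v) β =
    trans (lookup-twice (take (blocks q) y) β v) (sym (lookup-twice (take (blocks q) y) α v))
  lookup-forget {suc q} (suc r) y (true ∷ v) β = trans (lookup-true u w (v [ r ]≔ β)) (trans (lookup-forget r (drop (blocks q) y) v β) (sym (lookup-true u w v)))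
    where
    u = forget r (take (blocks q) y)
    w = forget r (drop (blocks q) y)
  lookup-forget {suc q} (suc r) y (false ∷ v) β = trans (lookup-false u w (v [ r ]≔ β)) (trans (lookup-forget r (take (blocks q) y) v β) (sym (lookup-false u w v)))
    where
    u = forget r (take (blocks q) y)
    w = forget r (drop (blocks q) y)

  forget-twice : ∀ {q} (r : Fin q) u → forget r u ≡ u → forget (suc r) (u ++ u) ≡ u ++ u
  forget-twice r u e = cong₂ _++_ (trans (cong (forget r) (take-++ u u)) e) (trans (cong (forget r) (drop-++ u u)) e)

  forget-const : ∀ {q} (r : Fin q) β → forget r (const q β) ≡ const q β
  forget-const {suc q} zero    β = cong₂ _++_ (take-++ (const q β) (const q β)) (take-++ (const q β) (const q β))
  forget-const {suc q} (suc r) β = forget-twice r (const q β) (forget-const r β)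

  forget-dictator : ∀ {q} {r r′ : Fin q} → r ≢ r′ → forget r′ (dictator r) ≡ dictator r
  forget-dictator {r = zero}  {zero}   r≢r′ = ⊥-elim (r≢r′ refl)
  forget-dictator {r = suc r} {zero}   r≢r′ = cong₂ _++_ (take-++ (dictator r) (dictator r)) (take-++ (dictator r) (dictator r))
  forget-dictator {suc q} {zero}  {suc r′} r≢r′ = cong₂ _++_
    (trans (cong (forget r′) (take-++ (const q false) (const q true))) (forget-const r′ false))
    (trans (cong (forget r′) (drop-++ (const q false) (const q true))) (forget-const r′ true))
  forget-dictator {r = suc r} {suc r′} r≢r′ = forget-twice r′ (dictator r) (forget-dictator (r≢r′ ∘ cong suc))

  column : ∀ {n q} → Vec (Cube n) q → Fin n → Vec Bool q
  column ts i = Vec.map (λ t → lookup t i) ts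

  select : ∀ {n q} → Vec (Cube n) q → Cube (blocks q) → Cube n
  select ts y = tabulate λ i → lookup y (block (column ts i))

  -- The subcube of Cube n generated by the points a and a ⊕ t (t in ts).
  embed : ∀ {n q} → Cube n → Vec (Cube n) q → Cube (blocks q) → Cube n
  embed a ts y = tabulate λ i → lookup a i xor lookup y (block (column ts i))

  lookup-⊕ : ∀ {n} (x y : Cube n) i → lookup (x ⊕ y) i ≡ lookup x i xor lookup y i
  lookup-⊕ x y i = Vec.lookup-zipWith _xor_ i x y

  embed-⊕-dictator : ∀ {n q} (a : Cube n) (ts : Vec (Cube n) q) y r →
    embed a ts (y ⊕ dictator r) ≡ (a ⊕ select ts y) ⊕ lookup ts r
  embed-⊕-dictator a ts y r = Vec-ext λ i → begin
    lookup (embed a ts (y ⊕ dictator r)) i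
      ≡⟨ Vec.lookup∘tabulate _ i ⟩
    lookup a i xor lookup (y ⊕ dictator r) (block (column ts i))
      ≡⟨ cong (lookup a i xor_) (lookup-⊕ y (dictator r) (block (column ts i))) ⟩
    lookup a i xor (lookup y (block (column ts i)) xor lookup (dictator r) (block (column ts i)))
      ≡⟨ cong₂ (λ s t → lookup a i xor (s xor t)) (sym (Vec.lookup∘tabulate _ i))
           (trans (lookup-dictator r (column ts i)) (Vec.lookup-map r (λ t → lookup t i) ts)) ⟩
    lookup a i xor (lookup (select ts y) i xor lookup (lookup ts r) i)
      ≡⟨ Bool.xor-assoc (lookup a i) _ _ ⟨
    (lookup a i xor lookup (select ts y) i) xor lookup (lookup ts r) i
      ≡⟨ cong (_xor lookup (lookup ts r) i) (lookup-⊕ a (select ts y) i) ⟨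
    lookup (a ⊕ select ts y) i xor lookup (lookup ts r) i
      ≡⟨ lookup-⊕ (a ⊕ select ts y) (lookup ts r) i ⟨
    lookup ((a ⊕ select ts y) ⊕ lookup ts r) i ∎
    where open ≡-Reasoning

  embed-dictator : ∀ {n q} (a : Cube n) (ts : Vec (Cube n) q) r → embed a ts (dictator r) ≡ a ⊕ lookup ts r
  embed-dictator a ts r = Vec-ext λ i → trans (Vec.lookup∘tabulate _ i) (trans
    (cong (lookup a i xor_) (trans (lookup-dictator r (column ts i)) (Vec.lookup-map r (λ t → lookup t i) ts)))
    (sym (lookup-⊕ a (lookup ts r) i)))

  -- A table that ignores bit `r` does not see the r-th point. Hence both subcubes assign the same
  -- points of the big cube to the common subcube.
  embed-forget : ∀ {n q} (a : Cube n) (ts : Vec (Cube n) q) r t y →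
    embed a (ts [ r ]≔ t) (forget r y) ≡ embed a ts (forget r y)
  embed-forget a ts r t y = Vec.tabulate-cong λ i → cong (lookup a i xor_) (trans
    (cong (λ v → lookup (forget r y) (block v)) (Vec.map-[]≔ (λ t → lookup t i) ts r))
    (lookup-forget r y (column ts i) (lookup t i)))

  chunks : ∀ {n} q → Cube (q ℕ.* n) → Vec (Cube n) q
  chunks         zero    w = []
  chunks {n = n} (suc q) w = take n w ∷ chunks q (drop n w)

  EV : ∀ {n} q → (Vec (Cube n) q → ℚ) → ℚ
  EV {n} q F = E (q ℕ.* n) (F ∘ chunks q)

  EV-suc : ∀ {n} q (F : Vec (Cube n) (suc q) → ℚ) → EV (suc q) F ≡ E n (λ t → EV q (F ∘ (t ∷_)))
  EV-suc {n} q F = trans (E-++ n (F ∘ chunks (suc q))) (E-cong λ t → E-cong λ w →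
    cong F (cong₂ _∷_ (take-++ t w) (cong (chunks q) (drop-++ t w))))

  -- Resampling one of several independent points preserves their joint law.
  EV-update : ∀ {n} q (r : Fin q) (F : Vec (Cube n) q → ℚ) → EV q (λ ts → E n (λ x → F (ts [ r ]≔ x))) ≡ EV q F
  EV-update {n} (suc q) zero F = begin
    EV (suc q) (λ ts → E n (λ x → F (ts [ zero ]≔ x)))  ≡⟨ EV-suc q (λ ts → E n (λ x → F (ts [ zero ]≔ x))) ⟩
    E n (λ t → EV q (λ ts → E n (λ x → F (x ∷ ts))))    ≡⟨ E-const n (EV q (λ ts → E n (λ x → F (x ∷ ts)))) ⟩
    EV q (λ ts → E n (λ x → F (x ∷ ts)))                ≡⟨ E-swap (q ℕ.* n) n (λ w x → F (x ∷ chunks q w)) ⟩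
    E n (λ x → EV q (λ ts → F (x ∷ ts)))                ≡⟨ EV-suc q F ⟨
    EV (suc q) F                                        ∎
    where open ≡-Reasoning
  EV-update {n} (suc q) (suc r) F = begin
    EV (suc q) (λ ts → E n (λ x → F (ts [ suc r ]≔ x)))        ≡⟨ EV-suc q (λ ts → E n (λ x → F (ts [ suc r ]≔ x))) ⟩
    E n (λ t → EV q (λ ts → E n (λ x → F (t ∷ ts [ r ]≔ x))))  ≡⟨ E-cong (λ t → EV-update q r (F ∘ (t ∷_))) ⟩
    E n (λ t → EV q (F ∘ (t ∷_)))                              ≡⟨ EV-suc q F ⟨
    EV (suc q) F                                               ∎
    where open ≡-Reasoning

  sumFin : ∀ q → (Fin q → ℚ) → ℚ
  sumFin zero    H = 0ℚ
  sumFin (suc q) H = H zero + sumFin q (H ∘ suc)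

  sumFin-cong : ∀ q {H H′ : Fin q → ℚ} → (∀ r → H r ≡ H′ r) → sumFin q H ≡ sumFin q H′
  sumFin-cong zero    e = refl
  sumFin-cong (suc q) e = cong₂ _+_ (e zero) (sumFin-cong q (e ∘ suc))

  sumFin-const : ∀ q h → sumFin q (λ _ → h) ≡ fromℕ q * h
  sumFin-const zero    h = sym (*-zeroˡ h)
  sumFin-const (suc q) h = trans (cong (h +_) (sumFin-const q h))
    (solve 2 (λ q h → h :+ q :* h := (con 1ℚ :+ q) :* h) refl (fromℕ q) h)

  E-sumFin : ∀ {n} q (H : Fin q → Cube n → ℚ) → E n (λ y → sumFin q (λ r → H r y)) ≡ sumFin q (λ r → E n (H r))
  E-sumFin {n} zero    H = E-const n 0ℚ
  E-sumFin {n} (suc q) H = trans (E-+ (H zero) (λ y → sumFin q (λ r → H (suc r) y))) (cong (E n (H zero) +_) (E-sumFin q (H ∘ suc)))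

  E-⊕ˡ : ∀ {n} (w : Cube n) (F : Cube n → ℚ) → E n (λ x → F (w ⊕ x)) ≡ E n F
  E-⊕ˡ w F = trans (E-cong λ x → cong F (Vec.zipWith-comm Bool.xor-comm w x)) (E-⊕ w F)

  module Sampling {n} (h : Cube n → ℚ) (Eh≡0 : E n h ≡ 0ℚ) (h²≤1 : ∀ x → h x ² ≤ 1ℚ) where

    -- The summands are independent with mean zero, so the cross terms vanish.
    variance : ∀ q (g : Cube n → ℚ) → E n g ≡ 0ℚ → (∀ x → g x ² ≤ 1ℚ) →
               EV q (λ ts → sumFin q (λ r → g (lookup ts r)) ²) ≤ fromℕ q
    variance zero    g Eg≡0 g²≤1 = ≤-refl
    variance (suc q) g Eg≡0 g²≤1 = begin
      EV (suc q) (λ ts → sumFin (suc q) (λ r → g (lookup ts r)) ²)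
        ≡⟨ EV-suc q (λ ts → sumFin (suc q) (λ r → g (lookup ts r)) ²) ⟩
      E n (λ t → EV q (λ ts → (g t + s ts) ²))
        ≡⟨ E-cong expand ⟩
      E n (λ t → g t ² + ((m + m) * g t + v))
        ≡⟨ E-+ (λ t → g t ²) (λ t → (m + m) * g t + v) ⟩
      E n (λ t → g t ²) + E n (λ t → (m + m) * g t + v)
        ≡⟨ cong (E n (λ t → g t ²) +_) (trans (E-+ (λ t → (m + m) * g t) (λ _ → v)) (cong₂ _+_ mean (E-const n v))) ⟩
      E n (λ t → g t ²) + (0ℚ + v)
        ≡⟨ cong (E n (λ t → g t ²) +_) (+-identityˡ v) ⟩
      E n (λ t → g t ²) + v
        ≤⟨ +-mono-≤ (E-≤const g²≤1) (variance q g Eg≡0 g²≤1) ⟩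
      1ℚ + fromℕ q ∎
      where
      open ≤-Reasoning
      s : Vec (Cube n) q → ℚ
      s ts = sumFin q (λ r → g (lookup ts r))
      m v : ℚ
      m = EV q s
      v = EV q (λ ts → s ts ²)
      mean : E n (λ t → (m + m) * g t) ≡ 0ℚ
      mean = trans (E-*ˡ (m + m) g) (trans (cong ((m + m) *_) Eg≡0) (*-zeroʳ (m + m)))
      expand : ∀ t → EV q (λ ts → (g t + s ts) ²) ≡ g t ² + ((m + m) * g t + v)
      expand t = ≡.begin
        EV q (λ ts → (g t + s ts) ²)
          ≡.≡⟨ E-cong (λ w → solve 2 (λ g s → (g :+ s) :* (g :+ s) := (g :* g :+ (g :+ g) :* s) :+ s :* s) refl (g t) (s (chunks q w))) ⟩
        EV q (λ ts → (g t ² + (g t + g t) * s ts) + s ts ²)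
          ≡.≡⟨ E-+ (λ w → g t ² + (g t + g t) * s (chunks q w)) (λ w → s (chunks q w) ²) ⟩
        EV q (λ ts → g t ² + (g t + g t) * s ts) + v
          ≡.≡⟨ cong (_+ v) (trans (E-+ (λ _ → g t ²) (λ w → (g t + g t) * s (chunks q w)))
                 (cong₂ _+_ (E-const (q ℕ.* n) (g t ²)) (E-*ˡ (g t + g t) (s ∘ chunks q)))) ⟩
        (g t ² + (g t + g t) * m) + v
          ≡.≡⟨ solve 3 (λ g m v → (g :* g :+ (g :+ g) :* m) :+ v := g :* g :+ ((m :+ m) :* g :+ v)) refl (g t) m v ⟩
        g t ² + ((m + m) * g t + v) ≡.∎
        where module ≡ = ≡-Reasoning

    local : ∀ {q} → Cube n → Vec (Cube n) q → ℚ
    local {q} a ts = E (blocks q) (λ y → h (embed a ts y))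

    module _ (q : ℕ) where

      private
        B = blocks q

        s : Cube n → Vec (Cube n) q → ℚ
        s a ts = sumFin q (λ r → h (a ⊕ lookup ts r))

      -- Translation by each `dictator r` preserves the mean over the subcube. Averaging these `q`
      -- translates turns the mean into one over `y` of sums of `h` at `q` points, which differ from
      -- a common centre by the entries of `ts`.
      q*local : ∀ a (ts : Vec (Cube n) q) → fromℕ q * local a ts ≡ E B (λ y → s (a ⊕ select ts y) ts)
      q*local a ts = begin
        fromℕ q * local a ts
          ≡⟨ sumFin-const q (local a ts) ⟨
        sumFin q (λ r → local a ts)
          ≡⟨ sumFin-cong q (λ r → E-⊕ (dictator r) (λ y → h (embed a ts y))) ⟨
        sumFin q (λ r → E B (λ y → h (embed a ts (y ⊕ dictator r))))
          ≡⟨ E-sumFin q (λ r y → h (embed a ts (y ⊕ dictator r))) ⟨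
        E B (λ y → sumFin q (λ r → h (embed a ts (y ⊕ dictator r))))
          ≡⟨ E-cong (λ y → sumFin-cong q λ r → cong h (embed-⊕-dictator a ts y r)) ⟩
        E B (λ y → s (a ⊕ select ts y) ts) ∎
        where open ≡-Reasoning

      -- For fixed y and ts, a ⊕ select ts y is uniform when a is, so the points
      -- embed a ts (y ⊕ dictator r) are independent.
      second-moment : E n (λ a → EV q (λ ts → (fromℕ q * local a ts) ²)) ≤ fromℕ q
      second-moment = begin
        E n (λ a → EV q (λ ts → (fromℕ q * local a ts) ²))
          ≡⟨ E-cong (λ a → E-cong λ w → cong _² (q*local a (chunks q w))) ⟩
        E n (λ a → EV q (λ ts → E B (λ y → s (a ⊕ select ts y) ts) ²))
          ≤⟨ E-mono (λ a → E-mono λ w → E-jensen (λ y → s (a ⊕ select (chunks q w) y) (chunks q w))) ⟩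
        E n (λ a → EV q (λ ts → E B (λ y → s (a ⊕ select ts y) ts ²)))
          ≡⟨ E-swap n (q ℕ.* n) (λ a w → E B (λ y → s (a ⊕ select (chunks q w) y) (chunks q w) ²)) ⟩
        EV q (λ ts → E n (λ a → E B (λ y → s (a ⊕ select ts y) ts ²)))
          ≡⟨ E-cong (λ w → E-swap n B (λ a y → s (a ⊕ select (chunks q w) y) (chunks q w) ²)) ⟩
        EV q (λ ts → E B (λ y → E n (λ a → s (a ⊕ select ts y) ts ²)))
          ≡⟨ E-cong (λ w → E-cong λ y → E-⊕ (select (chunks q w) y) (λ a → s a (chunks q w) ²)) ⟩
        EV q (λ ts → E B (λ y → E n (λ a → s a ts ²)))
          ≡⟨ E-cong (λ w → E-const B (E n (λ a → s a (chunks q w) ²))) ⟩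
        EV q (λ ts → E n (λ a → s a ts ²))
          ≡⟨ E-swap (q ℕ.* n) n (λ w a → s a (chunks q w) ²) ⟩
        E n (λ a → EV q (λ ts → s a ts ²))
          ≤⟨ E-≤const (λ a → variance q (λ t → h (a ⊕ t)) (trans (E-⊕ˡ a h) Eh≡0) (λ t → h²≤1 (a ⊕ t))) ⟩
        fromℕ q ∎
        where open ≤-Reasoning

-- The randomized algorithm.

module Algorithm (ε : ℚ) (p n : ℕ) where
  open import Data.Bool using (Bool; true; false)
  open import Data.Fin using (Fin)
  open import Data.List using (map; upTo)
  open import Data.Nat as ℕ using (suc)
  open import Data.Rational using (½; _*_; _-_)
  open import Data.Vec using (Vec; _∷_; take; drop; _[_]≔_)

  open Expectation using (_⊕_)
  open Geometry
  open Programs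

  -- `q` is a power of two so that `p` fair coins select a uniform position. The other coins give
  -- the base point and the `q` points.
  q coins : ℕ
  q     = blocks p
  coins = n ℕ.+ (q ℕ.* n ℕ.+ p)

  base : Cube coins → Cube n
  base ω = take n ω

  tuple : Cube coins → Vec (Cube n) q
  tuple ω = chunks q (take (q ℕ.* n) (drop n ω))

  index : Cube coins → Cube p
  index ω = drop (q ℕ.* n) (drop n ω)

  position : Cube coins → Fin q
  position ω = block (index ω)

  points : Cube coins → Cube n → Cube (suc (blocks q)) → Cube n
  points ω x (true ∷ y)  = embed (base ω) (tuple ω) y
  points ω x (false ∷ y) = embed (base ω) (tuple ω [ position ω ]≔ (base ω ⊕ x)) y

  ψ : Cube coins → ℕ → Psi n 0
  ψ ω j x = program (suc (blocks q)) (points ω x)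
    (correctorD (½ - ε * ½) (forget (position ω)) (dictator (position ω)) j)

  -- All queries are left to the ψ's, which recompute the local list on the x-independent subcube.
  A : ℕ → RandAlg n coins
  A L ω = out (map (ψ ω) (upTo L))

-- Failure probability of the correction.

module Correction {c ℓ} (G : AbelianGroup c ℓ) (_≟_ : Decidable (AbelianGroup._≈_ G)) where
  open import Data.Bool using (Bool; true; false; not; _∧_; _xor_; if_then_else_)
  import Data.Bool.Properties as Bool
  open import Data.Fin using (Fin; zero; suc)
  import Data.Integer as ℤ
  open import Data.List as List using (List; []; _∷_; length; filter)
  open import Data.Bool.ListAction using (any)
  import Data.List.Properties as List
  open import Data.List.Membership.Propositional using (_∈_; find)
  open import Data.List.Membership.Propositional.Properties using (∈-map⁻)
  open import Data.List.Relation.Unary.All as All using (All; []; _∷_)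
  import Data.List.Relation.Unary.All.Properties as All
  open import Data.List.Relation.Unary.AllPairs using (AllPairs; []; _∷_)
  open import Data.List.Relation.Unary.Any using (Any)
  import Data.List.Relation.Unary.Any.Properties as Any
  open import Data.List.Relation.Unary.Unique.Propositional using (Unique)
  import Data.List.Relation.Unary.Unique.Propositional.Properties as Unique
  open import Data.Nat as ℕ using (ℕ; zero; suc)
  import Data.Nat.Properties as ℕₚ
  open import Data.Product using (∃; _×_; _,_; proj₁; proj₂)
  open import Data.Rational hiding (_≟_; _≥_; _>_)
  open import Data.Rational.Properties hiding (_≟_)
  open import Data.Rational.Solver using (module +-*-Solver)
  open import Data.Vec using (Vec; []; _∷_; lookup; tabulate; take; drop; _[_]≔_; replicate; zipWith)
  open import Function using (_∘_)
  import Level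
  open import Relation.Binary.PropositionalEquality
  open import Relation.Nullary using (Dec; yes; no; does; ¬_)

  open +-*-Solver using (solve; _:+_; _:*_; _:-_; :-_; _:=_; con)
  open AbelianGroup G using (Carrier; _≈_; _∙_; ε; _⁻¹; ∙-cong; ∙-congˡ; assoc; identityˡ; identityʳ; inverseʳ)
    renaming (refl to ≈-refl; sym to ≈-sym; trans to ≈-trans; reflexive to ≈-reflexive)
  open import Algebra.Properties.CommutativeSemigroup (AbelianGroup.commutativeSemigroup G) using (interchange)
  open WithGroup G _≟_
  open Expectation
  open Constants
  open ListBound G _≟_
  open UniformListBound G _≟_
  open Programs using (Cand)
  open ProgramSemantics G _≟_
  open LocalLists G _≟_
  open Geometry

  addA : ∀ {K} → Affine K → Affine K → Affine K
  addA (affine a v) (affine b w) = affine (a ∙ b) (zipWith _∙_ v w)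

  linear-zipWith : ∀ {K} (v w : Vec Carrier K) y → linear (zipWith _∙_ v w) y ≈ linear v y ∙ linear w y
  linear-zipWith []      []      []          = ≈-sym (identityˡ ε)
  linear-zipWith (g ∷ v) (h ∷ w) (true ∷ y)  = ≈-trans (∙-congˡ (linear-zipWith v w y)) (interchange _ _ _ _)
  linear-zipWith (g ∷ v) (h ∷ w) (false ∷ y) = ≈-trans (∙-cong (≈-sym (identityˡ ε)) (linear-zipWith v w y)) (interchange _ _ _ _)

  addA-eval : ∀ {K} (P Q : Affine K) y → ⟦ addA P Q ⟧ y ≈ ⟦ P ⟧ y ∙ ⟦ Q ⟧ y
  addA-eval (affine a v) (affine b w) y = ≈-trans (∙-congˡ (linear-zipWith v w y)) (interchange _ _ _ _)

  linear-zero : ∀ {K} (y : Cube K) → linear (replicate K ε) y ≈ ε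
  linear-zero []          = ≈-refl
  linear-zero (true ∷ y)  = ≈-trans (identityˡ _) (linear-zero y)
  linear-zero (false ∷ y) = ≈-trans (identityˡ _) (linear-zero y)

  linear-single : ∀ {K} (κ : Fin K) g y → linear (replicate K ε [ κ ]≔ g) y ≈ (if lookup y κ then g else ε)
  linear-single zero    g (β ∷ y)     = ≈-trans (∙-congˡ (linear-zero y)) (identityʳ _)
  linear-single (suc κ) g (true ∷ y)  = ≈-trans (identityˡ _) (linear-single κ g y)
  linear-single (suc κ) g (false ∷ y) = ≈-trans (identityˡ _) (linear-single κ g y)

  -- A possibly negated variable with weight `g`; negation is the affine function g - g·y.
  literal : ∀ {K} → Bool → Fin K → Carrier → Affine K
  literal {K} false κ g = affine ε (replicate K ε [ κ ]≔ g)
  literal {K} true  κ g = affine g (replicate K ε [ κ ]≔ g ⁻¹)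

  literal-eval : ∀ {K} α (κ : Fin K) g y → ⟦ literal α κ g ⟧ y ≈ (if α xor lookup y κ then g else ε)
  literal-eval false κ g y = ≈-trans (identityˡ _) (linear-single κ g y)
  literal-eval true  κ g y = ≈-trans (∙-congˡ (linear-single κ (g ⁻¹) y)) (cancel (lookup y κ))
    where
    cancel : ∀ β → g ∙ (if β then g ⁻¹ else ε) ≈ (if not β then g else ε)
    cancel true  = inverseʳ g
    cancel false = identityʳ g

  pullback-linear : ∀ {n K} (α : Fin n → Bool) (κ : Fin n → Fin K) (v : Vec Carrier n) →
    ∃ λ Q → ∀ y → ⟦ Q ⟧ y ≈ linear v (tabulate (λ i → α i xor lookup y (κ i)))
  pullback-linear {K = K} α κ []      = affine ε (replicate K ε) , λ y → ≈-trans (identityˡ _) (linear-zero y)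
  pullback-linear α κ (g ∷ v) =
    let Q , Q≈ = pullback-linear (α ∘ suc) (κ ∘ suc) v
        l = literal (α zero) (κ zero) g
    in addA l Q , λ y → ≈-trans (addA-eval l Q y) (∙-cong (literal-eval (α zero) (κ zero) g y) (Q≈ y))

  -- Every coordinate of `embed a ts y` is a possibly negated coordinate of `y`. So restriction to
  -- the subcube preserves affinity, and `P` can be found on the local list.
  pullback : ∀ {n q} (a : Cube n) (ts : Vec (Cube n) q) (P : Affine n) → ∃ λ Q → ∀ y → ⟦ Q ⟧ y ≈ ⟦ P ⟧ (embed a ts y)
  pullback a ts (affine a₀ v) =
    let affine b₀ w , Q≈ = pullback-linear (lookup a) (block ∘ column ts) v
    in affine (a₀ ∙ b₀) w , λ y → ≈-trans (assoc a₀ b₀ (linear w y)) (∙-congˡ (Q≈ y))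

  allPoints-unique : ∀ n → Unique (allPoints n)
  allPoints-unique zero    = [] ∷ []
  allPoints-unique (suc n) = Unique.++⁺ (Unique.map⁺ (λ { refl → refl }) (allPoints-unique n)) (Unique.map⁺ (λ { refl → refl }) (allPoints-unique n))
    λ (i , j) → heads (∈-map⁻ (true ∷_) i) (∈-map⁻ (false ∷_) j)
    where
    heads : ∀ {x : Cube (suc n)} → (∃ λ y → y ∈ allPoints n × x ≡ true ∷ y) → (∃ λ y → y ∈ allPoints n × x ≡ false ∷ y) → _
    heads (_ , _ , refl) (_ , _ , ())

  ⊕-cancel : ∀ {n} (a x : Cube n) → a ⊕ (a ⊕ x) ≡ x
  ⊕-cancel []          []      = refl
  ⊕-cancel (true ∷ a)  (β ∷ x) = cong₂ _∷_ (Bool.not-involutive β) (⊕-cancel a x)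
  ⊕-cancel (false ∷ a) (β ∷ x) = cong (β ∷_) (⊕-cancel a x)

  module Decoder {ε′ : ℚ} (0<ε : 0ℚ < ε′) (e : ℕ) (1≤eη : 1ℚ ≤ fromℕ e * (ε′ * ½)) (p : ℕ) {n} (f : Cube n → Carrier) where

    η τ : ℚ
    η = ε′ * ½
    τ = ½ - η

    open Algorithm ε′ p n

    N : ℕ
    N = listBound e

    0<η : 0ℚ < η
    0<η = positive⁻¹ η {{pos*pos⇒pos ε′ {{positive 0<ε}} ½}}

    Tuple : Set
    Tuple = Vec (Cube n) q

    q-positive : Positive (fromℕ q)
    q-positive = subst (Positive ∘ fromℕ) (sym (blocks≡2^ p)) (fromℕ-positive (2 ℕ.^ p) {{ℕₚ.m^n≢0 2 p}})

    localδ : Affine n → Cube n → Tuple → ℚ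
    localδ P a ts = δ (f ∘ embed a ts) (⟦ P ⟧ ∘ embed a ts)

    miss : Affine n → Cube n → Tuple → Bool
    miss P a ts = not (does (localδ P a ts ≤? τ))

    rival : Affine n → Fin q → Cube n → Tuple → Cand (blocks q) → Bool
    rival P r a ts γ = same (value F γ ∘ forget r) (⟦ P ⟧ ∘ embed a ts ∘ forget r)
                     ∧ not (eqb (value F γ (dictator r)) (⟦ P ⟧ (embed a ts (dictator r))))
      where F = f ∘ embed a ts

    confused : Affine n → Fin q → Cube n → Tuple → Bool
    confused P r a ts = any (rival P r a ts) (theList τ (f ∘ embed a ts))

    module _ (P : Affine n) (listed : InList f ε′ P) where

      private
        μ : ℚ
        μ = E n (differ f ⟦ P ⟧)

        μ≤ : μ ≤ ½ - ε′
        μ≤ = subst (_≤ ½ - ε′) (δ≡E f ⟦ P ⟧) listed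

        0≤μ : 0ℚ ≤ μ
        0≤μ = E-nonneg (λ x → ind-nonneg (not (eqb (f x) (⟦ P ⟧ x))))

        μ≤1 : μ ≤ 1ℚ
        μ≤1 = E-≤const (λ x → ind≤1 (not (eqb (f x) (⟦ P ⟧ x))))

        h : Cube n → ℚ
        h x = differ f ⟦ P ⟧ x - μ

        Eh≡0 : E n h ≡ 0ℚ
        Eh≡0 = trans (E-shift μ (differ f ⟦ P ⟧)) (+-inverseʳ μ)

        ind-μ² : ∀ β → (ind β - μ) ² ≤ 1ℚ
        ind-μ² true  = ≤-from-gap (μ * (1ℚ - μ) + μ) (0≤+ (0≤* 0≤μ (gap μ≤1)) 0≤μ)
          (solve 1 (λ m → con 1ℚ := (con 1ℚ :- m) :* (con 1ℚ :- m) :+ (m :* (con 1ℚ :- m) :+ m)) refl μ)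
        ind-μ² false = ≤-from-gap ((1ℚ - μ) * (1ℚ + μ)) (0≤* (gap μ≤1) (0≤+ 0≤1 0≤μ))
          (solve 1 (λ m → con 1ℚ := (con 0ℚ :- m) :* (con 0ℚ :- m) :+ (con 1ℚ :- m) :* (con 1ℚ :+ m)) refl μ)

        open Sampling h Eh≡0 (λ x → ind-μ² (not (eqb (f x) (⟦ P ⟧ x))))

        local≡ : ∀ a (ts : Tuple) → local a ts ≡ localδ P a ts - μ
        local≡ a ts = trans (E-shift μ (λ y → differ f ⟦ P ⟧ (embed a ts y)))
          (cong (_- μ) (sym (δ≡E (f ∘ embed a ts) (⟦ P ⟧ ∘ embed a ts))))

        -- The global distance is at most ½ - ε, so exceeding the local threshold ½ - ε/2 takes a
        -- deviation of at least ε/2 = η.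
        deviation : ∀ a (ts : Tuple) (d : Dec (localδ P a ts ≤ τ)) → η ² * ind (not (does d)) ≤ local a ts ²
        deviation a ts (yes _) = subst (_≤ local a ts ²) (sym (*-zeroʳ (η ²))) (0≤² (local a ts))
        deviation a ts (no far) = subst (_≤ local a ts ²) (sym (*-identityʳ (η ²)))
          (*-mono (<⇒≤ 0<η) (≤-trans (<⇒≤ 0<η) η≤local) η≤local η≤local)
          where
          η≤local : η ≤ local a ts
          η≤local = subst (η ≤_) (sym (local≡ a ts)) (≤-from-gap ((localδ P a ts - τ) + (½ - ε′ - μ))
            (0≤+ (gap (<⇒≤ (≰⇒> far))) (gap μ≤))
            (solve 3 (λ l e m → l :- m := e :* con ½ :+ ((l :- (con ½ :- e :* con ½)) :+ (con ½ :- e :- m))) refl (localδ P a ts) ε′ μ))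

        missProb : ℚ
        missProb = E n (λ a → EV q (λ ts → ind (miss P a ts)))

        0≤missProb : 0ℚ ≤ missProb
        0≤missProb = E-nonneg (λ a → E-nonneg (λ w → ind-nonneg (miss P a (chunks q w))))

        chebyshev : fromℕ q * (η ² * missProb) ≤ 1ℚ
        chebyshev = *-cancelˡ-≤-pos {fromℕ q * (η ² * missProb)} {1ℚ} (fromℕ q) {{q-positive}} (begin
          fromℕ q * (fromℕ q * (η ² * missProb))
            ≡⟨ *-assoc (fromℕ q) (fromℕ q) (η ² * missProb) ⟨
          fromℕ q ² * (η ² * missProb)
            ≡⟨ cong (fromℕ q ² *_) (trans (sym (E-*ˡ (η ²) (λ a → EV q (λ ts → ind (miss P a ts)))))
                 (E-cong λ a → sym (E-*ˡ (η ²) (λ w → ind (miss P a (chunks q w)))))) ⟩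
          fromℕ q ² * E n (λ a → EV q (λ ts → η ² * ind (miss P a ts)))
            ≤⟨ *-monoˡ (0≤² (fromℕ q)) (E-mono λ a → E-mono λ w → deviation a (chunks q w) (localδ P a (chunks q w) ≤? τ)) ⟩
          fromℕ q ² * E n (λ a → EV q (λ ts → local a ts ²))
            ≡⟨ trans (sym (E-*ˡ (fromℕ q ²) (λ a → EV q (λ ts → local a ts ²))))
                 (E-cong λ a → trans (sym (E-*ˡ (fromℕ q ²) (λ w → local a (chunks q w) ²)))
                   (E-cong λ w → solve 2 (λ q l → (q :* q) :* (l :* l) := (q :* l) :* (q :* l)) refl (fromℕ q) (local a (chunks q w)))) ⟩
          E n (λ a → EV q (λ ts → (fromℕ q * local a ts) ²))
            ≤⟨ second-moment q ⟩
          fromℕ q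
            ≡⟨ *-identityʳ (fromℕ q) ⟨
          fromℕ q * 1ℚ ∎)
          where open ≤-Reasoning

      -- `chebyshev` with 1/η² replaced by its upper bound e², so that all further bounds are
      -- natural numbers.
      miss-rare : fromℕ q * E n (λ a → EV q (λ ts → ind (miss P a ts))) ≤ fromℕ e ²
      miss-rare = begin
        fromℕ q * missProb
          ≤⟨ ≤-from-gap (((fromℕ e * η) ² - 1ℚ) * (fromℕ q * missProb))
               (0≤* (gap (*-mono 0≤1 0≤eη 1≤eη 1≤eη)) (0≤* (0≤fromℕ q) 0≤missProb))
               (solve 3 (λ e h x → (e :* e) :* (h :* h :* x) := x :+ ((e :* h) :* (e :* h) :- con 1ℚ) :* x) refl (fromℕ e) η (fromℕ q * missProb)) ⟩
        fromℕ e ² * (η ² * (fromℕ q * missProb))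
          ≡⟨ cong (fromℕ e ² *_) (solve 3 (λ h q m → h :* (q :* m) := q :* (h :* m)) refl (η ²) (fromℕ q) missProb) ⟩
        fromℕ e ² * (fromℕ q * (η ² * missProb))
          ≤⟨ *-monoˡ (0≤² (fromℕ e)) chebyshev ⟩
        fromℕ e ² * 1ℚ
          ≡⟨ *-identityʳ (fromℕ e ²) ⟩
        fromℕ e ² ∎
        where
        open ≤-Reasoning
        0≤eη : 0ℚ ≤ fromℕ e * η
        0≤eη = ≤-trans 0≤1 1≤eη

    -- Rivals for different positions are different functions: the rival for r differs from P
    -- at dictator r, a point which is unaffected by forgetting any other position.
    module _ (P : Affine n) (a : Cube n) (ts : Tuple) where

      private
        F : Cube (blocks q) → Carrier
        F = f ∘ embed a ts

      record Rival (r : Fin q) : Set (c Level.⊔ ℓ) where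
        field
          γ       : Cand (blocks q)
          listed  : InList F η (toAffine F γ)
          agrees  : ∀ y → value F γ (forget r y) ≈ ⟦ P ⟧ (embed a ts (forget r y))
          differs : ¬ value F γ (dictator r) ≈ ⟦ P ⟧ (embed a ts (dictator r))

      open Rival

      confused⇒rival : ∀ r → confused P r a ts ≡ true → Rival r
      confused⇒rival r eq = record
        { γ = γ₀
        ; listed = theList-sound τ F γ₀∈
        ; agrees = same⇒≈ (value F γ₀ ∘ forget r) (⟦ P ⟧ ∘ embed a ts ∘ forget r) (proj₁ both)
        ; differs = λ e → Bool.not-¬ (cong not (eqb-true e)) (proj₂ both) }
        where
        found = find (Any.any⁻ (rival P r a ts) (theList τ F) (≡⇒T eq))
        γ₀ = proj₁ found
        γ₀∈ = proj₁ (proj₂ found)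
        both = ∧-true _ _ (T⇒≡ (proj₂ (proj₂ found)))

      rivals-distinct : ∀ {r r′} → r ≢ r′ → (ρ : Rival r) (ρ′ : Rival r′) → Distinct (toAffine F (γ ρ)) (toAffine F (γ ρ′))
      rivals-distinct {r} {r′} r≢r′ ρ ρ′ e = differs ρ (≈-trans (e (dictator r))
        (subst (λ y → value F (γ ρ′) y ≈ ⟦ P ⟧ (embed a ts y)) (forget-dictator r≢r′) (agrees ρ′ (dictator r))))

      rivals : ∀ {us : List (Cube p)} → All (Rival ∘ block) us → List (Affine (blocks q))
      rivals []       = []
      rivals (ρ ∷ ρs) = toAffine F (γ ρ) ∷ rivals ρs

      rivals-length : ∀ {us : List (Cube p)} (ρs : All (Rival ∘ block) us) → length (rivals ρs) ≡ length us
      rivals-length []       = refl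
      rivals-length (ρ ∷ ρs) = cong suc (rivals-length ρs)

      rivals-listed : ∀ {us : List (Cube p)} (ρs : All (Rival ∘ block) us) → All (InList F η) (rivals ρs)
      rivals-listed []       = []
      rivals-listed (ρ ∷ ρs) = listed ρ ∷ rivals-listed ρs

      rivals-distinct-head : ∀ {u} {us : List (Cube p)} (ρ : Rival (block u)) → All (u ≢_) us → (ρs : All (Rival ∘ block) us) →
                             All (Distinct (toAffine F (γ ρ))) (rivals ρs)
      rivals-distinct-head ρ []        []         = []
      rivals-distinct-head ρ (u≢ ∷ us) (ρ′ ∷ ρs) = rivals-distinct (u≢ ∘ block-injective _ _) ρ ρ′ ∷ rivals-distinct-head ρ us ρs

      rivals-allDistinct : ∀ {us : List (Cube p)} → Unique us → (ρs : All (Rival ∘ block) us) → AllPairs Distinct (rivals ρs)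
      rivals-allDistinct []        []       = []
      rivals-allDistinct (u ∷ us) (ρ ∷ ρs) = rivals-distinct-head ρ u ρs ∷ rivals-allDistinct us ρs

      confused-rare : fromℕ q * E p (λ u → ind (confused P (block u) a ts)) ≤ fromℕ N
      confused-rare = subst (_≤ fromℕ N) count≡
        (fromℕ-mono (subst (ℕ._≤ N) (rivals-length ρs)
          (list-bound F 0<η e 1≤eη (rivals ρs) (rivals-allDistinct (Unique.filter⁺ confused? (allPoints-unique p)) ρs) (rivals-listed ρs))))
        where
        confused? : (u : Cube p) → Dec (confused P (block u) a ts ≡ true)
        confused? u = confused P (block u) a ts Bool.≟ true
        ρs : All (Rival ∘ block) (filter confused? (allPoints p))
        ρs = All.map (λ {u} → confused⇒rival (block u)) (All.all-filter confused? (allPoints p))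
        does-≟true : ∀ β → does (β Bool.≟ true) ≡ β
        does-≟true true  = refl
        does-≟true false = refl
        count≡ : fromℕ (count confused?) ≡ fromℕ q * E p (λ u → ind (confused P (block u) a ts))
        count≡ = trans (count≡E confused?) (cong₂ (λ k → fromℕ k *_) (sym (blocks≡2^ p))
          (E-cong λ (u : Cube p) → cong ind (does-≟true (confused P (block u) a ts))))

    hazard : Affine n → Fin q → Cube n → Tuple → ℚ
    hazard P r a ts = ind (miss P a ts) + ind (confused P r a ts)

    error : Affine n → Cube n → Tuple → Fin q → ℚ
    error P a ts r = E n (λ x → hazard P r a (ts [ r ]≔ (a ⊕ x)))

    0≤hazard : ∀ P r a ts → 0ℚ ≤ hazard P r a ts
    0≤hazard P r a ts = 0≤+ (ind-nonneg (miss P a ts)) (ind-nonneg (confused P r a ts))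

    0≤error : ∀ P a ts r → 0ℚ ≤ error P a ts r
    0≤error P a ts r = E-nonneg (λ x → 0≤hazard P r a (ts [ r ]≔ (a ⊕ x)))

    E₃ : (Cube n → Tuple → Cube p → ℚ) → ℚ
    E₃ F = E n (λ a → EV q (λ ts → E p (λ u → F a ts u)))

    E₃-const : (F : Cube n → Tuple → ℚ) → E₃ (λ a ts _ → F a ts) ≡ E n (λ a → EV q (F a))
    E₃-const F = E-cong λ a → E-cong λ w → E-const p (F a (chunks q w))

    E₃-+ : (F H : Cube n → Tuple → Cube p → ℚ) → E₃ (λ a ts u → F a ts u + H a ts u) ≡ E₃ F + E₃ H
    E₃-+ F H = trans (E-cong λ a → trans (E-cong λ w → E-+ (F a (chunks q w)) (H a (chunks q w)))
        (E-+ (λ w → E p (F a (chunks q w))) (λ w → E p (H a (chunks q w)))))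
      (E-+ (λ a → EV q (λ ts → E p (F a ts))) (λ a → EV q (λ ts → E p (H a ts))))

    E₃-*ˡ : ∀ k (F : Cube n → Tuple → Cube p → ℚ) → E₃ (λ a ts u → k * F a ts u) ≡ k * E₃ F
    E₃-*ˡ k F = trans (E-cong λ a → trans (E-cong λ w → E-*ˡ k (F a (chunks q w)))
        (E-*ˡ k (λ w → E p (F a (chunks q w)))))
      (E-*ˡ k (λ a → EV q (λ ts → E p (F a ts))))

    -- For fixed `a` and position, `a ⊕ x` is uniform and `EV-update` applies: the second subcube
    -- may be treated as an unmodified random one, with the position still uniform.
    E₃-error : ∀ P → E₃ (λ a ts u → error P a ts (block u)) ≡ E₃ (λ a ts u → hazard P (block u) a ts)
    E₃-error P = E-cong λ a → begin
      EV q (λ ts → E p (λ u → error P a ts (block u)))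
        ≡⟨ E-swap (q ℕ.* n) p (λ w u → error P a (chunks q w) (block u)) ⟩
      E p (λ u → EV q (λ ts → E n (λ x → hazard P (block u) a (ts [ block u ]≔ (a ⊕ x)))))
        ≡⟨ E-cong (λ (u : Cube p) → E-cong λ w → E-⊕ˡ a (λ x → hazard P (block u) a (chunks q w [ block u ]≔ x))) ⟩
      E p (λ u → EV q (λ ts → E n (λ x → hazard P (block u) a (ts [ block u ]≔ x))))
        ≡⟨ E-cong (λ (u : Cube p) → EV-update q (block u) (hazard P (block u) a)) ⟩
      E p (λ u → EV q (λ ts → hazard P (block u) a ts))
        ≡⟨ E-swap (q ℕ.* n) p (λ w u → hazard P (block u) a (chunks q w)) ⟨
      EV q (λ ts → E p (λ u → hazard P (block u) a ts)) ∎
      where open ≡-Reasoning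

    -- A union bound joined with Markov's inequality at the threshold 1/100: this dominates the
    -- indicator of a bad coin string and has a computable mean.
    fail : Affine n → Cube n → Tuple → Cube p → ℚ
    fail P a ts u = ind (miss P a ts) + fromℕ 100 * error P a ts (block u)

    -- The first `e * e` is for a miss on the first subcube; the bracket collects a miss and a
    -- confusion on the second.
    failBound : ℕ
    failBound = e ℕ.* e ℕ.+ 100 ℕ.* (e ℕ.* e ℕ.+ N)

    fail-rare : ∀ P → InList f ε′ P → fromℕ q * E₃ (fail P) ≤ fromℕ failBound
    fail-rare P listed = begin
      fromℕ q * E₃ (fail P)
        ≡⟨ cong (fromℕ q *_) (trans (E₃-+ (λ a ts _ → ind (miss P a ts)) (λ a ts u → fromℕ 100 * error P a ts (block u)))
             (cong₂ _+_ (E₃-const (λ a ts → ind (miss P a ts)))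
               (trans (E₃-*ˡ (fromℕ 100) (λ a ts u → error P a ts (block u))) (cong (fromℕ 100 *_) hazard≡)))) ⟩
      fromℕ q * (m + fromℕ 100 * (m + k))
        ≡⟨ solve 4 (λ q h m k → q :* (m :+ h :* (m :+ k)) := q :* m :+ h :* (q :* m :+ q :* k)) refl (fromℕ q) (fromℕ 100) m k ⟩
      fromℕ q * m + fromℕ 100 * (fromℕ q * m + fromℕ q * k)
        ≤⟨ +-mono-≤ (miss-rare P listed) (*-monoˡ (0≤fromℕ 100) (+-mono-≤ (miss-rare P listed) confused≤)) ⟩
      fromℕ e ² + fromℕ 100 * (fromℕ e ² + fromℕ N)
        ≡⟨ trans (fromℕ-+ (e ℕ.* e) (100 ℕ.* (e ℕ.* e ℕ.+ N))) (cong₂ _+_ (fromℕ-* e e)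
             (trans (fromℕ-* 100 (e ℕ.* e ℕ.+ N)) (cong (fromℕ 100 *_) (trans (fromℕ-+ (e ℕ.* e) N) (cong (_+ fromℕ N) (fromℕ-* e e)))))) ⟨
      fromℕ failBound ∎
      where
      open ≤-Reasoning
      m k : ℚ
      m = E n (λ a → EV q (λ ts → ind (miss P a ts)))
      k = E₃ (λ a ts u → ind (confused P (block u) a ts))
      hazard≡ : E₃ (λ a ts u → error P a ts (block u)) ≡ m + k
      hazard≡ = trans (E₃-error P) (trans (E₃-+ (λ a ts _ → ind (miss P a ts)) (λ a ts u → ind (confused P (block u) a ts)))
        (cong (_+ k) (E₃-const (λ a ts → ind (miss P a ts)))))
      confused≤ : fromℕ q * k ≤ fromℕ N
      confused≤ = subst (_≤ fromℕ N)
        (trans (E-cong λ a → E-*ˡ (fromℕ q) (λ w → E p (λ u → ind (confused P (block u) a (chunks q w)))))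
          (E-*ˡ (fromℕ q) (λ a → EV q (λ ts → E p (λ u → ind (confused P (block u) a ts))))))
        (E-≤const λ a → E-≤const λ w → confused-rare P a (chunks q w))

    E-coins : (F : Cube n → Tuple → Cube p → ℚ) → E coins (λ ω → F (base ω) (tuple ω) (index ω)) ≡ E₃ F
    E-coins F = trans (E-++ n (λ ω → F (base ω) (tuple ω) (index ω))) (E-cong λ a → trans
      (E-cong λ w → cong₂ (λ a′ w′ → F a′ (chunks q (take (q ℕ.* n) w′)) (drop (q ℕ.* n) w′)) (take-++ a w) (drop-++ a w))
      (trans (E-++ (q ℕ.* n) (λ w → F a (chunks q (take (q ℕ.* n) w)) (drop (q ℕ.* n) w)))
        (E-cong λ v → E-cong λ u → cong₂ (λ v′ u′ → F a (chunks q v′) u′) (take-++ v u) (drop-++ v u))))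

    good : Affine n → Cube coins → Bool
    good P ω = not (miss P (base ω) (tuple ω)) ∧ does (error P (base ω) (tuple ω) (position ω) ≤? ℤ.+ 1 / 100)

    bad≤fail : ∀ P ω → ind (not (good P ω)) ≤ fail P (base ω) (tuple ω) (index ω)
    bad≤fail P ω = go (miss P (base ω) (tuple ω)) (x ≤? ℤ.+ 1 / 100)
      where
      x = error P (base ω) (tuple ω) (position ω)
      0≤100x : 0ℚ ≤ fromℕ 100 * x
      0≤100x = 0≤* (0≤fromℕ 100) (0≤error P (base ω) (tuple ω) (position ω))
      go : ∀ β (d : Dec (x ≤ ℤ.+ 1 / 100)) → ind (not (not β ∧ does d)) ≤ ind β + fromℕ 100 * x
      go true  d       = ≤-from-gap (fromℕ 100 * x) 0≤100x refl
      go false (yes _) = subst (0ℚ ≤_) (sym (+-identityˡ (fromℕ 100 * x))) 0≤100x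
      go false (no  l) = subst (1ℚ ≤_) (sym (+-identityˡ (fromℕ 100 * x)))
        (subst (_≤ fromℕ 100 * x) (*-/ 1 100) (*-monoˡ (0≤fromℕ 100) (<⇒≤ (≰⇒> l))))

    -- A finite set of representatives for the union bound: the listed functions of `f` itself, each
    -- up to pointwise equality. It serves the analysis only; no program computes it.
    Ps : List (Affine n)
    Ps = List.map (toAffine f) (theList (½ - ε′) f)

    Ps-listed : All (InList f ε′) Ps
    Ps-listed = All.map⁺ (All.tabulate (theList-sound (½ - ε′) f))

    Ps-length : length Ps ℕ.≤ N
    Ps-length = list-bound f 0<η e 1≤eη Ps (theList-distinct (½ - ε′) f) (All.map (λ {P} → weaken P) Ps-listed)
      where
      weaken : ∀ P → InList f ε′ P → InList f η P
      weaken P δ≤ = ≤-trans δ≤ (≤-from-gap η (<⇒≤ 0<η) (solve 1 (λ e → con ½ :- e :* con ½ := (con ½ :- e) :+ e :* con ½) refl ε′))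

    allGood? : (ω : Cube coins) → Dec (All (λ P → good P ω ≡ true) Ps)
    allGood? ω = All.all? (λ P → good P ω Bool.≟ true) Ps

    notAll≤sum : ∀ {A : Set c} (β : A → Bool) l → ind (not (does (All.all? (λ x → β x Bool.≟ true) l))) ≤ sumL (λ x → ind (not (β x))) l
    notAll≤sum β [] = ≤-refl
    notAll≤sum β (x ∷ l) with β x
    ... | true  = subst (ind (not (does (All.all? (λ x → β x Bool.≟ true) l))) ≤_) (sym (+-identityˡ _)) (notAll≤sum β l)
    ... | false = ≤-from-gap (sumL (λ x → ind (not (β x))) l) (nonneg l) refl
      where
      nonneg : ∀ l → 0ℚ ≤ sumL (λ x → ind (not (β x))) l
      nonneg []      = ≤-refl
      nonneg (y ∷ l) = 0≤+ (ind-nonneg (not (β y))) (nonneg l)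

    badProb : ℚ
    badProb = E coins (λ ω → ind (not (does (allGood? ω))))

    union-bound : fromℕ q * badProb ≤ fromℕ N * fromℕ failBound
    union-bound = begin
      fromℕ q * badProb
        ≤⟨ *-monoˡ (0≤fromℕ q) (E-mono λ ω → notAll≤sum (λ P → good P ω) Ps) ⟩
      fromℕ q * E coins (λ ω → sumL (λ P → ind (not (good P ω))) Ps)
        ≡⟨ cong (fromℕ q *_) (E-sumL (λ P ω → ind (not (good P ω))) Ps) ⟩
      fromℕ q * sumL (λ P → E coins (λ ω → ind (not (good P ω)))) Ps
        ≤⟨ each Ps Ps-listed ⟩
      fromℕ (length Ps) * fromℕ failBound
        ≤⟨ *-monoʳ-≤-nonNeg (fromℕ failBound) {{nonNegative (0≤fromℕ failBound)}} (fromℕ-mono Ps-length) ⟩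
      fromℕ N * fromℕ failBound ∎
      where
      open ≤-Reasoning
      one≤ : ∀ P → InList f ε′ P → fromℕ q * E coins (λ ω → ind (not (good P ω))) ≤ fromℕ failBound
      one≤ P listed = ≤-trans (*-monoˡ (0≤fromℕ q) (≤-trans (E-mono (bad≤fail P)) (≤-reflexive (E-coins (fail P))))) (fail-rare P listed)
      each : ∀ Qs → All (InList f ε′) Qs → fromℕ q * sumL (λ P → E coins (λ ω → ind (not (good P ω)))) Qs ≤ fromℕ (length Qs) * fromℕ failBound
      each []       []       = ≤-reflexive (trans (*-zeroʳ (fromℕ q)) (sym (*-zeroˡ (fromℕ failBound))))
      each (P ∷ Qs) (l ∷ ls) = begin
        fromℕ q * (E coins (λ ω → ind (not (good P ω))) + sumL (λ P → E coins (λ ω → ind (not (good P ω)))) Qs)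
          ≡⟨ *-distribˡ-+ (fromℕ q) (E coins (λ ω → ind (not (good P ω)))) (sumL (λ P → E coins (λ ω → ind (not (good P ω)))) Qs) ⟩
        fromℕ q * E coins (λ ω → ind (not (good P ω))) + fromℕ q * sumL (λ P → E coins (λ ω → ind (not (good P ω)))) Qs
          ≤⟨ +-mono-≤ (one≤ P l) (each Qs ls) ⟩
        fromℕ failBound + fromℕ (length Qs) * fromℕ failBound
          ≡⟨ solve 2 (λ k b → b :+ k :* b := (con 1ℚ :+ k) :* b) refl (fromℕ (length Qs)) (fromℕ failBound) ⟩
        (1ℚ + fromℕ (length Qs)) * fromℕ failBound ∎

    goodCoins : List (Cube coins)
    goodCoins = filter allGood? (allPoints coins)

    module _ (large : 4 ℕ.* (N ℕ.* failBound) ℕ.≤ q) where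

      badProb≤¼ : fromℕ 4 * badProb ≤ 1ℚ
      badProb≤¼ = *-cancelˡ-≤-pos {fromℕ 4 * badProb} {1ℚ} (fromℕ q) {{q-positive}} (begin
        fromℕ q * (fromℕ 4 * badProb)
          ≡⟨ solve 3 (λ q h b → q :* (h :* b) := h :* (q :* b)) refl (fromℕ q) (fromℕ 4) badProb ⟩
        fromℕ 4 * (fromℕ q * badProb)
          ≤⟨ *-monoˡ (0≤fromℕ 4) union-bound ⟩
        fromℕ 4 * (fromℕ N * fromℕ failBound)
          ≡⟨ trans (fromℕ-* 4 (N ℕ.* failBound)) (cong (fromℕ 4 *_) (fromℕ-* N failBound)) ⟨
        fromℕ (4 ℕ.* (N ℕ.* failBound))
          ≤⟨ fromℕ-mono large ⟩
        fromℕ q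
          ≡⟨ *-identityʳ (fromℕ q) ⟨
        fromℕ q * 1ℚ ∎)
        where open ≤-Reasoning

      goodCoins-many : 3 ℕ.* 2 ℕ.^ coins ℕ.≤ 4 ℕ.* length goodCoins
      goodCoins-many = fromℕ-cancel (begin
        fromℕ (3 ℕ.* 2 ℕ.^ coins)
          ≡⟨ fromℕ-* 3 (2 ℕ.^ coins) ⟩
        fromℕ 3 * M
          ≤⟨ ≤-from-gap (M * (1ℚ - fromℕ 4 * badProb)) (0≤* (0≤fromℕ (2 ℕ.^ coins)) (gap badProb≤¼))
               (solve 2 (λ m b → con (fromℕ 4) :* (m :* (con 1ℚ :- b)) := con (fromℕ 3) :* m :+ m :* (con 1ℚ :- con (fromℕ 4) :* b)) refl M badProb) ⟩
        fromℕ 4 * (M * (1ℚ - badProb))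
          ≡⟨ cong (λ g → fromℕ 4 * (M * g)) complement ⟨
        fromℕ 4 * (M * E coins (ind ∘ does ∘ allGood?))
          ≡⟨ cong (fromℕ 4 *_) (count≡E allGood?) ⟨
        fromℕ 4 * fromℕ (length goodCoins)
          ≡⟨ fromℕ-* 4 (length goodCoins) ⟨
        fromℕ (4 ℕ.* length goodCoins) ∎)
        where
        open ≤-Reasoning
        M : ℚ
        M = fromℕ (2 ℕ.^ coins)
        ind≡1-ind-not : ∀ β → ind β ≡ - 1ℚ * ind (not β) - (- 1ℚ)
        ind≡1-ind-not true  = refl
        ind≡1-ind-not false = refl
        complement : E coins (ind ∘ does ∘ allGood?) ≡ 1ℚ - badProb
        complement = trans (E-cong λ ω → ind≡1-ind-not (does (allGood? ω)))
          (trans (E-shift (- 1ℚ) (λ ω → - 1ℚ * ind (not (does (allGood? ω)))))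
            (trans (cong (_- (- 1ℚ)) (E-*ˡ (- 1ℚ) (λ ω → ind (not (does (allGood? ω))))))
              (solve 1 (λ b → (:- con 1ℚ) :* b :- (:- con 1ℚ) := con 1ℚ :- b) refl badProb)))

-- From good coins to the guarantee.

module Correctness {c ℓ} (G : AbelianGroup c ℓ) (_≟_ : Decidable (AbelianGroup._≈_ G)) where
  open import Data.Bool using (Bool; true; false; not; _∧_; T)
  open import Data.Empty using (⊥-elim)
  open import Data.Fin using (Fin)
  import Data.Integer as ℤ
  open import Data.List as List using (List; []; _∷_; length; upTo)
  import Data.List.Properties as List
  open import Data.List.Membership.Propositional using (_∈_; lose)
  open import Data.List.Membership.Propositional.Properties using (∈-map⁺; ∈-upTo⁺)
  open import Data.List.Relation.Unary.All as All using (All)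
  import Data.List.Relation.Unary.All.Properties as All
  open import Data.List.Relation.Unary.Any using (Any)
  import Data.List.Relation.Unary.Any.Properties as Any
  open import Data.List.Relation.Unary.Unique.Propositional using (Unique)
  import Data.List.Relation.Unary.Unique.Propositional.Properties as Unique
  open import Data.Maybe using (just)
  open import Data.Nat as ℕ using (ℕ; suc)
  import Data.Nat.Properties as ℕₚ
  open import Data.Product using (∃; _×_; _,_; proj₁; proj₂)
  open import Data.Rational hiding (_≟_; _≥_; _>_)
  open import Data.Rational.Properties hiding (_≟_)
  open import Data.Vec using (Vec; []; _∷_; lookup; _[_]≔_)
  import Data.Vec.Properties as Vec
  open import Function using (_∘_)
  open import Relation.Binary.PropositionalEquality
  open import Relation.Nullary using (Dec; yes; no; does)

  open AbelianGroup G using (Carrier; _≈_)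
    renaming (refl to ≈-refl; sym to ≈-sym; trans to ≈-trans; reflexive to ≈-reflexive)
  open WithGroup G _≟_
  open Expectation
  open ListBound G _≟_
  open Programs using (Cand; correctorD; nth)
  open ProgramSemantics G _≟_
  open LocalLists G _≟_
  open Geometry
  open Correction G _≟_

  not≡false⇒ : ∀ {a} {A : Set a} (d : Dec A) → not (does d) ≡ false → A
  not≡false⇒ (yes x) _ = x

  not-true : ∀ β → not β ≡ true → β ≡ false
  not-true false _ = refl

  does⇒ : ∀ {a} {A : Set a} (d : Dec A) → does d ≡ true → A
  does⇒ (yes x) _ = x

  module _ {ε : ℚ} (0<ε : 0ℚ < ε) (e : ℕ) (1≤eη : 1ℚ ≤ fromℕ e * (ε * ½)) (p : ℕ) {n} (f : Cube n → Carrier) where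

    open Algorithm ε p n
    open Decoder 0<ε e 1≤eη p f

    pullback-listed : ∀ P a (ts : Tuple) → localδ P a ts ≤ τ → InList (f ∘ embed a ts) η (proj₁ (pullback a ts P))
    pullback-listed P a ts = subst (_≤ τ) (sym (δ-congʳ (f ∘ embed a ts) (proj₂ (pullback a ts P))))

    local-candidate : ∀ P a (ts : Tuple) → localδ P a ts ≤ τ →
      ∃ λ γ → γ ∈ theList τ (f ∘ embed a ts) × (∀ y → value (f ∘ embed a ts) γ y ≈ ⟦ P ⟧ (embed a ts y))
    local-candidate P a ts close =
      let γ , γ∈ , γ≈ = theList-complete (f ∘ embed a ts) 0<η (proj₁ (pullback a ts P)) (pullback-listed P a ts close)
      in γ , γ∈ , λ y → ≈-trans (γ≈ y) (proj₂ (pullback a ts P) y)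

    module _ (P : Affine n) (ω : Cube coins) {j : ℕ} {γ₀ : Cand (blocks q)}
      (nth≡ : nth j (theList τ (f ∘ embed (base ω) (tuple ω))) ≡ just γ₀)
      (γ₀≈  : ∀ y → value (f ∘ embed (base ω) (tuple ω)) γ₀ y ≈ ⟦ P ⟧ (embed (base ω) (tuple ω) y))
      (x : Cube n) where

      private
        a : Cube n
        a = base ω
        r : Fin q
        r = position ω
        ts ts′ : Tuple
        ts  = tuple ω
        ts′ = ts [ r ]≔ (a ⊕ x)
        F₁ : Cube (blocks q) → Carrier
        F₁ = f ∘ embed a ts′
        p₁ : Cube (blocks q) → Carrier
        p₁ = ⟦ P ⟧ ∘ embed a ts′

      embed-x : embed a ts′ (dictator r) ≡ x
      embed-x = trans (embed-dictator a ts′ r) (trans (cong (a ⊕_) (Vec.lookup∘update r ts (a ⊕ x))) (⊕-cancel a x))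

      determined : confused P r a ts′ ≡ false →
        ∀ γ → γ ∈ theList τ F₁ → (∀ y → value F₁ γ (forget r y) ≈ p₁ (forget r y)) → value F₁ γ (dictator r) ≈ p₁ (dictator r)
      determined unconfused γ γ∈ agrees = decide (value F₁ γ (dictator r) ≟ p₁ (dictator r))
        where
        decide : Dec (value F₁ γ (dictator r) ≈ p₁ (dictator r)) → value F₁ γ (dictator r) ≈ p₁ (dictator r)
        decide (yes e) = e
        decide (no ne) = ⊥-elim (subst T unconfused (Any.any⁺ (rival P r a ts′) (lose γ∈ (≡⇒T
          (cong₂ _∧_ (≈⇒same (value F₁ γ ∘ forget r) (p₁ ∘ forget r) agrees) (cong not (eqb-false ne)))))))

      runPsi≡ : runPsi f (ψ ω j) [] x ≡ evalT (f ∘ points ω x) (evalD (f ∘ points ω x) (correctorD τ (forget r) (dictator r) j))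
      runPsi≡ = trans (runPsi≡result f (ψ ω j) [] x)
        (Runs.output (program-runs f (suc (blocks q)) (points ω x) (correctorD τ (forget r) (dictator r) j)))

      ψ-correct : localδ P a ts′ ≤ τ → confused P r a ts′ ≡ false → runPsi f (ψ ω j) [] x ≈ ⟦ P ⟧ x
      ψ-correct close unconfused =
        let γ₁ , γ₁∈ , γ₁≈ = local-candidate P a ts′ close in
        ≈-trans (≈-reflexive runPsi≡)
          (≈-trans (corrector-correct τ (forget r) (dictator r) (f ∘ points ω x) {j} {γ₀} {γ₁} (⟦ P ⟧ ∘ embed a ts) p₁
              nth≡ γ₀≈ γ₁∈ γ₁≈ (λ y → ≈-reflexive (cong ⟦ P ⟧ (sym (embed-forget a ts r (a ⊕ x) y)))) (determined unconfused))
            (≈-reflexive (cong ⟦ P ⟧ embed-x)))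

      -- With the j-th function on the first subcube fixed as `P`, a wrong output at `x` can only
      -- come from the second subcube: `P` is missing from its list or has a rival there.
      differ≤hazard : differ (runPsi f (ψ ω j) []) ⟦ P ⟧ x ≤ hazard P r a ts′
      differ≤hazard = go (miss P a ts′) (confused P r a ts′) refl refl
        where
        d = eqb (runPsi f (ψ ω j) [] x) (⟦ P ⟧ x)
        go : ∀ m k → miss P a ts′ ≡ m → confused P r a ts′ ≡ k → ind (not d) ≤ ind m + ind k
        go true  k     _ _  = ≤-trans (ind≤1 (not d)) (≤-from-gap (ind k) (ind-nonneg k) refl)
        go false true  _ _  = ind≤1 (not d)
        go false false m≡ k≡ = ≤-reflexive (cong (ind ∘ not) (eqb-true (ψ-correct (not≡false⇒ (localδ P a ts′ ≤? τ) m≡) k≡)))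

    ψ-close : ∀ P ω {j γ₀} → nth j (theList τ (f ∘ embed (base ω) (tuple ω))) ≡ just γ₀ →
      (∀ y → value (f ∘ embed (base ω) (tuple ω)) γ₀ y ≈ ⟦ P ⟧ (embed (base ω) (tuple ω) y)) →
      δ (runPsi f (ψ ω j) []) ⟦ P ⟧ ≤ error P (base ω) (tuple ω) (position ω)
    ψ-close P ω {j} nth≡ γ₀≈ = subst (_≤ error P (base ω) (tuple ω) (position ω)) (sym (δ≡E (runPsi f (ψ ω j) []) ⟦ P ⟧))
      (E-mono (differ≤hazard P ω nth≡ γ₀≈))

    module _ (L : ℕ) (maxL : IsMaxListSize η L) where

      -- `maxL` covers all dimensions, in particular that of the subcube; so `L` indices exhaust the
      -- local list for all coins.
      localList-length : ∀ (F : Cube (blocks q) → Carrier) → length (theList τ F) ℕ.≤ L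
      localList-length F = subst (ℕ._≤ L) (List.length-map (toAffine F) (theList τ F))
        (proj₁ maxL (blocks q) F (List.map (toAffine F) (theList τ F)) (theList-distinct τ F)
          (All.map⁺ (All.tabulate (theList-sound τ F))))

      good⇒Any : ∀ P ω → good P ω ≡ true → ∃ λ j → j ℕ.< L × δ (runPsi f (ψ ω j) []) ⟦ P ⟧ ≤ ℤ.+ 1 / 100
      good⇒Any P ω g =
        let m , close = ∧-true (not (miss P (base ω) (tuple ω))) _ g
            γ₀ , γ₀∈ , γ₀≈ = local-candidate P (base ω) (tuple ω)
              (not≡false⇒ (localδ P (base ω) (tuple ω) ≤? τ) (not-true _ m))
            j , j< , nth≡ = ∈⇒nth (theList τ (f ∘ embed (base ω) (tuple ω))) γ₀∈
        in j , ℕₚ.<-≤-trans j< (localList-length (f ∘ embed (base ω) (tuple ω)))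
             , ≤-trans (ψ-close P ω nth≡ γ₀≈) (does⇒ (error P (base ω) (tuple ω) (position ω) ≤? ℤ.+ 1 / 100) close)

      -- Goodness is known only for the representatives `Ps`; it passes to an arbitrary listed `P`
      -- because distance respects pointwise equality.
      allGood⇒Good : ∀ ω → All (λ P → good P ω ≡ true) Ps → Good f ε (A L) ω
      allGood⇒Good ω goods P listed =
        let γ , γ∈ , γ≈ = theList-complete f 0<ε P listed
            j , j<L , close = good⇒Any (toAffine f γ) ω (All.lookup goods (∈-map⁺ (toAffine f) γ∈))
        in Any.map⁺ (lose (∈-upTo⁺ j<L) (subst (_≤ ℤ.+ 1 / 100) (δ-congʳ (runPsi f (ψ ω j) []) γ≈) close))

      ψ-queries : ∀ ω j x → queries f (ψ ω j x) [] ≡ 2 ℕ.^ suc (blocks q)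
      ψ-queries ω j x = Runs.cost (program-runs f (suc (blocks q)) (points ω x)
        (correctorD τ (forget (position ω)) (dictator (position ω)) j))

      guarantee : 4 ℕ.* (N ℕ.* failBound) ℕ.≤ q →
          (∀ ω → queries f (A L ω) [] ℕ.≤ 2 ℕ.^ suc (blocks q))
        × (∀ ω → numOut f (A L) ω ℕ.≤ L)
        × (∀ ω → PsiQueryBound f (A L) ω (2 ℕ.^ suc (blocks q)))
        × (∃ λ S → Unique S × (3 ℕ.* 2 ℕ.^ coins ℕ.≤ 4 ℕ.* length S) × All (Good f ε (A L)) S)
      guarantee large =
          (λ ω → ℕ.z≤n)
        , (λ ω → ℕₚ.≤-reflexive (trans (List.length-map (ψ ω) (upTo L)) (List.length-upTo L)))
        , (λ ω → All.map⁺ (All.tabulate λ {j} _ x → ℕₚ.≤-reflexive (ψ-queries ω j x)))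
        , goodCoins
        , Unique.filter⁺ allGood? (allPoints-unique coins)
        , goodCoins-many large
        , All.map (λ {ω} → allGood⇒Good ω) (All.all-filter allGood? (allPoints coins))

-- Choice of parameters in terms of `ε`.

module Parameters where
  import Data.Integer as ℤ
  open import Data.Nat as ℕ using (ℕ; zero; suc)
  import Data.Nat.Properties as ℕₚ
  open import Data.Rational
  open import Data.Rational.Properties
  open import Data.Rational.Solver using (module +-*-Solver)
  open import Relation.Binary.PropositionalEquality

  open +-*-Solver using (solve; _:+_; _:*_; _:=_; con)
  open Expectation
  open Constants
  open Geometry

  -- Twice the denominator of `ε`: multiplied by ε/2 it gives the numerator, which is at least 1 for
  -- positive `ε`.
  inverseBound : ℚ → ℕ
  inverseBound ε = ↧ₙ ε ℕ.+ ↧ₙ ε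

  1≤inverseBound*η : ∀ {ε} → 0ℚ < ε → 1ℚ ≤ fromℕ (inverseBound ε) * (ε * ½)
  1≤inverseBound*η {ε} 0<ε = subst (1ℚ ≤_) (sym (begin
    fromℕ (d ℕ.+ d) * (ε * ½)          ≡⟨ cong (_* (ε * ½)) (fromℕ-+ d d) ⟩
    (fromℕ d + fromℕ d) * (ε * ½)      ≡⟨ solve 2 (λ d e → (d :+ d) :* (e :* con ½) := d :* e) refl (fromℕ d) ε ⟩
    fromℕ d * ε                        ∎)) (numerator ε (positive 0<ε))
    where
    open ≡-Reasoning
    d = ↧ₙ ε
    numerator : ∀ ε → Positive ε → 1ℚ ≤ fromℕ (↧ₙ ε) * ε
    numerator ε@(mkℚ (ℤ.+ suc k) _ _) _ = subst (1ℚ ≤_)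
      (trans (sym (*-/ (suc k) (↧ₙ ε))) (cong (fromℕ (↧ₙ ε) *_) (↥p/↧p≡p ε)))
      (≤-from-gap (fromℕ k) (0≤fromℕ k) refl)

  -- The number of points that the union bound requires for failure probability 1/4, used as an
  -- exponent: 2^p exceeds p, so no logarithm is taken.
  logPoints : ℚ → ℕ
  logPoints ε = 4 ℕ.* (N ℕ.* (e ℕ.* e ℕ.+ 100 ℕ.* (e ℕ.* e ℕ.+ N)))
    where
    e = inverseBound ε
    N = listBound e

  n<blocks : ∀ n → n ℕ.< blocks n
  n<blocks zero    = ℕ.s≤s ℕ.z≤n
  n<blocks (suc n) = ℕₚ.≤-trans (ℕ.s≤s (n<blocks n)) (ℕₚ.+-monoˡ-≤ (blocks n) (ℕₚ.≤-trans (ℕ.s≤s ℕ.z≤n) (n<blocks n)))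

  -- Two subcubes of dimension 2^q, with q = 2^p, are read completely.
  queryBound : ℚ → ℕ
  queryBound ε = 2 ℕ.^ suc (blocks (blocks (logPoints ε)))

open import Data.Nat using (_≤_; _*_; _^_; suc)
open import Data.Nat.Logarithm using (⌊log₂_⌋)
open import Data.Nat.Properties using (≤-trans; <⇒≤; m≤m*n; m≤m+n)
open import Data.Rational using (0ℚ; ½) renaming (_<_ to _<ℚ_; _*_ to _*ℚ_)
open import Data.Vec using (Vec; [])
open import Data.Bool using (Bool)
open import Data.List using (List; length)
open import Data.List.Relation.Unary.All using (All)
open import Data.List.Relation.Unary.Unique.Propositional using (Unique)
open import Data.Product using (Σ; _×_; _,_)

theorem5p1 : ∀ {c ℓ} → Σ ℕ λ C → Σ (ℚ → ℕ) λ Q →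
    (G : AbelianGroup c ℓ) (_≟_ : Decidable (AbelianGroup._≈_ G))
    (ε : ℚ) → 0ℚ <ℚ ε →
    (L : ℕ) → WithGroup.IsMaxListSize G _≟_ (ε *ℚ ½) L →
    (n : ℕ) →
    Σ ℕ λ r → Σ (RandAlg n r) λ A →
    (f : Cube n → AbelianGroup.Carrier G) →
    (∀ ω → WithGroup.queries G _≟_ f (A ω) [] ≤ Q ε)
    × (∀ ω → WithGroup.numOut G _≟_ f A ω ≤ C * (L * suc ⌊log₂ L ⌋))
    × (∀ ω → WithGroup.PsiQueryBound G _≟_ f A ω (Q ε))
    × (Σ (List (Vec Bool r)) λ S →
    Unique S × (3 * 2 ^ r ≤ 4 * length S)
    × All (WithGroup.Good G _≟_ f ε A) S)
-- Exactly `L` oracle algorithms are output, one for each place on the local list, hence the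
-- constant 1.
theorem5p1 = 1 , queryBound , λ G _≟_ ε 0<ε L maxL n →
  let p = logPoints ε in
  Algorithm.coins ε p n , Algorithm.A ε p n L , λ f →
  let queries≤ , outputs≤ , psi≤ , success =
        Correctness.guarantee G _≟_ 0<ε (inverseBound ε) (1≤inverseBound*η 0<ε) p f L maxL (<⇒≤ (n<blocks p))
  in queries≤
   , (λ ω → ≤-trans (outputs≤ ω) (≤-trans (m≤m*n L (suc ⌊log₂ L ⌋)) (m≤m+n (L * suc ⌊log₂ L ⌋) 0)))
   , psi≤
   , success
  where open Parameters
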